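{- Let $q$ and $w$ be integers such that either $2\le q\le 500$ and $w\ge2$, or $q\ge2$ and $w\in\{2,3\}$. Let $p\in\{ -1,1\}$, let $\tau$ be a root of $X^2-pX+q$ and let $\mathcal{D}$ be the minimal norm representative digit set modulo $\tau^w$. Then the width-$w$ non-adjacent form expansion with respect to $\tau$ and $\mathcal{D}$ is optimal if and only if $q=2$ and $w\in\{2,3\}$.
   Context: $\mathbb{Z}[\tau]=\{a+b\tau: a,b\in\mathbb{Z}\}$. The minimal norm representative digit set modulo $\tau^w$ is the set $\mathcal{D}\subseteq\mathbb{Z}[\tau]$ consisting of $0$ together with, for each residue class of $\mathbb{Z}[\tau]$ modulo $\tau^w$ whose elements are not divisible by $\tau$, a representative of minimal absolute value. A digit expansion of $z$ is a finite sum $z=\sum_{\ell=0}^{L-1}\sigma_\ell\tau^\ell$ with $\sigma_\ell\in\mathcal{D}$. It is a width-$w$ non-adjacent form ($w$-NAF) if every block $\sigma_\ell\cdots\sigma_{\ell+w-1}$ ($0\le\ell\le L-w$) contains at most one nonzero digit. The weight of an expansion is its number of nonzero digits; an expansion of $z$ is optimal if no expansion of $z$ with digits in $\mathcal{D}$ has smaller weight. The $w$-NAF expansion is optimal if the (unique) $w$-NAF of every element of $\mathbb{Z}[\tau]$ is optimal. -}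

module Defs where

open import Data.Nat using (ℕ; zero; suc; _∸_; _≤_)
open import Data.Integer as ℤ using (ℤ; +_; -_; _-_; 0ℤ; 1ℤ)
open import Data.Product using (_×_; _,_; ∃)
open import Data.Unit using (⊤)
open import Data.Sum using (_⊎_)
open import Data.List using (List; []; _∷_)
open import Relation.Binary.PropositionalEquality using (_≡_; _≢_)
open import Relation.Nullary using (¬_; yes; no)
open import Data.Product.Properties using (≡-dec)

-- Elements a + bτ of ℤ[τ], where τ is a root of X² - pX + q,
-- represented as the pair (a , b).  Arithmetic depends on p and q.
Zτ : Set
Zτ = ℤ × ℤ

zeroτ : Zτ
zeroτ = (0ℤ , 0ℤ)

oneτ : Zτ
oneτ = (1ℤ , 0ℤ)

τ : Zτ
τ = (0ℤ , 1ℤ)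

addτ : Zτ → Zτ → Zτ
addτ (a , b) (c , d) = (a ℤ.+ c , b ℤ.+ d)

subτ : Zτ → Zτ → Zτ
subτ (a , b) (c , d) = (a - c , b - d)

-- (a + bτ)(c + dτ) = ac + (ad + bc)τ + bd τ²,  τ² = pτ - q
mulτ : (p q : ℤ) → Zτ → Zτ → Zτ
mulτ p q (a , b) (c , d) =
  (a ℤ.* c - q ℤ.* (b ℤ.* d) , a ℤ.* d ℤ.+ b ℤ.* c ℤ.+ p ℤ.* (b ℤ.* d))

τpow : (p q : ℤ) → ℕ → Zτ
τpow p q zero = oneτ
τpow p q (suc n) = mulτ p q τ (τpow p q n)

-- Norm N(a + bτ) = (a + bτ)(a + bτ̄) = a² + pab + qb² = |a + bτ|²
norm : (p q : ℤ) → Zτ → ℤ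
norm p q (a , b) = a ℤ.* a ℤ.+ p ℤ.* (a ℤ.* b) ℤ.+ q ℤ.* (b ℤ.* b)

DivByτ : (p q : ℤ) → Zτ → Set
DivByτ p q z = ∃ λ k → z ≡ mulτ p q k τ

CongMod : (p q : ℤ) (w : ℕ) → Zτ → Zτ → Set
CongMod p q w x y = ∃ λ k → subτ x y ≡ mulτ p q k (τpow p q w)

record IsMinNormDigitSet (p q : ℤ) (w : ℕ) (D : Zτ → Set) : Set where
  field
    zero∈D     : D zeroτ
    digitsOk   : ∀ d → D d → d ≡ zeroτ ⊎ ¬ DivByτ p q d
    exists     : ∀ z → ¬ DivByτ p q z → ∃ λ d → D d × CongMod p q w d z
    unique     : ∀ d d′ → D d → D d′ → ¬ DivByτ p q d → CongMod p q w d d′ → d ≡ d′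
    minimal    : ∀ d → D d → ¬ DivByτ p q d → ∀ y → CongMod p q w y d →
                 norm p q d ℤ.≤ norm p q y

eval : (p q : ℤ) → List Zτ → Zτ
eval p q [] = zeroτ
eval p q (σ ∷ σs) = addτ σ (mulτ p q τ (eval p q σs))

weight : List Zτ → ℕ
weight [] = zero
weight (σ ∷ σs) with ≡-dec ℤ._≟_ ℤ._≟_ σ zeroτ
... | yes _ = weight σs
... | no _ = suc (weight σs)

ZerosUpTo : ℕ → List Zτ → Set
ZerosUpTo zero _ = ⊤
ZerosUpTo (suc n) [] = ⊤
ZerosUpTo (suc n) (σ ∷ σs) = (σ ≡ zeroτ) × ZerosUpTo n σs

-- width-w non-adjacent form: any w consecutive digits (the expansion
-- padded with zeros) contain at most one nonzero digit; equivalently every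
-- nonzero digit is followed by w-1 zero digits (where present).
IsNAF : ℕ → List Zτ → Set
IsNAF w [] = ⊤
IsNAF w (σ ∷ σs) = (σ ≢ zeroτ → ZerosUpTo (w ∸ 1) σs) × IsNAF w σs

AllIn : (Zτ → Set) → List Zτ → Set
AllIn D [] = ⊤
AllIn D (σ ∷ σs) = D σ × AllIn D σs

NAFOptimal : (p q : ℤ) (w : ℕ) (D : Zτ → Set) → Set
NAFOptimal p q w D = ∀ (e f : List Zτ) → AllIn D e → AllIn D f → IsNAF w e →
  eval p q e ≡ eval p q f → weight e ≤ weight f

{-# OPTIONS --safe #-}
module Submission where

-- Put θ = pτ, so that θ² = θ - q, and T = ±τ^w, U = T / θ.  If digits satisfy c + U d = c′ + T (e + T), the left-hand side
-- is an expansion of weight 2, while the w-NAF on the right-hand side has weight 3.  Such digits exist because the Voronoi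
-- cells of the lattices T ℤ[θ] and θT ℤ[θ] share part of a boundary line: e + T can be chosen just beyond T/2, and so
-- outside its cell, while d ≈ θT/2 is just inside, and g = θ (e + T) - d is small enough for U g to be a difference c - c′ of
-- digits.  Which choice works depends on T mod 2 and on the signs of B(1, T) and B(θ, T), B the polar form of the norm.
--
-- For q = 2 and w ∈ {2, 3}, comparing the w-NAF with another expansion of the same value digit by digit leaves finitely many
-- carries, and a potential on the resulting states shows that the w-NAF is never heavier.

open import Defs
open import Data.Nat using (ℕ; _≤_; _∸_)
open import Data.Integer using (ℤ; +_; -_; -[1+_]; _+_; _-_; _*_; 0ℤ; 1ℤ; +≤+; +<+)
  renaming (_≤_ to _≤ᶻ_; _<_ to _<ᶻ_)
open import Data.Product using (_×_; _,_; ∃; ∃₂; proj₁; proj₂)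
open import Data.Sum using (_⊎_; inj₁; inj₂)
open import Function.Bundles using (_⇔_; mk⇔)
open import Relation.Binary.PropositionalEquality using (_≡_; _≢_; refl; sym; trans; cong; cong₂; subst; subst₂)

import Data.Nat as ℕ
import Data.Nat.DivMod as ℕ
import Data.Nat.Properties as ℕ
import Data.Integer.Properties as ℤ
open import Data.Integer.Divisibility.Signed using (_∣?_; divides)
open import Data.Integer.Tactic.RingSolver using (solve-∀; solve)
open import Data.Bool using (Bool; true; false; _∧_; T)
open import Data.Fin using (Fin; zero; suc)
open import Data.Fin.Patterns using (0F; 1F; 2F; 3F; 4F)
open import Data.List using (List; []; _∷_; _++_; concatMap)
open import Data.List.Membership.Propositional using (_∈_; find)
open import Data.List.Relation.Unary.All as All using (All; all?)
open import Data.List.Relation.Unary.Any using (Any; here; there; any?)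
open import Data.Product.Properties using (≡-dec)
open import Data.Unit using (⊤; tt)
open import Relation.Nullary using (¬_; Dec; yes; no; contradiction)
open import Relation.Nullary.Decidable using (True; toWitness; map′; ¬?; _×-dec_; _→-dec_; _⊎-dec_)

-- `D` is arbitrary where several elements of a class have minimal norm, that is, on the boundary of
-- the cell of T ℤ[θ]. The digits of a counterexample are therefore taken in the open cell, which
-- forces them into every `D`.
--
-- Write 2(e + T) = T + ρᵉ + σᵉθ and 2d = θT + ρᵈ + σᵈθ. Three demands fix the small corrections.
-- Parity: the halves must exist. Signs: e lies in the cell if ρᵉP + σᵉQ > 0, and d if ρᵈ(P - Q) +
-- σᵈqP < 0, everything else having ample room. Divisibility: q must not divide the first
-- coordinates, as otherwise τ divides the digits.
--
-- By θ² = θ - q, 2Ug = (ρᵉ + σᵉ - σᵈ)T - (ρᵈ + qσᵉ)U. The corrections are chosen so that this is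
-- either qU or (q + 1)U, or 2T - κU with κ one of q - 1, q, q + 1. In the first case c and c′ are
-- multiples of U, plus 1, of about a quarter of this length. In the second case 2T - qU = T + θT
-- puts c near T/2 and c′ near -θT/2.

infixl 6 _⊕_
infixl 7 _⊗_

-- Nonnegative and positive integers

NonNeg Pos : ℤ → Set
NonNeg x = 0ℤ ≤ᶻ x
Pos x = 0ℤ <ᶻ x

lit : ∀ n → NonNeg (+ n)
lit n = +≤+ ℕ.z≤n

_⊕_ : ∀ {x y} → NonNeg x → NonNeg y → NonNeg (x + y)
_⊕_ = ℤ.+-mono-≤

_⊗_ : ∀ {x y} → NonNeg x → NonNeg y → NonNeg (x * y)
_⊗_ {+ m} {+ n} _ _ = subst NonNeg (ℤ.pos-* m n) (lit (m ℕ.* n))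

weaken : ∀ {x} → Pos x → NonNeg x
weaken = ℤ.<⇒≤

pred-NonNeg : ∀ {x} → Pos x → NonNeg (x - 1ℤ)
pred-NonNeg (+<+ (ℕ.s≤s _)) = lit _

suc-Pos : ∀ {x} → NonNeg x → Pos (1ℤ + x)
suc-Pos {+ n} _ = +<+ (ℕ.s≤s ℕ.z≤n)

-- Over ℤ strict positivity means being at least 1, so it can be certified by an identity; the
-- factor k + 1 clears the denominators of rational coefficients.
cert : ∀ k {x y} → NonNeg y → + ℕ.suc k * x ≡ 1ℤ + y → 0ℤ <ᶻ x
cert k {x} h eq = ℤ.*-cancelˡ-<-nonNeg (+ ℕ.suc k)
  (subst (_<ᶻ + ℕ.suc k * x) (sym (ℤ.*-zeroʳ (+ ℕ.suc k))) (subst Pos (sym eq) (suc-Pos h)))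

nonNeg-cert : ∀ k {x y} → NonNeg y → + ℕ.suc k * x ≡ y → 0ℤ ≤ᶻ x
nonNeg-cert k {x} h eq = ℤ.*-cancelˡ-≤-pos 0ℤ x (+ ℕ.suc k)
  (subst₂ _≤ᶻ_ (sym (ℤ.*-zeroʳ (+ ℕ.suc k))) (sym eq) h)

half-NonNeg : ∀ {x} → NonNeg (x + x) → NonNeg x
half-NonNeg {+ n} _ = lit n

-- The Voronoi cell of T ℤ[θ]

-- The inequalities saying that x lies in the open Voronoi cell of the lattice T ℤ[θ]: N is the norm of T, and X and Y are
-- the values B(x, T) and B(x, θT) of the polar form B of the norm.
record Inside (q N X Y : ℤ) : Set where
  constructor inside
  field
    x⁺ : 0ℤ <ᶻ N + X
    x⁻ : 0ℤ <ᶻ N - X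
    y⁺ : 0ℤ <ᶻ q * N + Y
    y⁻ : 0ℤ <ᶻ q * N - Y
    z⁺ : 0ℤ <ᶻ q * N + (Y - X)
    z⁻ : 0ℤ <ᶻ q * N - (Y - X)

flip : ∀ {q N X Y} → Inside q N X Y → Inside q N (- X) (- Y)
flip {q} {N} {X} {Y} (inside a b c d e f) =
  inside b (subst Pos (lem N X) a) d (subst Pos (lem (q * N) Y) c)
    (subst Pos (lem₁ (q * N) X Y) f) (subst Pos (lem₂ (q * N) X Y) e)
  where
  lem : ∀ n x → n + x ≡ n - - x
  lem = solve-∀
  lem₁ : ∀ n x y → n - (y - x) ≡ n + (- y - - x)
  lem₁ = solve-∀
  lem₂ : ∀ n x y → n + (y - x) ≡ n - (- y - - x)
  lem₂ = solve-∀

-- Integrality enters here. Neighbours among 1, θ, θ - 1, -1 have polar forms 1, 2q - 1 and 1, all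
-- nonnegative, so u² ≥ u and v² ≥ v bound the norm of uα + vβ below by u N(α) + v N(β).
-- Inequalities at the two vectors spanning a sector thus carry over to the whole sector.
square-minus : ∀ {u} → NonNeg u → NonNeg (u * u - u)
square-minus {+ 0} _ = lit 0
square-minus {+ ℕ.suc n} _ = subst NonNeg (lem (+ n)) ((lit 1 ⊕ lit n) ⊗ lit n)
  where
  lem : ∀ k → (1ℤ + k) * k ≡ (1ℤ + k) * (1ℤ + k) - (1ℤ + k)
  lem = solve-∀

cone-Pos : ∀ {u v A B C} → NonNeg u → NonNeg v → Pos u ⊎ Pos v → Pos A → Pos B → NonNeg C →
  Pos (u * A + v * B + C)
cone-Pos {u} {v} {A} {B} {C} hu hv (inj₁ pu) pA pB hC =
  cert 0 (pred-NonNeg pA ⊕ pred-NonNeg pu ⊗ weaken pA ⊕ hv ⊗ weaken pB ⊕ hC) (lem u v A B C)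
  where
  lem : ∀ u v A B C → 1ℤ * (u * A + v * B + C) ≡ 1ℤ + (A - 1ℤ + (u - 1ℤ) * A + v * B + C)
  lem = solve-∀
cone-Pos {u} {v} {A} {B} {C} hu hv (inj₂ pv) pA pB hC =
  subst Pos (lem u v A B C) (cone-Pos hv hu (inj₁ pv) pB pA hC)
  where
  lem : ∀ u v A B C → v * B + u * A + C ≡ u * A + v * B + C
  lem = solve-∀

normForm : ℤ → ℤ → ℤ → ℤ
normForm q m n = m * m + m * n + q * (n * n)

-- The three sectors of the upper half plane spanned by the consecutive lattice vectors 1, θ, θ - 1, -1:
-- in each of them the difference is a nonnegative combination of the hypotheses.
gap⁺ : ∀ {q N X Y} → NonNeg (q - 1ℤ) → Inside q N X Y → ∀ m n → ¬ (m ≡ 0ℤ × + n ≡ 0ℤ) →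
  Pos (normForm q m (+ n) * N + (m * X + + n * Y))
gap⁺ {q} {N} {X} {Y} hq (inside x⁺ x⁻ y⁺ y⁻ z⁺ z⁻) = go
  where
  hN : NonNeg N
  hN = half-NonNeg (subst NonNeg (lem N X) (weaken x⁺ ⊕ weaken x⁻))
    where
    lem : ∀ n x → n + x + (n - x) ≡ n + n
    lem = solve-∀
  q≥0 : NonNeg q
  q≥0 = subst NonNeg (lem q) (hq ⊕ lit 1)
    where
    lem : ∀ q → q - 1ℤ + 1ℤ ≡ q
    lem = solve-∀
  sector₁ : ∀ u v → NonNeg u → NonNeg v → Pos u ⊎ Pos v → Pos (normForm q u v * N + (u * X + v * Y))
  sector₁ u v hu hv h = subst Pos (lem q N X Y u v)
    (cone-Pos hu hv h x⁺ y⁺ (square-minus hu ⊗ hN ⊕ hu ⊗ hv ⊗ hN ⊕ q≥0 ⊗ square-minus hv ⊗ hN))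
    where
    lem : ∀ q N X Y u v → u * (N + X) + v * (q * N + Y) + ((u * u - u) * N + u * v * N + q * (v * v - v) * N)
      ≡ (u * u + u * v + q * (v * v)) * N + (u * X + v * Y)
    lem = solve-∀
  sector₂ : ∀ u v → NonNeg u → NonNeg v → Pos u ⊎ Pos v →
    Pos (normForm q (- u) (u + v) * N + (- u * X + (u + v) * Y))
  sector₂ u v hu hv h = subst Pos (lem q N X Y u v)
    (cone-Pos hu hv h z⁺ y⁺ (q≥0 ⊗ square-minus hu ⊗ hN ⊕ q≥0 ⊗ square-minus hv ⊗ hN
      ⊕ (hq ⊕ q≥0) ⊗ hu ⊗ hv ⊗ hN))
    where
    lem : ∀ q N X Y u v → u * (q * N + (Y - X)) + v * (q * N + Y)
      + (q * (u * u - u) * N + q * (v * v - v) * N + (q - 1ℤ + q) * u * v * N)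
      ≡ (- u * - u + - u * (u + v) + q * ((u + v) * (u + v))) * N + (- u * X + (u + v) * Y)
    lem = solve-∀
  sector₃ : ∀ u v → NonNeg u → NonNeg v → Pos u ⊎ Pos v →
    Pos (normForm q (- (u + v)) v * N + (- (u + v) * X + v * Y))
  sector₃ u v hu hv h = subst Pos (lem q N X Y u v)
    (cone-Pos hu hv h x⁻ z⁺ (square-minus hu ⊗ hN ⊕ hu ⊗ hv ⊗ hN ⊕ q≥0 ⊗ square-minus hv ⊗ hN))
    where
    lem : ∀ q N X Y u v → u * (N - X) + v * (q * N + (Y - X))
      + ((u * u - u) * N + u * v * N + q * (v * v - v) * N)
      ≡ (- (u + v) * - (u + v) + - (u + v) * v + q * (v * v)) * N + (- (u + v) * X + v * Y)
    lem = solve-∀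
  go : ∀ m n → ¬ (m ≡ 0ℤ × + n ≡ 0ℤ) → Pos (normForm q m (+ n) * N + (m * X + + n * Y))
  go (+ 0) 0 h = contradiction (refl , refl) h
  go (+ 0) (ℕ.suc n) h = sector₁ (+ 0) (+ ℕ.suc n) (lit _) (lit _) (inj₂ (+<+ (ℕ.s≤s ℕ.z≤n)))
  go (+ ℕ.suc m) n h = sector₁ (+ ℕ.suc m) (+ n) (lit _) (lit _) (inj₁ (+<+ (ℕ.s≤s ℕ.z≤n)))
  go -[1+ m ] n h with ℕ.≤-total (ℕ.suc m) n
  ... | inj₁ m<n =
    subst (λ k → Pos (normForm q -[1+ m ] k * N + (-[1+ m ] * X + k * Y))) (cong +_ (ℕ.m+[n∸m]≡n m<n))
      (sector₂ (+ ℕ.suc m) (+ (n ℕ.∸ ℕ.suc m)) (lit _) (lit _) (inj₁ (+<+ (ℕ.s≤s ℕ.z≤n))))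
  go -[1+ m ] 0 h | inj₂ _ =
    subst (λ k → Pos (normForm q (- k) 0ℤ * N + (- k * X + 0ℤ * Y))) (ℤ.+-identityʳ (+ ℕ.suc m))
      (sector₃ (+ ℕ.suc m) 0ℤ (lit _) (lit _) (inj₁ (+<+ (ℕ.s≤s ℕ.z≤n))))
  go -[1+ m ] n@(ℕ.suc _) h | inj₂ n≤m =
    subst (λ k → Pos (normForm q (- k) (+ n) * N + (- k * X + + n * Y))) (cong +_ (ℕ.m∸n+n≡m n≤m))
      (sector₃ (+ (ℕ.suc m ℕ.∸ n)) (+ n) (lit _) (lit _) (inj₂ (+<+ (ℕ.s≤s ℕ.z≤n))))

-- For λ = m + nθ the quantity is the norm of x + λT minus the norm of x: a point of the open cell
-- is the unique shortest element of its class modulo T. Negating λ and x together reduces the lower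
-- half plane to the upper one.
gap : ∀ {q N X Y} → NonNeg (q - 1ℤ) → Inside q N X Y → ∀ m n → ¬ (m ≡ 0ℤ × n ≡ 0ℤ) →
  Pos (normForm q m n * N + (m * X + n * Y))
gap hq i m (+ n) h = gap⁺ hq i m n h
gap {q} {N} {X} {Y} hq i m n@(-[1+ k ]) h = subst Pos (lem q N X Y m n)
  (gap⁺ hq (flip i) (- m) (ℕ.suc k) λ { (_ , ()) })
  where
  lem : ∀ q N X Y m n → (- m * - m + - m * - n + q * (- n * - n)) * N + (- m * - X + - n * - Y)
    ≡ (m * m + m * n + q * (n * n)) * N + (m * X + n * Y)
  lem = solve-∀

-- Certificates for polynomial identities and inequalities

infixr 5 _▸_

data Env : ℕ → Set where
  ∅ : Env 0
  _▸_ : ∀ {n} → ℤ → Env n → Env (ℕ.suc n)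

lookup : ∀ {n} → Env n → Fin n → ℤ
lookup (x ▸ ρ) zero = x
lookup (x ▸ ρ) (suc i) = lookup ρ i

infix 9 #_
infix 8 :-_
infixl 7 _:*_
infixl 6 _:+_ _:-_

data Expr (n : ℕ) : Set where
  var : Fin n → Expr n
  con : ℤ → Expr n
  _:+_ _:-_ _:*_ : Expr n → Expr n → Expr n
  :-_ : Expr n → Expr n

#_ : ∀ {n} → ℕ → Expr n
# n = con (+ n)

⟦_⟧ : ∀ {n} → Expr n → Env n → ℤ
⟦ var i ⟧ ρ = lookup ρ i
⟦ con c ⟧ ρ = c
⟦ e :+ f ⟧ ρ = ⟦ e ⟧ ρ + ⟦ f ⟧ ρ
⟦ e :- f ⟧ ρ = ⟦ e ⟧ ρ - ⟦ f ⟧ ρ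
⟦ e :* f ⟧ ρ = ⟦ e ⟧ ρ * ⟦ f ⟧ ρ
⟦ :- e ⟧ ρ = - ⟦ e ⟧ ρ

-- Dense polynomials, as coefficient lists in the first variable.
Poly : ℕ → Set
Poly 0 = ℤ
Poly (ℕ.suc n) = List (Poly n)

⟪_⟫ : ∀ {n} → Poly n → Env n → ℤ
⟪_⟫ {0} c ρ = c
⟪_⟫ {ℕ.suc n} [] ρ = 0ℤ
⟪_⟫ {ℕ.suc n} (p ∷ ps) (x ▸ ρ) = ⟪ p ⟫ ρ + x * ⟪ ps ⟫ (x ▸ ρ)

constant : ∀ {n} → ℤ → Poly n
constant {0} c = c
constant {ℕ.suc n} c = constant c ∷ []

variable′ : ∀ {n} → Fin n → Poly n
variable′ zero = constant 0ℤ ∷ constant 1ℤ ∷ []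
variable′ (suc i) = variable′ i ∷ []

_+ₚ_ : ∀ {n} → Poly n → Poly n → Poly n
_+ₚ_ {0} c d = c + d
_+ₚ_ {ℕ.suc n} [] qs = qs
_+ₚ_ {ℕ.suc n} ps@(_ ∷ _) [] = ps
_+ₚ_ {ℕ.suc n} (p ∷ ps) (q ∷ qs) = (p +ₚ q) ∷ (ps +ₚ qs)

_*ₚ_ : ∀ {n} → Poly n → Poly n → Poly n
scale : ∀ {n} → Poly n → Poly (ℕ.suc n) → Poly (ℕ.suc n)
_*ₚ_ {0} c d = c * d
_*ₚ_ {ℕ.suc n} [] qs = []
_*ₚ_ {ℕ.suc n} (p ∷ ps) qs = scale p qs +ₚ (constant 0ℤ ∷ (ps *ₚ qs))
scale p [] = []
scale p (q ∷ qs) = (p *ₚ q) ∷ scale p qs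

isZero : ∀ {n} → Poly n → Bool
isZero {0} (+ 0) = true
isZero {0} _ = false
isZero {ℕ.suc n} [] = true
isZero {ℕ.suc n} (p ∷ ps) = isZero p ∧ isZero ps

normalise : ∀ {n} → Expr n → Poly n
normalise (var i) = variable′ i
normalise (con c) = constant c
normalise (e :+ f) = normalise e +ₚ normalise f
normalise (e :- f) = normalise e +ₚ (constant (- 1ℤ) *ₚ normalise f)
normalise (e :* f) = normalise e *ₚ normalise f
normalise (:- e) = constant (- 1ℤ) *ₚ normalise e

constant-correct : ∀ {n} c (ρ : Env n) → ⟪ constant c ⟫ ρ ≡ c
constant-correct c ∅ = refl
constant-correct c (x ▸ ρ) = trans (cong₂ _+_ (constant-correct c ρ) (ℤ.*-zeroʳ x)) (ℤ.+-identityʳ c)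

variable-correct : ∀ {n} (i : Fin n) ρ → ⟪ variable′ i ⟫ ρ ≡ lookup ρ i
variable-correct zero (x ▸ ρ) = trans (cong₂ (λ a b → a + x * (b + x * 0ℤ)) (constant-correct 0ℤ ρ)
  (constant-correct 1ℤ ρ)) (lem x)
  where
  lem : ∀ x → 0ℤ + x * (1ℤ + x * 0ℤ) ≡ x
  lem = solve-∀
variable-correct (suc i) (x ▸ ρ) = trans (cong₂ _+_ (variable-correct i ρ) (ℤ.*-zeroʳ x)) (ℤ.+-identityʳ _)

+ₚ-correct : ∀ {n} (p q : Poly n) ρ → ⟪ p +ₚ q ⟫ ρ ≡ ⟪ p ⟫ ρ + ⟪ q ⟫ ρ
+ₚ-correct {0} p q ρ = refl
+ₚ-correct {ℕ.suc n} [] q ρ = sym (ℤ.+-identityˡ _)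
+ₚ-correct {ℕ.suc n} (p ∷ ps) [] ρ = sym (ℤ.+-identityʳ _)
+ₚ-correct {ℕ.suc n} (p ∷ ps) (q ∷ qs) (x ▸ ρ) =
  trans (cong₂ (λ a b → a + x * b) (+ₚ-correct p q ρ) (+ₚ-correct ps qs (x ▸ ρ)))
  (lem (⟪ p ⟫ ρ) (⟪ q ⟫ ρ) x (⟪ ps ⟫ (x ▸ ρ)) (⟪ qs ⟫ (x ▸ ρ)))
  where
  lem : ∀ a b x c d → a + b + x * (c + d) ≡ a + x * c + (b + x * d)
  lem = solve-∀

*ₚ-correct : ∀ {n} (p q : Poly n) ρ → ⟪ p *ₚ q ⟫ ρ ≡ ⟪ p ⟫ ρ * ⟪ q ⟫ ρ
scale-correct : ∀ {n} (p : Poly n) qs x ρ → ⟪ scale p qs ⟫ (x ▸ ρ) ≡ ⟪ p ⟫ ρ * ⟪ qs ⟫ (x ▸ ρ)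
*ₚ-correct {0} p q ρ = refl
*ₚ-correct {ℕ.suc n} [] qs ρ = refl
*ₚ-correct {ℕ.suc n} (p ∷ ps) qs (x ▸ ρ) = trans (+ₚ-correct (scale p qs) (constant 0ℤ ∷ (ps *ₚ qs)) (x ▸ ρ))
  (trans (cong₂ (λ a b → a + b) (scale-correct p qs x ρ)
    (cong₂ (λ a b → a + x * b) (constant-correct 0ℤ ρ) (*ₚ-correct ps qs (x ▸ ρ))))
  (lem (⟪ p ⟫ ρ) (⟪ qs ⟫ (x ▸ ρ)) x (⟪ ps ⟫ (x ▸ ρ))))
  where
  lem : ∀ a b x c → a * b + (0ℤ + x * (c * b)) ≡ (a + x * c) * b
  lem = solve-∀
scale-correct p [] x ρ = sym (ℤ.*-zeroʳ (⟪ p ⟫ ρ))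
scale-correct p (q ∷ qs) x ρ = trans (cong₂ (λ a b → a + x * b) (*ₚ-correct p q ρ) (scale-correct p qs x ρ))
  (lem (⟪ p ⟫ ρ) (⟪ q ⟫ ρ) x (⟪ qs ⟫ (x ▸ ρ)))
  where
  lem : ∀ a b x c → a * b + x * (a * c) ≡ a * (b + x * c)
  lem = solve-∀

minus-one-correct : ∀ {n} (p : Poly n) ρ → ⟪ constant (- 1ℤ) *ₚ p ⟫ ρ ≡ - ⟪ p ⟫ ρ
minus-one-correct p ρ = trans (*ₚ-correct (constant (- 1ℤ)) p ρ)
  (trans (cong (_* ⟪ p ⟫ ρ) (constant-correct (- 1ℤ) ρ)) (ℤ.-1*i≡-i _))

normalise-correct : ∀ {n} (e : Expr n) ρ → ⟪ normalise e ⟫ ρ ≡ ⟦ e ⟧ ρ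
normalise-correct (var i) ρ = variable-correct i ρ
normalise-correct (con c) ρ = constant-correct c ρ
normalise-correct (e :+ f) ρ = trans (+ₚ-correct (normalise e) (normalise f) ρ)
  (cong₂ _+_ (normalise-correct e ρ) (normalise-correct f ρ))
normalise-correct (e :- f) ρ = trans (+ₚ-correct (normalise e) _ ρ)
  (cong₂ _+_ (normalise-correct e ρ) (trans (minus-one-correct (normalise f) ρ)
    (cong -_ (normalise-correct f ρ))))
normalise-correct (e :* f) ρ = trans (*ₚ-correct (normalise e) (normalise f) ρ)
  (cong₂ _*_ (normalise-correct e ρ) (normalise-correct f ρ))
normalise-correct (:- e) ρ = trans (minus-one-correct (normalise e) ρ) (cong -_ (normalise-correct e ρ))

isZero-correct : ∀ {n} (p : Poly n) ρ → T (isZero p) → ⟪ p ⟫ ρ ≡ 0ℤ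
isZero-correct {0} (+ 0) ρ _ = refl
isZero-correct {ℕ.suc n} [] ρ _ = refl
isZero-correct {ℕ.suc n} (p ∷ ps) (x ▸ ρ) h with isZero p in eq
... | true = trans (cong₂ (λ a b → a + x * b) (isZero-correct p ρ (subst T (sym eq) _))
  (isZero-correct ps (x ▸ ρ) h))
  (trans (ℤ.+-identityˡ _) (ℤ.*-zeroʳ x))

-- For a concrete expression this evaluates to the unit type if all coefficients of the normal form
-- are 0, so the implicit arguments of this kind are filled in by evaluation.
Vanishes : ∀ {n} → Expr n → Set
Vanishes e = T (isZero (normalise e))

identity : ∀ {n} (e f : Expr n) → {Vanishes (e :- f)} → ∀ ρ → ⟦ e ⟧ ρ ≡ ⟦ f ⟧ ρ
identity e f {h} ρ = ℤ.i-j≡0⇒i≡j (⟦ e ⟧ ρ) (⟦ f ⟧ ρ)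
  (trans (sym (normalise-correct (e :- f) ρ)) (isZero-correct (normalise (e :- f)) ρ h))

-- The terms c, c hᵢ, c hᵢ hⱼ, c hᵢ hⱼ hₖ of a nonnegative combination of hypotheses h ≥ 0, given by position.
data Term : Set where
  const : (c : ℕ) → Term
  lin : (c i : ℕ) → Term
  quad : (c i j : ℕ) → Term
  cubic : (c i j k : ℕ) → Term

-- (k , ts) certifies the positivity of g by the identity (k + 1) g = 1 + Σ ts.
Certificate : Set
Certificate = ℕ × List Term

nth : ∀ {n} → List (Expr n) → ℕ → Expr n
-- An index out of range denotes 0, which is still a nonnegative quantity.
nth [] _ = # 0
nth (h ∷ hs) 0 = h
nth (h ∷ hs) (ℕ.suc i) = nth hs i

term : ∀ {n} → List (Expr n) → Term → Expr n
term hs (const c) = con (+ c)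
term hs (lin c i) = con (+ c) :* nth hs i
term hs (quad c i j) = con (+ c) :* nth hs i :* nth hs j
term hs (cubic c i j k) = con (+ c) :* nth hs i :* nth hs j :* nth hs k

combination : ∀ {n} → List (Expr n) → List Term → Expr n
combination hs [] = # 0
combination hs (t ∷ ts) = term hs t :+ combination hs ts

Certifies : ∀ {n} → List (Expr n) → Expr n → Certificate → Set
Certifies hs g (k , ts) = Vanishes (con (+ ℕ.suc k) :* g :- (# 1 :+ combination hs ts))

Hypotheses : ∀ {n} → Env n → List (Expr n) → Set
Hypotheses ρ [] = ⊤
Hypotheses ρ (h ∷ hs) = NonNeg (⟦ h ⟧ ρ) × Hypotheses ρ hs

nth-NonNeg : ∀ {n} {ρ : Env n} hs → Hypotheses ρ hs → ∀ i → NonNeg (⟦ nth hs i ⟧ ρ)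
nth-NonNeg [] _ i = lit 0
nth-NonNeg (h ∷ hs) (p , _) 0 = p
nth-NonNeg (h ∷ hs) (_ , ps) (ℕ.suc i) = nth-NonNeg hs ps i

term-NonNeg : ∀ {n} {ρ : Env n} hs → Hypotheses ρ hs → ∀ t → NonNeg (⟦ term hs t ⟧ ρ)
term-NonNeg hs ps (const c) = lit c
term-NonNeg hs ps (lin c i) = lit c ⊗ nth-NonNeg hs ps i
term-NonNeg hs ps (quad c i j) = lit c ⊗ nth-NonNeg hs ps i ⊗ nth-NonNeg hs ps j
term-NonNeg hs ps (cubic c i j k) = lit c ⊗ nth-NonNeg hs ps i ⊗ nth-NonNeg hs ps j ⊗ nth-NonNeg hs ps k

combination-NonNeg : ∀ {n} {ρ : Env n} hs → Hypotheses ρ hs → ∀ ts → NonNeg (⟦ combination hs ts ⟧ ρ)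
combination-NonNeg hs ps [] = lit 0
combination-NonNeg hs ps (t ∷ ts) = term-NonNeg hs ps t ⊕ combination-NonNeg hs ps ts

certified : ∀ {n} {ρ : Env n} hs → Hypotheses ρ hs → ∀ g c → {Certifies hs g c} → 0ℤ <ᶻ ⟦ g ⟧ ρ
certified {ρ = ρ} hs ps g (k , ts) {h} = cert k (combination-NonNeg hs ps ts)
  (identity (con (+ ℕ.suc k) :* g) (# 1 :+ combination hs ts) {h} ρ)

-- Voronoi inequalities for explicit digits

-- Here and below U = ±θ^(w-1) and T = θU, with coordinates (u₀ , u₁) and (- q u₁ , u₀ + u₁); M is the norm
-- of U, so that q M is the norm of T, while P = B(1, T) and Q = B(θ, T).
record Small (q M P Q : ℤ) : Set where
  constructor small
  field
    M≥0 : NonNeg M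
    p⁺ : NonNeg (q * M - + 4 * P - 1ℤ)
    p⁻ : NonNeg (q * M + + 4 * P - 1ℤ)
    q⁺ : NonNeg (q * M - + 3 * Q - 1ℤ)
    q⁻ : NonNeg (q * M + + 3 * Q - 1ℤ)

-- The Voronoi inequalities, multiplied by 2, for x with 2x = αT + βU + γθT + ρ + σθ.
record Bounds (q M P Q α β γ ρ σ : ℤ) : Set where
  constructor bounds
  field
    x⁺ : 0ℤ <ᶻ + 2 * (q * M) + ((+ 2 * α + γ) * (q * M) + β * M + ρ * P + σ * Q)
    x⁻ : 0ℤ <ᶻ + 2 * (q * M) - ((+ 2 * α + γ) * (q * M) + β * M + ρ * P + σ * Q)
    y⁺ : 0ℤ <ᶻ q * (+ 2 * (q * M)) + ((α + + 2 * q * γ) * (q * M) - β * ((+ 2 * q - 1ℤ) * M) + ρ * (P - Q)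
      + σ * (q * P))
    y⁻ : 0ℤ <ᶻ q * (+ 2 * (q * M)) - ((α + + 2 * q * γ) * (q * M) - β * ((+ 2 * q - 1ℤ) * M) + ρ * (P - Q)
      + σ * (q * P))
    z⁺ : 0ℤ <ᶻ q * (+ 2 * (q * M)) + (((α + + 2 * q * γ) * (q * M) - β * ((+ 2 * q - 1ℤ) * M) + ρ * (P - Q)
      + σ * (q * P)) - ((+ 2 * α + γ) * (q * M) + β * M + ρ * P + σ * Q))
    z⁻ : 0ℤ <ᶻ q * (+ 2 * (q * M)) - (((α + + 2 * q * γ) * (q * M) - β * ((+ 2 * q - 1ℤ) * M) + ρ * (P - Q)
      + σ * (q * P)) - ((+ 2 * α + γ) * (q * M) + β * M + ρ * P + σ * Q))

𝐪 𝐌 𝐏 𝐐 : ∀ {n} → Expr (4 ℕ.+ n)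
𝐪 = var 0F
𝐌 = var 1F
𝐏 = var 2F
𝐐 = var 3F

𝐚 : ∀ {n} → Expr (5 ℕ.+ n)
𝐚 = var 4F

-- Positions 0 to 5 of the certificates below refer to this list, positions from 6 on to the
-- hypotheses of the particular lemma, beginning with the lower bound for q. Position 1, qM ≥ 1, is
-- half the sum of the two bounds on P.
small-hypotheses : ∀ {n} → List (Expr (4 ℕ.+ n))
small-hypotheses = 𝐌 ∷ 𝐪 :* 𝐌 :- # 1 ∷ 𝐪 :* 𝐌 :- # 4 :* 𝐏 :- # 1 ∷ 𝐪 :* 𝐌 :+ # 4 :* 𝐏 :- # 1 ∷
  𝐪 :* 𝐌 :- # 3 :* 𝐐 :- # 1 ∷ 𝐪 :* 𝐌 :+ # 3 :* 𝐐 :- # 1 ∷ []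

with-small : ∀ {n q M P Q} {ρ : Env n} hs → Small q M P Q → Hypotheses (q ▸ M ▸ P ▸ Q ▸ ρ) hs →
  Hypotheses (q ▸ M ▸ P ▸ Q ▸ ρ) (small-hypotheses ++ hs)
with-small {q = q} {M} {P} _ (small M≥0 p⁺ p⁻ q⁺ q⁻) ps =
  M≥0 , nonNeg-cert 1 (p⁺ ⊕ p⁻) (lem q M P) , p⁺ , p⁻ , q⁺ , q⁻ , ps
  where
  lem : ∀ q M P → + 2 * (q * M - 1ℤ) ≡ q * M - + 4 * P - 1ℤ + (q * M + + 4 * P - 1ℤ)
  lem = solve-∀

module _ {n q M P Q} (ρ : Env n) (hs : List (Expr (4 ℕ.+ n))) (sm : Small q M P Q)
  (ps : Hypotheses (q ▸ M ▸ P ▸ Q ▸ ρ) hs)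
  (α β γ κ σ : Expr (4 ℕ.+ n)) where
  private
    ξ η X Y : Expr (4 ℕ.+ n)
    ξ = (# 2 :* α :+ γ) :* (𝐪 :* 𝐌) :+ β :* 𝐌 :+ κ :* 𝐏 :+ σ :* 𝐐
    η = (α :+ # 2 :* 𝐪 :* γ) :* (𝐪 :* 𝐌) :- β :* ((# 2 :* 𝐪 :- # 1) :* 𝐌) :+ κ :* (𝐏 :- 𝐐) :+ σ :* (𝐪 :* 𝐏)
    X = # 2 :* (𝐪 :* 𝐌)
    Y = 𝐪 :* (# 2 :* (𝐪 :* 𝐌))
    hs′ : List (Expr (4 ℕ.+ n))
    hs′ = small-hypotheses ++ hs
    ps′ : Hypotheses (q ▸ M ▸ P ▸ Q ▸ ρ) hs′
    ps′ = with-small hs sm ps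
    ρ′ : Env (4 ℕ.+ n)
    ρ′ = q ▸ M ▸ P ▸ Q ▸ ρ

  certified-bounds : ∀ x⁺ x⁻ y⁺ y⁻ z⁺ z⁻ →
    {Certifies hs′ (X :+ ξ) x⁺} → {Certifies hs′ (X :- ξ) x⁻} → {Certifies hs′ (Y :+ η) y⁺} →
      {Certifies hs′ (Y :- η) y⁻} →
    {Certifies hs′ (Y :+ (η :- ξ)) z⁺} → {Certifies hs′ (Y :- (η :- ξ)) z⁻} →
    Bounds q M P Q (⟦ α ⟧ ρ′) (⟦ β ⟧ ρ′) (⟦ γ ⟧ ρ′) (⟦ κ ⟧ ρ′) (⟦ σ ⟧ ρ′)
  certified-bounds x⁺ x⁻ y⁺ y⁻ z⁺ z⁻ {a} {b} {c} {d} {e} {f} = bounds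
    (certified hs′ ps′ (X :+ ξ) x⁺ {a}) (certified hs′ ps′ (X :- ξ) x⁻ {b})
      (certified hs′ ps′ (Y :+ η) y⁺ {c}) (certified hs′ ps′ (Y :- η) y⁻ {d})
    (certified hs′ ps′ (Y :+ (η :- ξ)) z⁺ {e}) (certified hs′ ps′ (Y :- (η :- ξ)) z⁻ {f})

-- The lattice vector qU = T - θT limits the cell in the direction of U, so (β/2)U is inside for |β|
-- < q, with room for the summand 1. That summand makes the first coordinate 1 modulo q, since q
-- divides the first coordinate of U.
strip : ∀ {q M P Q β} → Small q M P Q →
  NonNeg (q - + 2) → NonNeg (q - 1ℤ - β) → NonNeg (q - 1ℤ + β) → Bounds q M P Q 0ℤ β 0ℤ (+ 2) 0ℤ
strip {β = β} sm q≥2 β⁺ β⁻ = certified-bounds (β ▸ ∅) (𝐪 :- # 2 ∷ 𝐪 :- # 1 :- 𝐚 ∷ 𝐪 :- # 1 :+ 𝐚 ∷ []) sm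
  (q≥2 , β⁺ , β⁻ , tt)
  (# 0) 𝐚 (# 0) (# 2) (# 0)
  (3 , const 3 ∷ lin 4 0 ∷ lin 1 2 ∷ lin 3 3 ∷ quad 4 8 0 ∷ [])
  (3 , const 3 ∷ lin 4 0 ∷ lin 3 2 ∷ lin 1 3 ∷ quad 4 7 0 ∷ [])
  (5 , const 14 ∷ lin 4 2 ∷ lin 7 3 ∷ lin 4 4 ∷ quad 3 0 6 ∷ quad 18 7 0 ∷ cubic 12 7 6 0 ∷ [])
  (5 , const 14 ∷ lin 7 2 ∷ lin 4 3 ∷ lin 4 5 ∷ quad 3 0 6 ∷ quad 18 8 0 ∷ cubic 12 8 6 0 ∷ [])
  (2 , const 5 ∷ lin 4 4 ∷ lin 2 5 ∷ quad 12 7 0 ∷ cubic 6 7 6 0 ∷ [])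
  (2 , const 5 ∷ lin 4 1 ∷ lin 2 5 ∷ quad 12 8 0 ∷ cubic 6 8 6 0 ∷ [])

-- For β = q the point (q/2)U lies on the boundary. As B(1, qU) = Q, a negative Q means that adding
-- 1 moves it inwards. The families use this value only for q = 2, with c = U + 1.
strip-even : ∀ {q M P Q β} → Small q M P Q →
  NonNeg (q - + 2) → NonNeg (q - β) → NonNeg (q - 1ℤ + β) → NonNeg (P - 1ℤ) → NonNeg (- Q - 1ℤ) →
    Bounds q M P Q 0ℤ β 0ℤ (+ 2) 0ℤ
strip-even {β = β} sm q≥2 β≤q β⁻ P≥1 Q≤-1 =
  certified-bounds (β ▸ ∅) (𝐪 :- # 2 ∷ 𝐪 :- 𝐚 ∷ 𝐪 :- # 1 :+ 𝐚 ∷ 𝐏 :- # 1 ∷ :- 𝐐 :- # 1 ∷ []) sm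
  (q≥2 , β≤q , β⁻ , P≥1 , Q≤-1 , tt)
  (# 0) 𝐚 (# 0) (# 2) (# 0)
  (1 , lin 4 0 ∷ lin 1 3 ∷ quad 1 0 6 ∷ quad 2 8 0 ∷ [])
  (3 , const 3 ∷ lin 3 2 ∷ lin 1 3 ∷ quad 4 7 0 ∷ [])
  (2 , const 4 ∷ lin 1 3 ∷ lin 2 4 ∷ lin 2 9 ∷ quad 9 7 0 ∷ cubic 6 7 6 0 ∷ [])
  (5 , const 14 ∷ lin 7 2 ∷ lin 4 3 ∷ lin 4 5 ∷ quad 3 0 6 ∷ quad 18 8 0 ∷ cubic 12 8 6 0 ∷ [])
  (0 , const 1 ∷ lin 2 10 ∷ quad 4 7 0 ∷ cubic 2 7 6 0 ∷ [])
  (2 , const 5 ∷ lin 2 4 ∷ lin 4 5 ∷ quad 12 8 0 ∷ cubic 6 8 6 0 ∷ [])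

-- The point -T/2 lies on the boundary line of `x⁺`, where the inequality reduces to Q > 0; the
-- other five have slack of order N. All lemmas for e have this pattern, with ρᵉP + σᵉQ in place of
-- Q.
even-e⁺ : ∀ {q M P Q} → Small q M P Q →
  NonNeg (q - + 2) → NonNeg (P - 1ℤ) → NonNeg (Q - 1ℤ) → Bounds q M P Q (- 1ℤ) 0ℤ 0ℤ 0ℤ 1ℤ
even-e⁺ sm q≥2 P≥1 Q≥1 = certified-bounds ∅ (𝐪 :- # 2 ∷ 𝐏 :- # 1 ∷ 𝐐 :- # 1 ∷ []) sm (q≥2 , P≥1 , Q≥1 , tt)
  (:- # 1) (# 0) (# 0) (# 0) (# 1)
  (0 , lin 1 8 ∷ [])
  (2 , const 11 ∷ lin 11 1 ∷ lin 1 4 ∷ [])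
  (3 , const 11 ∷ lin 5 2 ∷ lin 7 3 ∷ lin 8 6 ∷ quad 7 1 6 ∷ quad 1 3 6 ∷ [])
  (3 , const 19 ∷ lin 11 2 ∷ lin 9 3 ∷ lin 8 6 ∷ quad 7 1 6 ∷ quad 1 2 6 ∷ [])
  (11 , const 59 ∷ lin 50 1 ∷ lin 6 3 ∷ lin 4 4 ∷ lin 24 6 ∷ quad 21 1 6 ∷ quad 3 3 6 ∷ [])
  (11 , const 35 ∷ lin 26 1 ∷ lin 6 2 ∷ lin 4 5 ∷ lin 24 6 ∷ quad 21 1 6 ∷ quad 3 2 6 ∷ [])

even-e⁻ : ∀ {q M P Q} → Small q M P Q →
  NonNeg (q - + 2) → NonNeg (- Q - 1ℤ) → Bounds q M P Q (- 1ℤ) 0ℤ 0ℤ 0ℤ (- 1ℤ)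
even-e⁻ sm q≥2 Q≤-1 = certified-bounds ∅ (𝐪 :- # 2 ∷ :- 𝐐 :- # 1 ∷ []) sm (q≥2 , Q≤-1 , tt)
  (:- # 1) (# 0) (# 0) (# 0) (:- # 1)
  (0 , lin 1 7 ∷ [])
  (2 , const 11 ∷ lin 11 1 ∷ lin 1 5 ∷ [])
  (3 , const 11 ∷ lin 7 2 ∷ lin 5 3 ∷ lin 8 6 ∷ quad 7 1 6 ∷ quad 1 2 6 ∷ [])
  (3 , const 19 ∷ lin 18 1 ∷ lin 2 3 ∷ lin 8 6 ∷ quad 7 1 6 ∷ quad 1 3 6 ∷ [])
  (11 , const 59 ∷ lin 50 1 ∷ lin 6 2 ∷ lin 4 5 ∷ lin 24 6 ∷ quad 21 1 6 ∷ quad 3 2 6 ∷ [])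
  (23 , const 71 ∷ lin 26 2 ∷ lin 38 3 ∷ lin 8 4 ∷ lin 48 6 ∷ quad 21 2 6 ∷ quad 27 3 6 ∷ [])

-- The point θT/2 lies on the boundary line of `y⁻`, which reduces to qP > 0. In all lemmas for d
-- the critical inequality is `y⁻`, where -(ρᵈ(P - Q) + σᵈqP) remains.
even-d : ∀ {q M P Q} → Small q M P Q →
  NonNeg (q - + 2) → NonNeg (P - 1ℤ) → Bounds q M P Q 0ℤ 0ℤ 1ℤ 0ℤ (- 1ℤ)
even-d sm q≥2 P≥1 = certified-bounds ∅ (𝐪 :- # 2 ∷ 𝐏 :- # 1 ∷ []) sm (q≥2 , P≥1 , tt)
  (# 0) (# 0) (# 1) (# 0) (:- # 1)
  (2 , const 8 ∷ lin 5 4 ∷ lin 4 5 ∷ [])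
  (2 , const 2 ∷ lin 1 4 ∷ lin 2 5 ∷ [])
  (7 , const 63 ∷ lin 60 1 ∷ lin 4 2 ∷ lin 32 6 ∷ quad 17 2 6 ∷ quad 15 3 6 ∷ [])
  (0 , const 1 ∷ lin 1 6 ∷ lin 2 7 ∷ quad 1 7 6 ∷ [])
  (11 , const 83 ∷ lin 74 1 ∷ lin 6 2 ∷ lin 4 5 ∷ lin 48 6 ∷ quad 45 1 6 ∷ quad 3 2 6 ∷ [])
  (5 , const 5 ∷ lin 1 1 ∷ lin 3 3 ∷ lin 2 4 ∷ lin 6 6 ∷ quad 6 7 6 ∷ [])

-- Together with `even-c′`: from T/2 and -θT/2, a step of -U/2 leads inwards at both, because B(U,
-- T) = M > 0 and B(U, θT) = -(2q - 1)M < 0. By θT = T - qU the second point is (-T + (q - 1)U)/2.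
-- The further summand -1 makes the first coordinates -1 modulo q.
even-c : ∀ {q M P Q} → Small q M P Q →
  NonNeg (q - + 2) → NonNeg (P - 1ℤ) → NonNeg (Q - 1ℤ) → Bounds q M P Q 1ℤ (- 1ℤ) 0ℤ (- (+ 2)) 0ℤ
even-c sm q≥2 P≥1 Q≥1 = certified-bounds ∅ (𝐪 :- # 2 ∷ 𝐏 :- # 1 ∷ 𝐐 :- # 1 ∷ []) sm (q≥2 , P≥1 , Q≥1 , tt)
  (# 1) (:- # 1) (# 0) (:- (# 2)) (# 0)
  (1 , const 6 ∷ lin 4 2 ∷ lin 3 3 ∷ quad 1 0 6 ∷ [])
  (0 , const 1 ∷ lin 1 0 ∷ lin 2 7 ∷ [])
  (5 , const 38 ∷ lin 3 2 ∷ lin 16 4 ∷ lin 20 5 ∷ quad 27 0 6 ∷ cubic 12 0 6 6 ∷ [])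
  (5 , const 8 ∷ lin 1 2 ∷ lin 4 3 ∷ lin 4 4 ∷ quad 21 0 6 ∷ cubic 12 0 6 6 ∷ [])
  (2 , const 14 ∷ lin 13 1 ∷ lin 2 5 ∷ lin 6 6 ∷ quad 6 1 6 ∷ [])
  (2 , const 8 ∷ lin 7 1 ∷ lin 2 4 ∷ lin 6 6 ∷ quad 6 1 6 ∷ [])

even-c′ : ∀ {q M P Q} → Small q M P Q →
  NonNeg (q - + 2) → Bounds q M P Q (- 1ℤ) (q - 1ℤ) 0ℤ (- (+ 2)) 0ℤ
even-c′ sm q≥2 = certified-bounds ∅ (𝐪 :- # 2 ∷ []) sm (q≥2 , tt)
  (:- # 1) (𝐪 :- # 1) (# 0) (:- (# 2)) (# 0)
  (1 , lin 1 2 ∷ quad 1 0 6 ∷ [])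
  (1 , const 5 ∷ lin 2 0 ∷ lin 5 1 ∷ lin 1 3 ∷ [])
  (5 , const 8 ∷ lin 4 2 ∷ lin 1 3 ∷ lin 4 5 ∷ quad 3 0 6 ∷ [])
  (5 , const 38 ∷ lin 32 1 ∷ lin 3 3 ∷ lin 4 4 ∷ quad 45 0 6 ∷ cubic 24 0 6 6 ∷ [])
  (2 , const 8 ∷ lin 7 1 ∷ lin 2 5 ∷ [])
  (5 , const 29 ∷ lin 17 4 ∷ lin 13 5 ∷ lin 24 6 ∷ quad 24 1 6 ∷ [])

mixed-e : ∀ {q M P Q} → Small q M P Q →
  NonNeg (q - + 3) → NonNeg (P - Q - 1ℤ) → Bounds q M P Q (- 1ℤ) 0ℤ 0ℤ 1ℤ (- 1ℤ)
mixed-e sm q≥3 P>Q = certified-bounds ∅ (𝐪 :- # 3 ∷ 𝐏 :- 𝐐 :- # 1 ∷ []) sm (q≥3 , P>Q , tt)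
  (:- # 1) (# 0) (# 0) (# 1) (:- # 1)
  (0 , lin 1 7 ∷ [])
  (11 , const 47 ∷ lin 41 1 ∷ lin 3 2 ∷ lin 4 5 ∷ [])
  (11 , const 59 ∷ lin 50 1 ∷ lin 6 2 ∷ lin 4 4 ∷ lin 24 6 ∷ quad 21 1 6 ∷ quad 3 2 6 ∷ [])
  (11 , const 83 ∷ lin 74 1 ∷ lin 6 3 ∷ lin 4 5 ∷ lin 24 6 ∷ quad 21 1 6 ∷ quad 3 3 6 ∷ [])
  (3 , const 27 ∷ lin 25 1 ∷ lin 3 2 ∷ lin 8 6 ∷ quad 7 1 6 ∷ quad 1 2 6 ∷ [])
  (7 , const 39 ∷ lin 17 2 ∷ lin 23 3 ∷ lin 16 6 ∷ quad 7 2 6 ∷ quad 9 3 6 ∷ [])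

mixed-d : ∀ {q M P Q} → Small q M P Q →
  NonNeg (q - + 3) → NonNeg (P - Q - 1ℤ) → Bounds q M P Q 0ℤ 0ℤ 1ℤ (- 1ℤ) 0ℤ
mixed-d sm q≥3 P>Q = certified-bounds ∅ (𝐪 :- # 3 ∷ 𝐏 :- 𝐐 :- # 1 ∷ []) sm (q≥3 , P>Q , tt)
  (# 0) (# 0) (# 1) (:- # 1) (# 0)
  (3 , const 11 ∷ lin 11 1 ∷ lin 1 2 ∷ [])
  (7 , const 7 ∷ lin 3 2 ∷ lin 5 3 ∷ [])
  (11 , const 143 ∷ lin 137 1 ∷ lin 3 2 ∷ lin 4 5 ∷ lin 48 6 ∷ quad 48 1 6 ∷ [])
  (0 , lin 1 7 ∷ [])
  (2 , const 32 ∷ lin 32 1 ∷ lin 1 5 ∷ lin 12 6 ∷ quad 12 1 6 ∷ [])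
  (2 , const 2 ∷ lin 2 1 ∷ lin 1 4 ∷ [])

unit-e : ∀ {q M P Q} → Small q M P Q →
  NonNeg (q - + 3) → NonNeg (P - 1ℤ) → Bounds q M P Q (- 1ℤ) 0ℤ 0ℤ 1ℤ 0ℤ
unit-e sm q≥3 P≥1 = certified-bounds ∅ (𝐪 :- # 3 ∷ 𝐏 :- # 1 ∷ []) sm (q≥3 , P≥1 , tt)
  (:- # 1) (# 0) (# 0) (# 1) (# 0)
  (0 , lin 1 7 ∷ [])
  (3 , const 15 ∷ lin 15 1 ∷ lin 1 2 ∷ [])
  (11 , const 59 ∷ lin 53 1 ∷ lin 3 3 ∷ lin 4 4 ∷ lin 24 6 ∷ quad 24 1 6 ∷ [])
  (23 , const 167 ∷ lin 83 2 ∷ lin 77 3 ∷ lin 8 5 ∷ lin 48 6 ∷ quad 48 1 6 ∷ [])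
  (2 , const 20 ∷ lin 11 4 ∷ lin 10 5 ∷ lin 6 6 ∷ quad 6 1 6 ∷ [])
  (2 , const 14 ∷ lin 7 4 ∷ lin 8 5 ∷ lin 6 6 ∷ quad 6 1 6 ∷ [])

unit-c : ∀ {q M P Q} → Small q M P Q →
  NonNeg (q - + 3) → NonNeg (P - 1ℤ) → Bounds q M P Q 1ℤ 0ℤ 0ℤ (- 1ℤ) 0ℤ
unit-c sm q≥3 P≥1 = certified-bounds ∅ (𝐪 :- # 3 ∷ 𝐏 :- # 1 ∷ []) sm (q≥3 , P≥1 , tt)
  (# 1) (# 0) (# 0) (:- # 1) (# 0)
  (3 , const 15 ∷ lin 15 1 ∷ lin 1 2 ∷ [])
  (0 , lin 1 7 ∷ [])
  (11 , const 83 ∷ lin 77 1 ∷ lin 3 2 ∷ lin 4 5 ∷ lin 24 6 ∷ quad 24 1 6 ∷ [])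
  (11 , const 59 ∷ lin 53 1 ∷ lin 3 3 ∷ lin 4 4 ∷ lin 24 6 ∷ quad 24 1 6 ∷ [])
  (2 , const 14 ∷ lin 14 1 ∷ lin 1 5 ∷ lin 6 6 ∷ quad 6 1 6 ∷ [])
  (2 , const 20 ∷ lin 20 1 ∷ lin 1 4 ∷ lin 6 6 ∷ quad 6 1 6 ∷ [])

-- The critical inequality becomes P + (q - 1)Q > 0. The shift by (q - 1)/2 is no longer bounded in
-- terms of N by `Small`, whence the hypothesis N > (q + 1)P.
unit-d⁺ : ∀ {q M P Q} → Small q M P Q →
  NonNeg (q - + 3) → NonNeg (P - 1ℤ) → NonNeg (Q - 1ℤ) → NonNeg (q * M - (q + 1ℤ) * P - 1ℤ) →
    Bounds q M P Q 0ℤ 0ℤ 1ℤ (q - 1ℤ) (- 1ℤ)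
unit-d⁺ sm q≥3 P≥1 Q≥1 qP = certified-bounds ∅
  (𝐪 :- # 3 ∷ 𝐏 :- # 1 ∷ 𝐐 :- # 1 ∷ 𝐪 :* 𝐌 :- (𝐪 :+ # 1) :* 𝐏 :- # 1 ∷ []) sm (q≥3 , P≥1 , Q≥1 , qP , tt)
  (# 0) (# 0) (# 1) (𝐪 :- # 1) (:- # 1)
  (2 , const 14 ∷ lin 5 4 ∷ lin 4 5 ∷ lin 3 6 ∷ lin 6 7 ∷ quad 3 7 6 ∷ [])
  (0 , const 3 ∷ lin 2 7 ∷ lin 1 8 ∷ lin 1 9 ∷ [])
  (23 , const 287 ∷ lin 6 2 ∷ lin 149 4 ∷ lin 133 5 ∷ lin 96 6 ∷ quad 52 4 6 ∷ quad 44 5 6 ∷ [])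
  (0 , const 2 ∷ lin 1 6 ∷ lin 1 7 ∷ lin 2 8 ∷ quad 1 8 6 ∷ [])
  (11 , const 131 ∷ lin 119 1 ∷ lin 9 2 ∷ lin 4 4 ∷ lin 48 6 ∷ quad 41 1 6 ∷ quad 3 2 6 ∷ quad 4 4 6 ∷ [])
  (3 , const 4 ∷ lin 3 3 ∷ lin 1 5 ∷ lin 8 6 ∷ lin 1 8 ∷ quad 4 7 6 ∷ quad 4 8 6 ∷ [])

unit-d⁻ : ∀ {q M P Q} → Small q M P Q →
  NonNeg (q - + 3) → NonNeg (P - 1ℤ) → NonNeg (- Q - 1ℤ) → NonNeg (q * M - (q + 1ℤ) * P - 1ℤ) →
    Bounds q M P Q 0ℤ 0ℤ 1ℤ (- q - 1ℤ) 1ℤ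
unit-d⁻ sm q≥3 P≥1 Q≤-1 qP = certified-bounds ∅
  (𝐪 :- # 3 ∷ 𝐏 :- # 1 ∷ :- 𝐐 :- # 1 ∷ 𝐪 :* 𝐌 :- (𝐪 :+ # 1) :* 𝐏 :- # 1 ∷ []) sm (q≥3 , P≥1 , Q≤-1 , qP , tt)
  (# 0) (# 0) (# 1) (:- 𝐪 :- # 1) (# 1)
  (2 , const 8 ∷ lin 5 1 ∷ lin 1 5 ∷ lin 3 9 ∷ [])
  (0 , const 1 ∷ lin 1 3 ∷ lin 1 6 ∷ lin 1 8 ∷ quad 1 7 6 ∷ [])
  (11 , const 143 ∷ lin 125 1 ∷ lin 3 2 ∷ lin 16 5 ∷ lin 48 6 ∷ quad 22 4 6 ∷ quad 26 5 6 ∷ [])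
  (0 , const 4 ∷ lin 1 6 ∷ lin 1 7 ∷ lin 4 8 ∷ quad 1 8 6 ∷ [])
  (11 , const 131 ∷ lin 111 1 ∷ lin 9 3 ∷ lin 12 5 ∷ lin 48 6 ∷ quad 41 1 6 ∷ quad 3 3 6 ∷ quad 4 5 6 ∷ [])
  (0 , const 4 ∷ lin 1 6 ∷ lin 1 7 ∷ lin 3 8 ∷ lin 1 9 ∷ quad 1 8 6 ∷ [])

unit-c′ : ∀ {q M P Q} → Small q M P Q →
  NonNeg (q - + 3) → NonNeg (P - 1ℤ) → Bounds q M P Q (- 1ℤ) (q - 1ℤ) 0ℤ (- 1ℤ) 0ℤ
unit-c′ sm q≥3 P≥1 = certified-bounds ∅ (𝐪 :- # 3 ∷ 𝐏 :- # 1 ∷ []) sm (q≥3 , P≥1 , tt)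
  (:- # 1) (𝐪 :- # 1) (# 0) (:- # 1) (# 0)
  (11 , const 7 ∷ lin 5 1 ∷ lin 3 2 ∷ quad 4 0 6 ∷ [])
  (3 , const 11 ∷ lin 4 0 ∷ lin 11 1 ∷ lin 1 3 ∷ [])
  (2 , const 17 ∷ lin 4 2 ∷ lin 1 5 ∷ lin 13 7 ∷ quad 1 0 6 ∷ [])
  (2 , const 33 ∷ lin 30 1 ∷ lin 1 4 ∷ lin 3 7 ∷ quad 35 0 6 ∷ cubic 12 0 6 6 ∷ [])
  (2 , const 8 ∷ lin 4 4 ∷ lin 5 5 ∷ [])
  (2 , const 26 ∷ lin 26 1 ∷ lin 1 4 ∷ lin 12 6 ∷ quad 12 1 6 ∷ [])

axis-e⁺ : ∀ {q M P Q m} → Small q M P Q →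
  NonNeg (q - + 3) → NonNeg (m - 1ℤ) → NonNeg (P - 1ℤ) → NonNeg (Q - 1ℤ) → NonNeg ((m + 1ℤ) * Q - P) →
    NonNeg (+ 2 * P - m * Q - 1ℤ) → NonNeg (q * M - (m * q + q + 1ℤ) * P - 1ℤ) →
    Bounds q M P Q (- 1ℤ) 0ℤ 0ℤ (+ 2) (- m)
axis-e⁺ {m = m} sm q≥3 m≥1 P≥1 Q≥1 mQ⁺ 2P⁺ mqP =
  certified-bounds (m ▸ ∅) (𝐪 :- # 3 ∷ 𝐚 :- # 1 ∷ 𝐏 :- # 1 ∷ 𝐐 :- # 1 ∷ (𝐚 :+ # 1) :* 𝐐 :- 𝐏
  ∷ # 2 :* 𝐏 :- 𝐚 :* 𝐐 :- # 1 ∷ 𝐪 :* 𝐌 :- (𝐚 :* 𝐪 :+ 𝐪 :+ # 1) :* 𝐏 :- # 1 ∷ []) sm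
  (q≥3 , m≥1 , P≥1 , Q≥1 , mQ⁺ , 2P⁺ , mqP , tt)
  (:- # 1) (# 0) (# 0) (# 2) (:- 𝐚)
  (0 , lin 1 11 ∷ [])
  (11 , const 47 ∷ lin 41 1 ∷ lin 3 2 ∷ lin 4 4 ∷ lin 12 10 ∷ [])
  (11 , const 59 ∷ lin 22 1 ∷ lin 18 3 ∷ lin 8 4 ∷ lin 24 6 ∷ lin 12 12 ∷ quad 21 1 6 ∷ quad 3 3 6 ∷ [])
  (11 , const 83 ∷ lin 73 1 ∷ lin 3 3 ∷ lin 8 5 ∷ lin 24 6 ∷ lin 36 7 ∷ quad 21 1 6 ∷ quad 3 3 6
    ∷ quad 12 7 6 ∷ quad 36 7 8 ∷ cubic 12 7 6 8 ∷ [])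
  (7 , const 55 ∷ lin 15 2 ∷ lin 25 3 ∷ lin 8 4 ∷ lin 16 6 ∷ lin 8 10 ∷ lin 8 12 ∷ quad 7 2 6 ∷ quad 9 3 6 ∷ [])
  (11 , const 71 ∷ lin 49 1 ∷ lin 3 3 ∷ lin 8 5 ∷ lin 36 6 ∷ lin 36 7 ∷ lin 12 11 ∷ quad 24 1 6 ∷ quad 12 7 6
    ∷ quad 12 8 6 ∷ quad 36 7 8 ∷ cubic 12 7 6 8 ∷ [])

axis-e⁻ : ∀ {q M P Q m} → Small q M P Q →
  NonNeg (q - + 3) → NonNeg (m - 1ℤ) → NonNeg (P - 1ℤ) → NonNeg (- Q - 1ℤ) → NonNeg ((m + 1ℤ) * - Q - P) →
    NonNeg (+ 2 * P - m * - Q - 1ℤ) → NonNeg (q * M - (m * q + q + 1ℤ) * P - 1ℤ) →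
    Bounds q M P Q (- 1ℤ) 0ℤ 0ℤ (+ 2) m
axis-e⁻ {m = m} sm q≥3 m≥1 P≥1 Q≤-1 mQ⁻ 2P⁻ mqP =
  certified-bounds (m ▸ ∅) (𝐪 :- # 3 ∷ 𝐚 :- # 1 ∷ 𝐏 :- # 1 ∷ :- 𝐐 :- # 1 ∷ (𝐚 :+ # 1) :* :- 𝐐 :- 𝐏
  ∷ # 2 :* 𝐏 :- 𝐚 :* :- 𝐐 :- # 1 ∷ 𝐪 :* 𝐌 :- (𝐚 :* 𝐪 :+ 𝐪 :+ # 1) :* 𝐏 :- # 1 ∷ []) sm
  (q≥3 , m≥1 , P≥1 , Q≤-1 , mQ⁻ , 2P⁻ , mqP , tt)
  (:- # 1) (# 0) (# 0) (# 2) 𝐚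
  (0 , lin 1 11 ∷ [])
  (11 , const 47 ∷ lin 41 1 ∷ lin 3 2 ∷ lin 4 5 ∷ lin 12 10 ∷ [])
  (7 , const 55 ∷ lin 30 1 ∷ lin 10 3 ∷ lin 16 6 ∷ lin 24 7 ∷ lin 16 9 ∷ quad 7 2 6 ∷ quad 9 3 6 ∷ quad 8 7 6
    ∷ quad 24 7 8 ∷ cubic 8 7 6 8 ∷ [])
  (11 , const 83 ∷ lin 58 1 ∷ lin 6 3 ∷ lin 8 5 ∷ lin 24 6 ∷ lin 12 12 ∷ quad 21 1 6 ∷ quad 3 3 6 ∷ [])
  (7 , const 63 ∷ lin 48 1 ∷ lin 8 3 ∷ lin 16 6 ∷ lin 24 7 ∷ lin 8 9 ∷ lin 8 10 ∷ quad 7 2 6 ∷ quad 9 3 6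
    ∷ quad 8 7 6 ∷ quad 24 7 8 ∷ cubic 8 7 6 8 ∷ [])
  (11 , const 71 ∷ lin 6 3 ∷ lin 17 4 ∷ lin 25 5 ∷ lin 24 6 ∷ lin 12 11 ∷ lin 12 12 ∷ quad 21 1 6
    ∷ quad 3 3 6 ∷ [])

-- The critical inequality becomes (mq + q - 1)Q > (q - 1)P, which follows from (m + 1)Q ≥ P.
axis-d⁺ : ∀ {q M P Q m} → Small q M P Q →
  NonNeg (q - + 3) → NonNeg (m - 1ℤ) → NonNeg (P - 1ℤ) → NonNeg (Q - 1ℤ) → NonNeg ((m + 1ℤ) * Q - P) →
    NonNeg (+ 2 * P - m * Q - 1ℤ) → NonNeg (q * M - (m * q + q + 1ℤ) * P - 1ℤ) →
    Bounds q M P Q 0ℤ 0ℤ 1ℤ (m * q + q - 1ℤ) (- m)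
axis-d⁺ {m = m} sm q≥3 m≥1 P≥1 Q≥1 mQ⁺ 2P⁺ mqP =
  certified-bounds (m ▸ ∅) (𝐪 :- # 3 ∷ 𝐚 :- # 1 ∷ 𝐏 :- # 1 ∷ 𝐐 :- # 1 ∷ (𝐚 :+ # 1) :* 𝐐 :- 𝐏
  ∷ # 2 :* 𝐏 :- 𝐚 :* 𝐐 :- # 1 ∷ 𝐪 :* 𝐌 :- (𝐚 :* 𝐪 :+ 𝐪 :+ # 1) :* 𝐏 :- # 1 ∷ []) sm
  (q≥3 , m≥1 , P≥1 , Q≥1 , mQ⁺ , 2P⁺ , mqP , tt)
  (# 0) (# 0) (# 1) (𝐚 :* 𝐪 :+ 𝐪 :- # 1) (:- 𝐚)
  (3 , const 15 ∷ lin 9 1 ∷ lin 3 3 ∷ lin 8 6 ∷ lin 12 7 ∷ lin 4 11 ∷ quad 4 7 6 ∷ quad 8 8 6 ∷ quad 12 7 8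
    ∷ cubic 4 7 6 8 ∷ [])
  (1 , const 6 ∷ lin 1 7 ∷ lin 5 8 ∷ lin 1 10 ∷ lin 2 12 ∷ quad 1 7 9 ∷ [])
  (11 , const 179 ∷ lin 12 2 ∷ lin 70 4 ∷ lin 62 5 ∷ lin 60 6 ∷ lin 36 11 ∷ quad 41 1 6 ∷ quad 3 2 6
    ∷ quad 4 4 6 ∷ quad 12 11 6 ∷ [])
  (1 , lin 1 7 ∷ lin 1 8 ∷ lin 5 10 ∷ quad 2 10 6 ∷ quad 1 7 9 ∷ [])
  (11 , const 155 ∷ lin 112 1 ∷ lin 8 4 ∷ lin 60 6 ∷ lin 24 11 ∷ lin 12 12 ∷ quad 41 1 6 ∷ quad 3 2 6
    ∷ quad 4 4 6 ∷ quad 12 11 6 ∷ [])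
  (0 , const 1 ∷ lin 1 3 ∷ lin 2 6 ∷ lin 3 7 ∷ lin 1 8 ∷ lin 2 10 ∷ quad 1 7 6 ∷ quad 2 8 6 ∷ quad 1 10 6
    ∷ quad 3 7 8 ∷ cubic 1 7 6 8 ∷ [])

axis-d⁻ : ∀ {q M P Q m} → Small q M P Q →
  NonNeg (q - + 3) → NonNeg (m - 1ℤ) → NonNeg (P - 1ℤ) → NonNeg (- Q - 1ℤ) → NonNeg ((m + 1ℤ) * - Q - P) →
    NonNeg (+ 2 * P - m * - Q - 1ℤ) → NonNeg (q * M - (m * q + q + 1ℤ) * P - 1ℤ) →
    Bounds q M P Q 0ℤ 0ℤ 1ℤ (- (m * q + q + 1ℤ)) (m + + 2)
axis-d⁻ {m = m} sm q≥3 m≥1 P≥1 Q≤-1 mQ⁻ 2P⁻ mqP =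
  certified-bounds (m ▸ ∅) (𝐪 :- # 3 ∷ 𝐚 :- # 1 ∷ 𝐏 :- # 1 ∷ :- 𝐐 :- # 1 ∷ (𝐚 :+ # 1) :* :- 𝐐 :- 𝐏
  ∷ # 2 :* 𝐏 :- 𝐚 :* :- 𝐐 :- # 1 ∷ 𝐪 :* 𝐌 :- (𝐚 :* 𝐪 :+ 𝐪 :+ # 1) :* 𝐏 :- # 1 ∷ []) sm
  (q≥3 , m≥1 , P≥1 , Q≤-1 , mQ⁻ , 2P⁻ , mqP , tt)
  (# 0) (# 0) (# 1) (:- (𝐚 :* 𝐪 :+ 𝐪 :+ # 1)) (𝐚 :+ # 2)
  (5 , const 23 ∷ lin 5 1 ∷ lin 3 2 ∷ lin 4 5 ∷ lin 6 11 ∷ lin 6 12 ∷ [])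
  (0 , const 5 ∷ lin 1 3 ∷ lin 2 6 ∷ lin 3 7 ∷ lin 4 8 ∷ lin 1 9 ∷ lin 1 10 ∷ quad 1 7 6 ∷ quad 2 8 6
    ∷ quad 3 7 8 ∷ cubic 1 7 6 8 ∷ [])
  (11 , const 179 ∷ lin 70 2 ∷ lin 58 3 ∷ lin 16 5 ∷ lin 60 6 ∷ lin 36 11 ∷ quad 41 1 6 ∷ quad 3 2 6
    ∷ quad 4 5 6 ∷ quad 12 11 6 ∷ [])
  (0 , lin 4 10 ∷ lin 1 11 ∷ quad 1 10 6 ∷ [])
  (11 , const 155 ∷ lin 109 1 ∷ lin 15 3 ∷ lin 8 5 ∷ lin 60 6 ∷ lin 36 7 ∷ lin 24 11 ∷ quad 41 1 6
    ∷ quad 3 3 6 ∷ quad 4 5 6 ∷ quad 12 7 6 ∷ quad 12 11 6 ∷ quad 36 7 8 ∷ cubic 12 7 6 8 ∷ [])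
  (0 , lin 2 10 ∷ lin 1 12 ∷ quad 1 10 6 ∷ [])

axis-c : ∀ {q M P Q m} → Small q M P Q →
  NonNeg (q - + 3) → NonNeg (m - 1ℤ) → NonNeg (P - 1ℤ) → NonNeg (Q - 1ℤ) → NonNeg ((m + 1ℤ) * Q - P) →
    NonNeg (+ 2 * P - m * Q - 1ℤ) → NonNeg (q * M - (m * q + q + 1ℤ) * P - 1ℤ) →
    Bounds q M P Q 1ℤ 0ℤ 0ℤ (- (+ 2)) m
axis-c {m = m} sm q≥3 m≥1 P≥1 Q≥1 mQ⁺ 2P⁺ mqP =
  certified-bounds (m ▸ ∅) (𝐪 :- # 3 ∷ 𝐚 :- # 1 ∷ 𝐏 :- # 1 ∷ 𝐐 :- # 1 ∷ (𝐚 :+ # 1) :* 𝐐 :- 𝐏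
  ∷ # 2 :* 𝐏 :- 𝐚 :* 𝐐 :- # 1 ∷ 𝐪 :* 𝐌 :- (𝐚 :* 𝐪 :+ 𝐪 :+ # 1) :* 𝐏 :- # 1 ∷ []) sm
  (q≥3 , m≥1 , P≥1 , Q≥1 , mQ⁺ , 2P⁺ , mqP , tt)
  (# 1) (# 0) (# 0) (:- (# 2)) 𝐚
  (23 , const 95 ∷ lin 47 2 ∷ lin 41 3 ∷ lin 8 4 ∷ lin 24 10 ∷ [])
  (0 , lin 1 11 ∷ [])
  (11 , const 83 ∷ lin 73 1 ∷ lin 3 3 ∷ lin 8 5 ∷ lin 24 6 ∷ lin 36 7 ∷ quad 21 1 6 ∷ quad 3 3 6
    ∷ quad 12 7 6 ∷ quad 36 7 8 ∷ cubic 12 7 6 8 ∷ [])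
  (11 , const 59 ∷ lin 11 2 ∷ lin 29 3 ∷ lin 8 4 ∷ lin 24 6 ∷ lin 12 12 ∷ quad 21 1 6 ∷ quad 3 3 6 ∷ [])
  (11 , const 71 ∷ lin 49 1 ∷ lin 3 3 ∷ lin 8 5 ∷ lin 24 6 ∷ lin 36 7 ∷ lin 12 11 ∷ quad 21 1 6 ∷ quad 3 3 6
    ∷ quad 12 7 6 ∷ quad 36 7 8 ∷ cubic 12 7 6 8 ∷ [])
  (3 , const 27 ∷ lin 15 1 ∷ lin 5 3 ∷ lin 4 4 ∷ lin 8 6 ∷ lin 4 10 ∷ lin 4 12 ∷ quad 7 1 6 ∷ quad 1 3 6 ∷ [])

axis-c′ : ∀ {q M P Q m} → Small q M P Q →
  NonNeg (q - + 3) → NonNeg (m - 1ℤ) → NonNeg (P - 1ℤ) → NonNeg (Q - 1ℤ) → NonNeg ((m + 1ℤ) * Q - P) →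
    NonNeg (+ 2 * P - m * Q - 1ℤ) → NonNeg (q * M - (m * q + q + 1ℤ) * P - 1ℤ) →
    Bounds q M P Q (- 1ℤ) (q - 1ℤ) 0ℤ (- (+ 2)) m
axis-c′ {m = m} sm q≥3 m≥1 P≥1 Q≥1 mQ⁺ 2P⁺ mqP =
  certified-bounds (m ▸ ∅) (𝐪 :- # 3 ∷ 𝐚 :- # 1 ∷ 𝐏 :- # 1 ∷ 𝐐 :- # 1 ∷ (𝐚 :+ # 1) :* 𝐐 :- 𝐏
  ∷ # 2 :* 𝐏 :- 𝐚 :* 𝐐 :- # 1 ∷ 𝐪 :* 𝐌 :- (𝐚 :* 𝐪 :+ 𝐪 :+ # 1) :* 𝐏 :- # 1 ∷ []) sm
  (q≥3 , m≥1 , P≥1 , Q≥1 , mQ⁺ , 2P⁺ , mqP , tt)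
  (:- # 1) (𝐪 :- # 1) (# 0) (:- (# 2)) 𝐚
  (11 , const 7 ∷ lin 1 1 ∷ lin 3 2 ∷ lin 4 4 ∷ lin 12 10 ∷ quad 4 0 6 ∷ [])
  (0 , const 3 ∷ lin 1 0 ∷ lin 3 1 ∷ lin 1 11 ∷ [])
  (2 , const 19 ∷ lin 3 2 ∷ lin 2 5 ∷ lin 3 6 ∷ lin 9 7 ∷ lin 15 8 ∷ quad 1 0 6 ∷ quad 3 7 6 ∷ quad 3 8 6
    ∷ quad 9 7 8 ∷ cubic 3 7 6 8 ∷ [])
  (11 , const 119 ∷ lin 12 0 ∷ lin 18 3 ∷ lin 49 4 ∷ lin 41 5 ∷ lin 48 6 ∷ lin 12 12 ∷ quad 45 1 6
    ∷ quad 3 3 6 ∷ [])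
  (3 , const 23 ∷ lin 11 1 ∷ lin 1 3 ∷ lin 4 6 ∷ lin 12 7 ∷ lin 8 9 ∷ lin 4 11 ∷ quad 4 7 6 ∷ quad 4 8 6
    ∷ quad 12 7 8 ∷ cubic 4 7 6 8 ∷ [])
  (3 , const 35 ∷ lin 23 1 ∷ lin 5 3 ∷ lin 4 4 ∷ lin 16 6 ∷ lin 4 10 ∷ lin 4 12 ∷ quad 15 1 6 ∷ quad 1 3 6 ∷ [])

steep-e⁺ : ∀ {q M P Q} → Small q M P Q →
  NonNeg (q - + 3) → NonNeg (P - 1ℤ) → NonNeg (Q - + 2 * P - 1ℤ) → Bounds q M P Q (- 1ℤ) 0ℤ 0ℤ (- (+ 2)) 1ℤ
steep-e⁺ sm q≥3 P≥1 Q>2P = certified-bounds ∅ (𝐪 :- # 3 ∷ 𝐏 :- # 1 ∷ 𝐐 :- # 2 :* 𝐏 :- # 1 ∷ []) sm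
  (q≥3 , P≥1 , Q>2P , tt)
  (:- # 1) (# 0) (# 0) (:- (# 2)) (# 1)
  (0 , lin 1 8 ∷ [])
  (5 , const 23 ∷ lin 19 1 ∷ lin 3 3 ∷ lin 2 4 ∷ [])
  (7 , const 55 ∷ lin 15 2 ∷ lin 25 3 ∷ lin 16 6 ∷ lin 16 8 ∷ quad 7 2 6 ∷ quad 9 3 6 ∷ [])
  (11 , const 83 ∷ lin 73 1 ∷ lin 3 2 ∷ lin 8 4 ∷ lin 24 6 ∷ quad 21 1 6 ∷ quad 3 2 6 ∷ [])
  (11 , const 83 ∷ lin 71 1 ∷ lin 9 3 ∷ lin 4 5 ∷ lin 24 6 ∷ quad 21 1 6 ∷ quad 3 3 6 ∷ [])
  (11 , const 59 ∷ lin 47 1 ∷ lin 9 2 ∷ lin 4 4 ∷ lin 24 6 ∷ quad 21 1 6 ∷ quad 3 2 6 ∷ [])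

steep-e⁻ : ∀ {q M P Q} → Small q M P Q →
  NonNeg (q - + 3) → NonNeg (- Q - + 2 * P - 1ℤ) → NonNeg (q * M - (q + 1ℤ) * P - 1ℤ) →
    Bounds q M P Q (- 1ℤ) 0ℤ 0ℤ (- (+ 2)) (- 1ℤ)
steep-e⁻ sm q≥3 -Q>2P qP = certified-bounds ∅
  (𝐪 :- # 3 ∷ :- 𝐐 :- # 2 :* 𝐏 :- # 1 ∷ 𝐪 :* 𝐌 :- (𝐪 :+ # 1) :* 𝐏 :- # 1 ∷ []) sm (q≥3 , -Q>2P , qP , tt)
  (:- # 1) (# 0) (# 0) (:- (# 2)) (:- # 1)
  (0 , lin 1 7 ∷ [])
  (5 , const 23 ∷ lin 19 1 ∷ lin 3 3 ∷ lin 2 5 ∷ [])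
  (23 , const 119 ∷ lin 6 2 ∷ lin 37 4 ∷ lin 53 5 ∷ lin 48 6 ∷ lin 24 8 ∷ quad 48 1 6 ∷ [])
  (7 , const 71 ∷ lin 38 1 ∷ lin 18 3 ∷ lin 16 6 ∷ lin 16 7 ∷ quad 7 2 6 ∷ quad 9 3 6 ∷ [])
  (7 , const 55 ∷ lin 19 2 ∷ lin 21 3 ∷ lin 8 5 ∷ lin 16 6 ∷ lin 8 8 ∷ quad 16 1 6 ∷ [])
  (7 , const 39 ∷ lin 6 3 ∷ lin 21 4 ∷ lin 13 5 ∷ lin 16 6 ∷ quad 7 2 6 ∷ quad 9 3 6 ∷ [])

steep-d⁺ : ∀ {q M P Q} → Small q M P Q →
  NonNeg (q - + 3) → NonNeg (P - 1ℤ) → NonNeg (Q - + 2 * P - 1ℤ) → NonNeg (q * M - (q + 1ℤ) * P - 1ℤ) →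
    Bounds q M P Q 0ℤ 0ℤ 1ℤ 1ℤ (- (+ 3))
steep-d⁺ sm q≥3 P≥1 Q>2P qP = certified-bounds ∅
  (𝐪 :- # 3 ∷ 𝐏 :- # 1 ∷ 𝐐 :- # 2 :* 𝐏 :- # 1 ∷ 𝐪 :* 𝐌 :- (𝐪 :+ # 1) :* 𝐏 :- # 1 ∷ []) sm
  (q≥3 , P≥1 , Q>2P , qP , tt)
  (# 0) (# 0) (# 1) (# 1) (:- (# 3))
  (7 , const 23 ∷ lin 7 2 ∷ lin 9 3 ∷ lin 8 4 ∷ [])
  (1 , const 4 ∷ lin 1 3 ∷ lin 1 5 ∷ lin 3 8 ∷ [])
  (11 , const 143 ∷ lin 116 1 ∷ lin 4 4 ∷ lin 48 6 ∷ lin 24 9 ∷ quad 45 1 6 ∷ quad 3 2 6 ∷ [])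
  (0 , const 10 ∷ lin 3 6 ∷ lin 10 7 ∷ lin 1 8 ∷ quad 3 7 6 ∷ [])
  (23 , const 263 ∷ lin 79 2 ∷ lin 97 3 ∷ lin 16 5 ∷ lin 96 6 ∷ lin 72 9 ∷ quad 96 1 6 ∷ [])
  (2 , const 25 ∷ lin 1 3 ∷ lin 2 4 ∷ lin 9 6 ∷ lin 23 7 ∷ quad 9 7 6 ∷ [])

steep-d⁻ : ∀ {q M P Q} → Small q M P Q →
  NonNeg (q - + 3) → NonNeg (P - 1ℤ) → NonNeg (- Q - + 2 * P - 1ℤ) → NonNeg (q * M - (q + 1ℤ) * P - 1ℤ) →
    Bounds q M P Q 0ℤ 0ℤ 1ℤ (- 1ℤ) (- (+ 3))
steep-d⁻ sm q≥3 P≥1 -Q>2P qP = certified-bounds ∅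
  (𝐪 :- # 3 ∷ 𝐏 :- # 1 ∷ :- 𝐐 :- # 2 :* 𝐏 :- # 1 ∷ 𝐪 :* 𝐌 :- (𝐪 :+ # 1) :* 𝐏 :- # 1 ∷ []) sm
  (q≥3 , P≥1 , -Q>2P , qP , tt)
  (# 0) (# 0) (# 1) (:- # 1) (:- (# 3))
  (7 , const 23 ∷ lin 9 2 ∷ lin 7 3 ∷ lin 8 4 ∷ [])
  (0 , const 1 ∷ lin 1 5 ∷ lin 1 7 ∷ [])
  (5 , const 71 ∷ lin 49 1 ∷ lin 3 3 ∷ lin 2 5 ∷ lin 24 6 ∷ lin 18 9 ∷ quad 24 1 6 ∷ [])
  (0 , const 12 ∷ lin 3 6 ∷ lin 12 7 ∷ lin 1 8 ∷ quad 3 7 6 ∷ [])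
  (11 , const 131 ∷ lin 71 1 ∷ lin 9 3 ∷ lin 16 5 ∷ lin 48 6 ∷ lin 36 9 ∷ quad 48 1 6 ∷ [])
  (0 , const 12 ∷ lin 1 4 ∷ lin 3 6 ∷ lin 11 7 ∷ lin 1 8 ∷ quad 3 7 6 ∷ [])

steep-c : ∀ {q M P Q} → Small q M P Q →
  NonNeg (q - + 3) → NonNeg (P - 1ℤ) → NonNeg (Q - + 2 * P - 1ℤ) → NonNeg (q * M - (q + 1ℤ) * P - 1ℤ) →
    Bounds q M P Q 1ℤ (- (+ 2)) 0ℤ (+ 2) (- 1ℤ)
steep-c sm q≥3 P≥1 Q>2P qP = certified-bounds ∅
  (𝐪 :- # 3 ∷ 𝐏 :- # 1 ∷ 𝐐 :- # 2 :* 𝐏 :- # 1 ∷ 𝐪 :* 𝐌 :- (𝐪 :+ # 1) :* 𝐏 :- # 1 ∷ []) sm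
  (q≥3 , P≥1 , Q>2P , qP , tt)
  (# 1) (:- (# 2)) (# 0) (# 2) (:- # 1)
  (5 , const 19 ∷ lin 15 1 ∷ lin 3 3 ∷ lin 2 4 ∷ quad 4 0 6 ∷ [])
  (0 , lin 2 0 ∷ lin 1 8 ∷ [])
  (11 , const 123 ∷ lin 113 1 ∷ lin 3 2 ∷ lin 8 4 ∷ lin 24 6 ∷ quad 8 0 6 ∷ quad 21 1 6 ∷ quad 3 2 6 ∷ [])
  (23 , const 39 ∷ lin 9 2 ∷ lin 15 3 ∷ lin 16 5 ∷ lin 6 6 ∷ quad 110 0 6 ∷ quad 6 3 6 ∷ cubic 42 0 6 6 ∷ [])
  (23 , const 215 ∷ lin 113 2 ∷ lin 95 3 ∷ lin 8 4 ∷ lin 48 6 ∷ quad 42 1 6 ∷ quad 6 2 6 ∷ [])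
  (11 , const 35 ∷ lin 23 1 ∷ lin 9 3 ∷ lin 4 5 ∷ lin 24 6 ∷ quad 21 1 6 ∷ quad 3 3 6 ∷ [])

steep-c′ : ∀ {q M P Q} → Small q M P Q →
  NonNeg (q - + 3) → NonNeg (P - 1ℤ) → NonNeg (Q - + 2 * P - 1ℤ) → NonNeg (q * M - (q + 1ℤ) * P - 1ℤ) →
    Bounds q M P Q (- 1ℤ) (q - 1ℤ) 0ℤ (+ 2) (- 1ℤ)
steep-c′ sm q≥3 P≥1 Q>2P qP = certified-bounds ∅
  (𝐪 :- # 3 ∷ 𝐏 :- # 1 ∷ 𝐐 :- # 2 :* 𝐏 :- # 1 ∷ 𝐪 :* 𝐌 :- (𝐪 :+ # 1) :* 𝐏 :- # 1 ∷ []) sm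
  (q≥3 , P≥1 , Q>2P , qP , tt)
  (:- # 1) (𝐪 :- # 1) (# 0) (# 2) (:- # 1)
  (2 , const 3 ∷ lin 1 3 ∷ lin 1 4 ∷ lin 2 7 ∷ quad 1 0 6 ∷ [])
  (0 , const 3 ∷ lin 1 0 ∷ lin 3 1 ∷ lin 1 8 ∷ [])
  (2 , const 13 ∷ lin 2 4 ∷ lin 9 7 ∷ lin 3 9 ∷ quad 1 0 6 ∷ [])
  (23 , const 21 ∷ lin 678 0 ∷ lin 6 3 ∷ lin 16 5 ∷ lin 96 6 ∷ quad 218 0 6 ∷ quad 45 2 6 ∷ quad 51 3 6 ∷ [])
  (11 , const 35 ∷ lin 17 1 ∷ lin 3 3 ∷ lin 4 4 ∷ lin 12 9 ∷ [])
  (11 , const 107 ∷ lin 95 1 ∷ lin 9 3 ∷ lin 4 5 ∷ lin 48 6 ∷ quad 45 1 6 ∷ quad 3 3 6 ∷ [])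

-- Families of counterexamples

module _ (q u₀ u₁ : ℤ) where
  Mᵤ Pᵤ Qᵤ : ℤ
  Mᵤ = u₀ * u₀ + u₀ * u₁ + q * (u₁ * u₁)
  Pᵤ = + 2 * - (q * u₁) + (u₀ + u₁)
  Qᵤ = - (q * u₁) + + 2 * q * (u₀ + u₁)

  -- Since θ(a + bθ) = -qb + (a + b)θ, an element is divisible by θ exactly if q divides its first
  -- coordinate.
  record StrictDigit (x₀ x₁ : ℤ) : Set where
    constructor strict
    field
      isInside : Inside q (q * Mᵤ) (x₀ * Pᵤ + x₁ * Qᵤ) (x₀ * (Pᵤ - Qᵤ) + x₁ * (q * Pᵤ))
      indivisible : ∀ k → x₀ ≢ q * k

  -- Digits with c + U d = c′ + T (e + T): an expansion of weight 2 whose w-NAF has weight 3.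
  record Witness : Set where
    constructor witness
    field
      {c₀ c₁ c′₀ c′₁ d₀ d₁ e₀ e₁} : ℤ
      c-strict : StrictDigit c₀ c₁
      c′-strict : StrictDigit c′₀ c′₁
      d-strict : StrictDigit d₀ d₁
      e-strict : StrictDigit e₀ e₁
      one-strict : StrictDigit 1ℤ 0ℤ
      equal₀ : c₀ + (u₀ * d₀ - q * (u₁ * d₁)) ≡
        c′₀ + (- (q * u₁) * (e₀ + - (q * u₁)) - q * ((u₀ + u₁) * (e₁ + (u₀ + u₁))))
      equal₁ : c₁ + (u₀ * d₁ + u₁ * d₀ + u₁ * d₁) ≡
        c′₁ + (- (q * u₁) * (e₁ + (u₀ + u₁)) + (u₀ + u₁) * (e₀ + - (q * u₁)) + (u₀ + u₁) * (e₁ + (u₀ + u₁)))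

halve : ∀ {x y} → 0ℤ <ᶻ y → y ≡ x + x → 0ℤ <ᶻ x
halve {x} {y} h eq = cert 1 {x} (pred-NonNeg h ) (trans (lem x) (trans (sym eq) (lem′ y)))
  where
  lem : ∀ x → + 2 * x ≡ x + x
  lem = solve-∀
  lem′ : ∀ y → y ≡ 1ℤ + (y - 1ℤ)
  lem′ = solve-∀

inside-of-double : ∀ {q N X Y} → Inside q (+ 2 * N) (X + X) (Y + Y) → Inside q N X Y
inside-of-double {q} {N} {X} {Y} (inside a b c d e f) = inside
  (halve a (solve (N ∷ X ∷ []))) (halve b (solve (N ∷ X ∷ [])))
  (halve c (solve (q ∷ N ∷ Y ∷ []))) (halve d (solve (q ∷ N ∷ Y ∷ [])))
  (halve e (solve (q ∷ N ∷ X ∷ Y ∷ []))) (halve f (solve (q ∷ N ∷ X ∷ Y ∷ [])))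

record Digit (q u₀ u₁ x₀ x₁ α β γ ρ σ : ℤ) : Set where
  constructor digit
  field
    bounded : Bounds q (Mᵤ q u₀ u₁) (Pᵤ q u₀ u₁) (Qᵤ q u₀ u₁) α β γ ρ σ
    double₀ : x₀ + x₀ ≡ α * - (q * u₁) + β * u₀ + γ * - (q * (u₀ + u₁)) + ρ
    double₁ : x₁ + x₁ ≡ α * (u₀ + u₁) + β * u₁ + γ * (- (q * u₁) + (u₀ + u₁)) + σ
    indivisible : ∀ k → x₀ ≢ q * k

digit-strict : ∀ {q u₀ u₁ x₀ x₁ α β γ ρ σ} → Digit q u₀ u₁ x₀ x₁ α β γ ρ σ → StrictDigit q u₀ u₁ x₀ x₁
digit-strict {q} {u₀} {u₁} {x₀} {x₁} {α} {β} {γ} {ρ} {σ} (digit (bounds a b c d e f) eq₀ eq₁ h) = strict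
  (inside-of-double (subst₂ (Inside q _) ξ-eq η-eq (inside a b c d e f))) h
  where
  P Q : ℤ
  P = Pᵤ q u₀ u₁
  Q = Qᵤ q u₀ u₁
  double : ∀ x y A B → (x + x) * A + (y + y) * B ≡ x * A + y * B + (x * A + y * B)
  double = solve-∀
  ξ-eq : (+ 2 * α + γ) * (q * Mᵤ q u₀ u₁) + β * Mᵤ q u₀ u₁ + ρ * P + σ * Q ≡ x₀ * P + x₁ * Q + (x₀ * P + x₁ * Q)
  ξ-eq = trans (lem q u₀ u₁ α β γ ρ σ) (trans (sym (cong₂ (λ s t → s * P + t * Q) eq₀ eq₁)) (double x₀ x₁ P Q))
    where
    lem : ∀ q u₀ u₁ α β γ ρ σ →
      (+ 2 * α + γ) * (q * (u₀ * u₀ + u₀ * u₁ + q * (u₁ * u₁))) + β * (u₀ * u₀ + u₀ * u₁ + q * (u₁ * u₁))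
        + ρ * (+ 2 * - (q * u₁) + (u₀ + u₁)) + σ * (- (q * u₁) + + 2 * q * (u₀ + u₁)) ≡
      (α * - (q * u₁) + β * u₀ + γ * - (q * (u₀ + u₁)) + ρ) * (+ 2 * - (q * u₁) + (u₀ + u₁))
        + (α * (u₀ + u₁) + β * u₁ + γ * (- (q * u₁) + (u₀ + u₁)) + σ) * (- (q * u₁) + + 2 * q * (u₀ + u₁))
    lem = solve-∀
  η-eq : (α + + 2 * q * γ) * (q * Mᵤ q u₀ u₁) - β * ((+ 2 * q - 1ℤ) * Mᵤ q u₀ u₁) + ρ * (P - Q) + σ * (q * P)
    ≡ x₀ * (P - Q) + x₁ * (q * P) + (x₀ * (P - Q) + x₁ * (q * P))
  η-eq = trans (lem q u₀ u₁ α β γ ρ σ) (trans (sym (cong₂ (λ s t → s * (P - Q) + t * (q * P)) eq₀ eq₁))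
    (double x₀ x₁ (P - Q) (q * P)))
    where
    lem : ∀ q u₀ u₁ α β γ ρ σ →
      (α + + 2 * q * γ) * (q * (u₀ * u₀ + u₀ * u₁ + q * (u₁ * u₁))) - β *
        ((+ 2 * q - 1ℤ) * (u₀ * u₀ + u₀ * u₁ + q * (u₁ * u₁)))
        + ρ * (+ 2 * - (q * u₁) + (u₀ + u₁) - (- (q * u₁) + + 2 * q * (u₀ + u₁)))
          + σ * (q * (+ 2 * - (q * u₁) + (u₀ + u₁))) ≡
      (α * - (q * u₁) + β * u₀ + γ * - (q * (u₀ + u₁)) + ρ) *
        (+ 2 * - (q * u₁) + (u₀ + u₁) - (- (q * u₁) + + 2 * q * (u₀ + u₁)))
        + (α * (u₀ + u₁) + β * u₁ + γ * (- (q * u₁) + (u₀ + u₁)) + σ) * (q * (+ 2 * - (q * u₁) + (u₀ + u₁)))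
    lem = solve-∀

cancel-double : ∀ {x y} → + 2 * x ≡ + 2 * y → x ≡ y
cancel-double {x} {y} = ℤ.*-cancelˡ-≡ (+ 2) x y

-- Halving is postponed: as U θ = T and θT = T - qU, the equation between the doubled digits is one between coefficients.
assemble : ∀ {q u₀ u₁ c₀ c₁ c′₀ c′₁ d₀ d₁ e₀ e₁ α β α′ β′ ρ σ ρᵈ σᵈ ρᵉ σᵉ} →
  Digit q u₀ u₁ c₀ c₁ α β 0ℤ ρ σ → Digit q u₀ u₁ c′₀ c′₁ α′ β′ 0ℤ ρ σ →
  Digit q u₀ u₁ d₀ d₁ 0ℤ 0ℤ 1ℤ ρᵈ σᵈ → Digit q u₀ u₁ e₀ e₁ (- 1ℤ) 0ℤ 0ℤ ρᵉ σᵉ → StrictDigit q u₀ u₁ 1ℤ 0ℤ →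
  α′ ≡ α + σᵈ - ρᵉ - σᵉ → β′ ≡ β + ρᵈ + q * σᵉ → Witness q u₀ u₁
assemble {q} {u₀} {u₁} {c₀} {c₁} {c′₀} {c′₁} {d₀} {d₁} {e₀} {e₁} {α} {β} {ρ =
  ρ} {σ} {ρᵈ} {σᵈ} {ρᵉ} {σᵉ} c c′ d e one refl refl =
  witness (digit-strict c) (digit-strict c′) (digit-strict d) (digit-strict e) one
    (cancel-double (trans (lem₀ q u₀ u₁ c₀ d₀ d₁)
      (trans (cong₂ _+_ (Digit.double₀ c)
        (cong₂ (λ x y → u₀ * x - q * (u₁ * y)) (Digit.double₀ d) (Digit.double₁ d)))
      (trans (balance₀ q u₀ u₁ α β ρ ρᵈ σᵈ ρᵉ σᵉ)
      (trans (sym (cong₂ _+_ (Digit.double₀ c′)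
        (cong₂ (λ x y → T₀ * (x + (T₀ + T₀)) - q * (T₁ * (y + (T₁ + T₁)))) (Digit.double₀ e)
          (Digit.double₁ e))))
      (lem₁ q T₀ T₁ c′₀ e₀ e₁))))))
    (cancel-double (trans (lem₂ u₀ u₁ c₁ d₀ d₁)
      (trans (cong₂ _+_ (Digit.double₁ c)
        (cong₂ (λ x y → u₀ * y + u₁ * x + u₁ * y) (Digit.double₀ d) (Digit.double₁ d)))
      (trans (balance₁ q u₀ u₁ α β σ ρᵈ σᵈ ρᵉ σᵉ)
      (trans (sym (cong₂ _+_ (Digit.double₁ c′)
        (cong₂ (λ x y → T₀ * (y + (T₁ + T₁)) + T₁ * (x + (T₀ + T₀)) + T₁ * (y + (T₁ + T₁))) (Digit.double₀ e)
          (Digit.double₁ e))))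
      (lem₃ T₀ T₁ c′₁ e₀ e₁))))))
  where
  T₀ T₁ : ℤ
  T₀ = - (q * u₁)
  T₁ = u₀ + u₁
  lem₀ : ∀ q u₀ u₁ c d₀ d₁ → + 2 * (c + (u₀ * d₀ - q * (u₁ * d₁)))
    ≡ c + c + (u₀ * (d₀ + d₀) - q * (u₁ * (d₁ + d₁)))
  lem₀ = solve-∀
  lem₁ : ∀ q a b c e₀ e₁ → c + c + (a * (e₀ + e₀ + (a + a)) - q * (b * (e₁ + e₁ + (b + b))))
    ≡ + 2 * (c + (a * (e₀ + a) - q * (b * (e₁ + b))))
  lem₁ = solve-∀
  lem₂ : ∀ u₀ u₁ c d₀ d₁ → + 2 * (c + (u₀ * d₁ + u₁ * d₀ + u₁ * d₁))
    ≡ c + c + (u₀ * (d₁ + d₁) + u₁ * (d₀ + d₀) + u₁ * (d₁ + d₁))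
  lem₂ = solve-∀
  lem₃ : ∀ a b c e₀ e₁ → c + c + (a * (e₁ + e₁ + (b + b)) + b * (e₀ + e₀ + (a + a)) + b * (e₁ + e₁ + (b + b)))
    ≡ + 2 * (c + (a * (e₁ + b) + b * (e₀ + a) + b * (e₁ + b)))
  lem₃ = solve-∀
  balance₀ : ∀ q u v α β ρ ρᵈ σᵈ ρᵉ σᵉ → α * - (q * v) + β * u + 0ℤ * - (q * (u + v)) + ρ
      + (u * (0ℤ * - (q * v) + 0ℤ * u + 1ℤ * - (q * (u + v)) + ρᵈ)
        - q * (v * (0ℤ * (u + v) + 0ℤ * v + 1ℤ * (- (q * v) + (u + v)) + σᵈ)))
    ≡ (α + σᵈ - ρᵉ - σᵉ) * - (q * v) + (β + ρᵈ + q * σᵉ) * u + 0ℤ * - (q * (u + v)) + ρ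
      + (- (q * v) * (- 1ℤ * - (q * v) + 0ℤ * u + 0ℤ * - (q * (u + v)) + ρᵉ + (- (q * v) + - (q * v)))
        - q * ((u + v) * (- 1ℤ * (u + v) + 0ℤ * v + 0ℤ * (- (q * v) + (u + v)) + σᵉ + (u + v + (u + v)))))
  balance₀ = solve-∀
  balance₁ : ∀ q u v α β σ ρᵈ σᵈ ρᵉ σᵉ → α * (u + v) + β * v + 0ℤ * (- (q * v) + (u + v)) + σ
      + (u * (0ℤ * (u + v) + 0ℤ * v + 1ℤ * (- (q * v) + (u + v)) + σᵈ)
        + v * (0ℤ * - (q * v) + 0ℤ * u + 1ℤ * - (q * (u + v)) + ρᵈ)
        + v * (0ℤ * (u + v) + 0ℤ * v + 1ℤ * (- (q * v) + (u + v)) + σᵈ))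
    ≡ (α + σᵈ - ρᵉ - σᵉ) * (u + v) + (β + ρᵈ + q * σᵉ) * v + 0ℤ * (- (q * v) + (u + v)) + σ
      + (- (q * v) * (- 1ℤ * (u + v) + 0ℤ * v + 0ℤ * (- (q * v) + (u + v)) + σᵉ + (u + v + (u + v)))
        + (u + v) * (- 1ℤ * - (q * v) + 0ℤ * u + 0ℤ * - (q * (u + v)) + ρᵉ + (- (q * v) + - (q * v)))
        + (u + v) * (- 1ℤ * (u + v) + 0ℤ * v + 0ℤ * (- (q * v) + (u + v)) + σᵉ + (u + v + (u + v))))
  balance₁ = solve-∀

not-unit : ∀ q → NonNeg (q - + 2) → ∀ k → q * k ≢ 1ℤ
not-unit q hq k eq with q in eq-q | ℤ.abs-* q k
... | + 0 | _ = contradiction eq λ ()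
... | + 1 | _ = contradiction hq λ ()
... | + ℕ.suc (ℕ.suc n) | abs = contradiction
  (ℕ.m*n≡1⇒m≡1 (ℕ.suc (ℕ.suc n)) Data.Integer.∣ k ∣ (trans (sym abs) (cong Data.Integer.∣_∣ eq))) λ ()
... | -[1+ n ] | _ = contradiction hq λ ()

indivisible-by : ∀ s q → NonNeg (q - + 2) → ∀ {x} j → s * x ≡ q * j + 1ℤ → ∀ k → x ≢ q * k
indivisible-by s q hq {x} j eq k refl = not-unit q hq (s * k - j)
  (trans (lem s q k j) (trans (cong (_- q * j) eq) (lem′ (q * j))))
  where
  lem : ∀ s q k j → q * (s * k - j) ≡ s * (q * k) - q * j
  lem = solve-∀
  lem′ : ∀ x → x + 1ℤ - x ≡ 1ℤ
  lem′ = solve-∀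

odd-multiple : ∀ h → NonNeg (h - 1ℤ) → ∀ i {x} → x ≡ h * (1ℤ + + 2 * i) → ∀ k → x ≢ + 2 * h * k
odd-multiple h hh i eq′ k eq = not-unit (+ 2) (lit 0) (k - i)
  (trans (lem k i) (trans (cong (_- + 2 * i) (sym cancelled)) (lem′ i)))
  where
  nonZero : ∀ h → NonNeg (h - 1ℤ) → Data.Integer.NonZero h
  nonZero (+ 0) ()
  nonZero (+ ℕ.suc _) _ = _
  nonZero -[1+ _ ] ()
  cancelled : 1ℤ + + 2 * i ≡ + 2 * k
  cancelled = ℤ.*-cancelˡ-≡ h _ _ {{nonZero h hh}} (trans (sym eq′) (trans eq (lem″ h k)))
    where
    lem″ : ∀ h k → + 2 * h * k ≡ h * (+ 2 * k)
    lem″ = solve-∀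
  lem : ∀ k i → + 2 * (k - i) ≡ + 2 * k - + 2 * i
  lem = solve-∀
  lem′ : ∀ i → 1ℤ + + 2 * i - + 2 * i ≡ 1ℤ
  lem′ = solve-∀

one-digit : ∀ {q u₀ u₁} → Small q (Mᵤ q u₀ u₁) (Pᵤ q u₀ u₁) (Qᵤ q u₀ u₁) → NonNeg (q - + 2) →
  StrictDigit q u₀ u₁ 1ℤ 0ℤ
one-digit {q} {u₀} {u₁} sm q≥2 = digit-strict
  (digit (strip {β = 0ℤ} sm q≥2 (subst NonNeg (lem q) (q≥2 ⊕ lit 1)) (subst NonNeg (lem′ q) (q≥2 ⊕ lit 1)))
  (solve (q ∷ u₀ ∷ u₁ ∷ [])) (solve (q ∷ u₀ ∷ u₁ ∷ [])) (indivisible-by 1ℤ q q≥2 0ℤ (solve (q ∷ []))))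
  where
  lem : ∀ q → q - + 2 + 1ℤ ≡ q - 1ℤ - 0ℤ
  lem = solve-∀
  lem′ : ∀ q → q - + 2 + 1ℤ ≡ q - 1ℤ + 0ℤ
  lem′ = solve-∀

-- The ranges in which c = kU + 1 and c′ = - k′U + 1 are digits.
Strip : (q b k k′ : ℤ) → Set
Strip q b k k′ = NonNeg (b - + 2 * k) × NonNeg (q - 1ℤ + + 2 * k) × NonNeg (b - - (+ 2 * k′))
  × NonNeg (q - 1ℤ + - (+ 2 * k′))

lem-q≥2 : ∀ q → q - + 3 + 1ℤ ≡ q - + 2
lem-q≥2 = solve-∀

certified-digit : ∀ {n} (ρ : Env n) (q u₀ u₁ x₀ x₁ α β γ κ σ : Expr n) →
  {Vanishes (x₀ :+ x₀ :- (α :* :- (q :* u₁) :+ β :* u₀ :+ γ :* :- (q :* (u₀ :+ u₁)) :+ κ))} →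
  {Vanishes (x₁ :+ x₁ :- (α :* (u₀ :+ u₁) :+ β :* u₁ :+ γ :* (:- (q :* u₁) :+ (u₀ :+ u₁)) :+ σ))} →
  Bounds (⟦ q ⟧ ρ) (Mᵤ (⟦ q ⟧ ρ) (⟦ u₀ ⟧ ρ) (⟦ u₁ ⟧ ρ)) (Pᵤ (⟦ q ⟧ ρ) (⟦ u₀ ⟧ ρ) (⟦ u₁ ⟧ ρ))
    (Qᵤ (⟦ q ⟧ ρ) (⟦ u₀ ⟧ ρ) (⟦ u₁ ⟧ ρ))
    (⟦ α ⟧ ρ) (⟦ β ⟧ ρ) (⟦ γ ⟧ ρ) (⟦ κ ⟧ ρ) (⟦ σ ⟧ ρ) →
  (∀ k → ⟦ x₀ ⟧ ρ ≢ ⟦ q ⟧ ρ * k) →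
  Digit (⟦ q ⟧ ρ) (⟦ u₀ ⟧ ρ) (⟦ u₁ ⟧ ρ) (⟦ x₀ ⟧ ρ) (⟦ x₁ ⟧ ρ) (⟦ α ⟧ ρ) (⟦ β ⟧ ρ) (⟦ γ ⟧ ρ) (⟦ κ ⟧ ρ) (⟦ σ ⟧ ρ)
certified-digit ρ q u₀ u₁ x₀ x₁ α β γ κ σ {h₀} {h₁} bnd indivisible = digit bnd
  (identity (x₀ :+ x₀) (α :* :- (q :* u₁) :+ β :* u₀ :+ γ :* :- (q :* (u₀ :+ u₁)) :+ κ) {h₀} ρ)
  (identity (x₁ :+ x₁) (α :* (u₀ :+ u₁) :+ β :* u₁ :+ γ :*
    (:- (q :* u₁) :+ (u₀ :+ u₁)) :+ σ) {h₁} ρ) indivisible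

unit-remainder : ∀ {n} (ρ : Env n) q x s j → {Vanishes (s :* x :- (q :* j :+ # 1))} →
  NonNeg (⟦ q ⟧ ρ - + 2) → ∀ k → ⟦ x ⟧ ρ ≢ ⟦ q ⟧ ρ * k
unit-remainder ρ q x s j {h} q≥2 = indivisible-by (⟦ s ⟧ ρ) (⟦ q ⟧ ρ) q≥2 (⟦ j ⟧ ρ)
  (identity (s :* x) (q :* j :+ # 1) {h} ρ)

half-remainder : ∀ {n} (ρ : Env n) h x i → {Vanishes (x :- h :* (# 1 :+ # 2 :* i))} →
  NonNeg (⟦ h ⟧ ρ - 1ℤ) → ∀ k → ⟦ x ⟧ ρ ≢ + 2 * ⟦ h ⟧ ρ * k
half-remainder ρ h x i {eq} h≥1 = odd-multiple (⟦ h ⟧ ρ) h≥1 (⟦ i ⟧ ρ)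
  (identity x (h :* (# 1 :+ # 2 :* i)) {eq} ρ)

-- In all families e + T ≈ T/2 lies just outside the cell of T and d ≈ θT/2 just inside; c - c′ = U (θ (e + T) - d).
-- The families are distinguished by T mod 2 (mixed: 1 + θ, unit: 1, axis and steep: θ; for even q always θ), and
-- the superscript is the sign of Q; P is positive, except in the mixed family, where P - Q is.
module Even⁻ where
  K K′ I V q u₀ u₁ b c₀ c₁ c′₀ c′₁ d₀ d₁ e₀ e₁ : Expr 4
  K = var 0F
  K′ = var 1F
  I = var 2F
  V = var 3F
  q = # 2 :* (K :+ K′)
  u₀ = :- (q :* V)
  u₁ = # 1 :+ # 2 :* I
  b = u₀ :+ u₁
  c₀ = K :* u₀ :+ # 1
  c₁ = K :* u₁
  c′₀ = :- (K′ :* u₀) :+ # 1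
  c′₁ = :- (K′ :* u₁)
  d₀ = :- ((K :+ K′) :* b)
  d₁ = I :- (K :+ K′) :* V :- (K :+ K′) :* u₁
  e₀ = (K :+ K′) :* u₁
  e₁ = (K :+ K′) :* V :- I :- # 1

even⁻ : ∀ k k′ i v {q u₀ u₁} → let ρ = k ▸ k′ ▸ i ▸ v ▸ ∅ in
  q ≡ ⟦ Even⁻.q ⟧ ρ → u₀ ≡ ⟦ Even⁻.u₀ ⟧ ρ → u₁ ≡ ⟦ Even⁻.u₁ ⟧ ρ →
  let P = Pᵤ q u₀ u₁ ; Q = Qᵤ q u₀ u₁ ; M = Mᵤ q u₀ u₁ in
  Small q M P Q →
  NonNeg (q - + 2) → NonNeg (k + k′ - 1ℤ) → NonNeg (P - 1ℤ) → NonNeg (- Q - 1ℤ) → Strip q q k k′ →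
    Witness q u₀ u₁
even⁻ k k′ i v refl refl refl sm q≥2 h≥1 P≥1 Q≤-1 (k⁺ , k⁻ , k′⁺ , k′⁻) = assemble
    (certified-digit ρ q u₀ u₁ c₀ c₁ (# 0) (# 2 :* K) (# 0) (# 2) (# 0)
      (strip-even {β = ⟦ # 2 :* K ⟧ ρ} sm q≥2 k⁺ k⁻ P≥1 Q≤-1)
      (unit-remainder ρ q c₀ (# 1) (:- (K :* V)) q≥2))
    (certified-digit ρ q u₀ u₁ c′₀ c′₁ (# 0) (:- (# 2 :* K′)) (# 0) (# 2) (# 0)
      (strip-even {β = ⟦ :- (# 2 :* K′) ⟧ ρ} sm q≥2 k′⁺ k′⁻ P≥1 Q≤-1)
      (unit-remainder ρ q c′₀ (# 1) (K′ :* V) q≥2))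
    (certified-digit ρ q u₀ u₁ d₀ d₁ (# 0) (# 0) (# 1) (# 0) (:- # 1)
      (even-d sm q≥2 P≥1)
      (half-remainder ρ (K :+ K′) d₀ (:- (I :- (K :+ K′) :* V) :- # 1) h≥1))
    (certified-digit ρ q u₀ u₁ e₀ e₁ (:- # 1) (# 0) (# 0) (# 0) (:- # 1)
      (even-e⁻ sm q≥2 Q≤-1)
      (half-remainder ρ (K :+ K′) e₀ I h≥1))
    (one-digit sm q≥2)
    (identity (# 0) ((# 0) :+ (:- # 1) :- (# 0) :- (:- # 1)) ρ)
    (identity (:- (# 2 :* K′)) ((# 2 :* K) :+ (# 0) :+ q :* (:- # 1)) ρ)
  where
  open Even⁻
  ρ : Env 4
  ρ = k ▸ k′ ▸ i ▸ v ▸ ∅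

module Even⁺ where
  H I L q u₀ u₁ b c₀ c₁ c′₀ c′₁ d₀ d₁ e₀ e₁ : Expr 3
  H = var 0F
  I = var 1F
  L = var 2F
  q = # 2 :* H
  u₀ = :- (q :* (# 1 :+ # 2 :* L))
  u₁ = # 1 :+ # 2 :* I
  b = u₀ :+ u₁
  c₀ = :- (q :* (I :- L)) :- # 1
  c₁ = :- (H :* (# 1 :+ # 2 :* L))
  c′₀ = :- (q :* (I :- L)) :- # 1 :+ q :* u₁ :+ H :* u₀
  c′₁ = :- (H :* (# 1 :+ # 2 :* L)) :- b :+ H :* u₁
  d₀ = :- (H :* b)
  d₁ = I :- H :* (# 1 :+ # 2 :* L) :- H :* u₁
  e₀ = H :* u₁
  e₁ = H :* (# 1 :+ # 2 :* L) :- I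

-- The first coordinate of c = (T - U)/2 - 1 is -h(u₁ - v) - 1. It is -1 modulo q because u₁ and v
-- are both odd; hence v = 1 + 2l here, while `even⁻` admits any v.
even⁺ : ∀ h i l {q u₀ u₁} → let ρ = h ▸ i ▸ l ▸ ∅ in
  q ≡ ⟦ Even⁺.q ⟧ ρ → u₀ ≡ ⟦ Even⁺.u₀ ⟧ ρ → u₁ ≡ ⟦ Even⁺.u₁ ⟧ ρ →
  let P = Pᵤ q u₀ u₁ ; Q = Qᵤ q u₀ u₁ ; M = Mᵤ q u₀ u₁ in
  Small q M P Q →
  NonNeg (q - + 2) → NonNeg (h - 1ℤ) → NonNeg (P - 1ℤ) → NonNeg (Q - 1ℤ) → Witness q u₀ u₁
even⁺ h i l refl refl refl sm q≥2 h≥1 P≥1 Q≥1 = assemble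
    (certified-digit ρ q u₀ u₁ c₀ c₁ (# 1) (:- # 1) (# 0) (:- (# 2)) (# 0)
      (even-c sm q≥2 P≥1 Q≥1)
      (unit-remainder ρ q c₀ (:- # 1) (I :- L) q≥2))
    (certified-digit ρ q u₀ u₁ c′₀ c′₁ (:- # 1) (q :- # 1) (# 0) (:- (# 2)) (# 0)
      (even-c′ sm q≥2)
      (unit-remainder ρ q c′₀ (:- # 1) (I :- L :- u₁ :+ H :* (# 1 :+ # 2 :* L)) q≥2))
    (certified-digit ρ q u₀ u₁ d₀ d₁ (# 0) (# 0) (# 1) (# 0) (:- # 1)
      (even-d sm q≥2 P≥1)
      (half-remainder ρ H d₀ (:- (I :- H :* (# 1 :+ # 2 :* L)) :- # 1) h≥1))
    (certified-digit ρ q u₀ u₁ e₀ e₁ (:- # 1) (# 0) (# 0) (# 0) (# 1)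
      (even-e⁺ sm q≥2 P≥1 Q≥1)
      (half-remainder ρ H e₀ I h≥1))
    (one-digit sm q≥2)
    (identity (:- # 1) ((# 1) :+ (:- # 1) :- (# 0) :- (# 1)) ρ)
    (identity (q :- # 1) ((:- # 1) :+ (# 0) :+ q :* (# 1)) ρ)
  where
  open Even⁺
  ρ : Env 3
  ρ = h ▸ i ▸ l ▸ ∅

module Mixed where
  K K′ I L q u₀ u₁ b c₀ c₁ c′₀ c′₁ d₀ d₁ e₀ e₁ : Expr 4
  K = var 0F
  K′ = var 1F
  I = var 2F
  L = var 3F
  q = # 1 :+ # 2 :* (K :+ K′ :- # 1)
  u₀ = :- (q :* (# 2 :* L))
  u₁ = # 1 :+ # 2 :* I
  b = u₀ :+ u₁
  c₀ = K :* u₀ :+ # 1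
  c₁ = K :* u₁
  c′₀ = :- (K′ :* u₀) :+ # 1
  c′₁ = :- (K′ :* u₁)
  d₀ = :- (q :* (I :- q :* L) :+ (K :+ K′ :- # 1) :+ # 1)
  d₁ = :- (K :+ K′ :- # 1) :- q :* I :+ I :- q :* L
  e₀ = (K :+ K′ :- # 1) :+ # 1 :+ q :* I
  e₁ = q :* L :- I :- # 1

-- As q is odd, θ(1 + θ) ≡ 1 modulo 2: the corrections 1 - θ for e and -1 for d have the right
-- parities, and P > Q is the sign condition for both.
mixed : ∀ k k′ i l {q u₀ u₁} → let ρ = k ▸ k′ ▸ i ▸ l ▸ ∅ in
  q ≡ ⟦ Mixed.q ⟧ ρ → u₀ ≡ ⟦ Mixed.u₀ ⟧ ρ → u₁ ≡ ⟦ Mixed.u₁ ⟧ ρ →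
  let P = Pᵤ q u₀ u₁ ; Q = Qᵤ q u₀ u₁ ; M = Mᵤ q u₀ u₁ in
  Small q M P Q →
  NonNeg (q - + 3) → NonNeg (P - Q - 1ℤ) → Strip q (q - 1ℤ) k k′ → Witness q u₀ u₁
mixed k k′ i l refl refl refl sm q≥3 P>Q (k⁺ , k⁻ , k′⁺ , k′⁻) = assemble
    (certified-digit ρ q u₀ u₁ c₀ c₁ (# 0) (# 2 :* K) (# 0) (# 2) (# 0)
      (strip {β = ⟦ # 2 :* K ⟧ ρ} sm q≥2 k⁺ k⁻)
      (unit-remainder ρ q c₀ (# 1) (:- (K :* (# 2 :* L))) q≥2))
    (certified-digit ρ q u₀ u₁ c′₀ c′₁ (# 0) (:- (# 2 :* K′)) (# 0) (# 2) (# 0)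
      (strip {β = ⟦ :- (# 2 :* K′) ⟧ ρ} sm q≥2 k′⁺ k′⁻)
      (unit-remainder ρ q c′₀ (# 1) (K′ :* (# 2 :* L)) q≥2))
    (certified-digit ρ q u₀ u₁ d₀ d₁ (# 0) (# 0) (# 1) (:- # 1) (# 0)
      (mixed-d sm q≥3 P>Q)
      (unit-remainder ρ q d₀ (:- (# 2)) (b) q≥2))
    (certified-digit ρ q u₀ u₁ e₀ e₁ (:- # 1) (# 0) (# 0) (# 1) (:- # 1)
      (mixed-e sm q≥3 P>Q)
      (unit-remainder ρ q e₀ (# 2) (u₁) q≥2))
    (one-digit sm q≥2)
    (identity (# 0) ((# 0) :+ (# 0) :- (# 1) :- (:- # 1)) ρ)
    (identity (:- (# 2 :* K′)) ((# 2 :* K) :+ (:- # 1) :+ q :* (:- # 1)) ρ)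
  where
  open Mixed
  ρ : Env 4
  ρ = k ▸ k′ ▸ i ▸ l ▸ ∅
  q≥2 : NonNeg (⟦ q ⟧ ρ - + 2)
  q≥2 = subst NonNeg (lem-q≥2 (⟦ q ⟧ ρ)) (q≥3 ⊕ lit 1)

module Unit⁺ where
  H I L q u₀ u₁ b c₀ c₁ c′₀ c′₁ d₀ d₁ e₀ e₁ : Expr 3
  H = var 0F
  I = var 1F
  L = var 2F
  q = # 1 :+ # 2 :* (H)
  u₀ = :- (q :* (# 1 :+ # 2 :* L))
  u₁ = # 1 :+ # 2 :* I
  b = u₀ :+ u₁
  c₀ = :- (H :+ # 1 :+ q :* I)
  c₁ = :- (H :+ q :* L :- I)
  c′₀ = :- (H :+ # 1 :+ q :* I) :+ q :* u₁ :+ H :* u₀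
  c′₁ = :- (H :+ q :* L :- I) :- b :+ H :* u₁
  d₀ = q :* (H :+ q :* L :- I) :+ H
  d₁ = :- (H :+ # 1) :- q :* I :- (H :+ q :* L :- I)
  e₀ = H :+ # 1 :+ q :* I
  e₁ = (H :+ q :* L :- I)

-- Here θT ≡ θ modulo 2, but the plain correction -θ would leave q dividing the first coordinate of
-- d. Adding q - 1 repairs this and keeps the parity; for negative Q, -(q + 1) + θ takes its place.
unit⁺ : ∀ h i l {q u₀ u₁} → let ρ = h ▸ i ▸ l ▸ ∅ in
  q ≡ ⟦ Unit⁺.q ⟧ ρ → u₀ ≡ ⟦ Unit⁺.u₀ ⟧ ρ → u₁ ≡ ⟦ Unit⁺.u₁ ⟧ ρ →
  let P = Pᵤ q u₀ u₁ ; Q = Qᵤ q u₀ u₁ ; M = Mᵤ q u₀ u₁ in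
  Small q M P Q →
  NonNeg (q - + 3) → NonNeg (P - 1ℤ) → NonNeg (Q - 1ℤ) → NonNeg (q * M - (q + 1ℤ) * P - 1ℤ) → Witness q u₀ u₁
unit⁺ h i l refl refl refl sm q≥3 P≥1 Q≥1 qP = assemble
    (certified-digit ρ q u₀ u₁ c₀ c₁ (# 1) (# 0) (# 0) (:- # 1) (# 0)
      (unit-c sm q≥3 P≥1)
      (unit-remainder ρ q c₀ (:- (# 2)) (u₁) q≥2))
    (certified-digit ρ q u₀ u₁ c′₀ c′₁ (:- # 1) (q :- # 1) (# 0) (:- # 1) (# 0)
      (unit-c′ sm q≥3 P≥1)
      (unit-remainder ρ q c′₀ (:- (# 2)) (:- u₁ :+ # 2 :* H :* (# 1 :+ # 2 :* L)) q≥2))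
    (certified-digit ρ q u₀ u₁ d₀ d₁ (# 0) (# 0) (# 1) (q :- # 1) (:- # 1)
      (unit-d⁺ sm q≥3 P≥1 Q≥1 qP)
      (unit-remainder ρ q d₀ (:- (# 2)) (b :- # 1) q≥2))
    (certified-digit ρ q u₀ u₁ e₀ e₁ (:- # 1) (# 0) (# 0) (# 1) (# 0)
      (unit-e sm q≥3 P≥1)
      (unit-remainder ρ q e₀ (# 2) (u₁) q≥2))
    (one-digit sm q≥2)
    (identity (:- # 1) ((# 1) :+ (:- # 1) :- (# 1) :- (# 0)) ρ)
    (identity (q :- # 1) ((# 0) :+ (q :- # 1) :+ q :* (# 0)) ρ)
  where
  open Unit⁺
  ρ : Env 3
  ρ = h ▸ i ▸ l ▸ ∅
  q≥2 : NonNeg (⟦ q ⟧ ρ - + 2)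
  q≥2 = subst NonNeg (lem-q≥2 (⟦ q ⟧ ρ)) (q≥3 ⊕ lit 1)

module Unit⁻ where
  K K′ I L q u₀ u₁ b c₀ c₁ c′₀ c′₁ d₀ d₁ e₀ e₁ : Expr 4
  K = var 0F
  K′ = var 1F
  I = var 2F
  L = var 3F
  q = # 1 :+ # 2 :* (K :+ K′ :- # 1)
  u₀ = :- (q :* (# 1 :+ # 2 :* L))
  u₁ = # 1 :+ # 2 :* I
  b = u₀ :+ u₁
  c₀ = K :* u₀ :+ # 1
  c₁ = K :* u₁
  c′₀ = :- (K′ :* u₀) :+ # 1
  c′₁ = :- (K′ :* u₁)
  d₀ = q :* ((K :+ K′ :- # 1) :+ q :* L :- I) :- ((K :+ K′ :- # 1) :+ # 1)
  d₁ = :- (K :+ K′ :- # 1) :- q :* I :- ((K :+ K′ :- # 1) :+ q :* L :- I)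
  e₀ = (K :+ K′ :- # 1) :+ # 1 :+ q :* I
  e₁ = ((K :+ K′ :- # 1) :+ q :* L :- I)

unit⁻ : ∀ k k′ i l {q u₀ u₁} → let ρ = k ▸ k′ ▸ i ▸ l ▸ ∅ in
  q ≡ ⟦ Unit⁻.q ⟧ ρ → u₀ ≡ ⟦ Unit⁻.u₀ ⟧ ρ → u₁ ≡ ⟦ Unit⁻.u₁ ⟧ ρ →
  let P = Pᵤ q u₀ u₁ ; Q = Qᵤ q u₀ u₁ ; M = Mᵤ q u₀ u₁ in
  Small q M P Q →
  NonNeg (q - + 3) → NonNeg (P - 1ℤ) → NonNeg (- Q - 1ℤ) → NonNeg (q * M - (q + 1ℤ) * P - 1ℤ) →
  Strip q (q - 1ℤ) k k′ → Witness q u₀ u₁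
unit⁻ k k′ i l refl refl refl sm q≥3 P≥1 Q≤-1 qP (k⁺ , k⁻ , k′⁺ , k′⁻) = assemble
    (certified-digit ρ q u₀ u₁ c₀ c₁ (# 0) (# 2 :* K) (# 0) (# 2) (# 0)
      (strip {β = ⟦ # 2 :* K ⟧ ρ} sm q≥2 k⁺ k⁻)
      (unit-remainder ρ q c₀ (# 1) (:- (K :* (# 1 :+ # 2 :* L))) q≥2))
    (certified-digit ρ q u₀ u₁ c′₀ c′₁ (# 0) (:- (# 2 :* K′)) (# 0) (# 2) (# 0)
      (strip {β = ⟦ :- (# 2 :* K′) ⟧ ρ} sm q≥2 k′⁺ k′⁻)
      (unit-remainder ρ q c′₀ (# 1) (K′ :* (# 1 :+ # 2 :* L)) q≥2))
    (certified-digit ρ q u₀ u₁ d₀ d₁ (# 0) (# 0) (# 1) (:- q :- # 1) (# 1)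
      (unit-d⁻ sm q≥3 P≥1 Q≤-1 qP)
      (unit-remainder ρ q d₀ (:- (# 2)) (b :+ # 1) q≥2))
    (certified-digit ρ q u₀ u₁ e₀ e₁ (:- # 1) (# 0) (# 0) (# 1) (# 0)
      (unit-e sm q≥3 P≥1)
      (unit-remainder ρ q e₀ (# 2) (u₁) q≥2))
    (one-digit sm q≥2)
    (identity (# 0) ((# 0) :+ (# 1) :- (# 1) :- (# 0)) ρ)
    (identity (:- (# 2 :* K′)) ((# 2 :* K) :+ (:- q :- # 1) :+ q :* (# 0)) ρ)
  where
  open Unit⁻
  ρ : Env 4
  ρ = k ▸ k′ ▸ i ▸ l ▸ ∅
  q≥2 : NonNeg (⟦ q ⟧ ρ - + 2)
  q≥2 = subst NonNeg (lem-q≥2 (⟦ q ⟧ ρ)) (q≥3 ⊕ lit 1)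

module Axis⁺ where
  N H I L q u₀ u₁ b c₀ c₁ c′₀ c′₁ d₀ d₁ e₀ e₁ : Expr 4
  N = var 0F
  H = var 1F
  I = var 2F
  L = var 3F
  q = # 1 :+ # 2 :* (H)
  u₀ = :- (q :* (# 1 :+ # 2 :* L))
  u₁ = # 2 :* I
  b = u₀ :+ u₁
  c₀ = :- (q :* I) :- # 1
  c₁ = :- (H :+ q :* L :- I :- N)
  c′₀ = :- (q :* I) :- # 1 :+ q :* u₁ :+ H :* u₀
  c′₁ = :- (H :+ q :* L :- I :- N) :- b :+ H :* u₁
  d₀ = # 2 :* H :* (H :+ # 1) :+ (N :+ # 1) :* q :+ q :* q :* L :- q :* I
  d₁ = :- (q :* I) :- q :* L :+ I :- N :- H :- # 1
  e₀ = q :* I :+ # 1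
  e₁ = H :+ q :* L :- I :- N

-- The correction 2 - mθ of e needs m odd by parity and mQ < 2P by sign, while d asks for (m + 1)Q ≥
-- P; so m depends on the ratio of P and Q. In d the term mq cancels qσᵉ = -mq, which keeps c - c′
-- independent of m.
axis⁺ : ∀ n h i l {q u₀ u₁} → let ρ = n ▸ h ▸ i ▸ l ▸ ∅ in
  q ≡ ⟦ Axis⁺.q ⟧ ρ → u₀ ≡ ⟦ Axis⁺.u₀ ⟧ ρ → u₁ ≡ ⟦ Axis⁺.u₁ ⟧ ρ →
  let P = Pᵤ q u₀ u₁ ; Q = Qᵤ q u₀ u₁ ; M = Mᵤ q u₀ u₁ in
  Small q M P Q →
  NonNeg (q - + 3) → NonNeg ((+ 2 * n + 1ℤ) - 1ℤ) → NonNeg (P - 1ℤ) → NonNeg (Q - 1ℤ) →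
  NonNeg (((+ 2 * n + 1ℤ) + 1ℤ) * Q - P) → NonNeg (+ 2 * P - (+ 2 * n + 1ℤ) * Q - 1ℤ) →
  NonNeg (q * M - ((+ 2 * n + 1ℤ) * q + q + 1ℤ) * P - 1ℤ) → Witness q u₀ u₁
axis⁺ n h i l refl refl refl sm q≥3 m≥1 P≥1 Q≥1 mQ⁺ 2P⁺ mqP = assemble
    (certified-digit ρ q u₀ u₁ c₀ c₁ (# 1) (# 0) (# 0) (:- (# 2)) (# 2 :* N :+ # 1)
      (axis-c {m = ⟦ (# 2 :* N :+ # 1) ⟧ ρ} sm q≥3 m≥1 P≥1 Q≥1 mQ⁺ 2P⁺ mqP)
      (unit-remainder ρ q c₀ (:- # 1) (I) q≥2))
    (certified-digit ρ q u₀ u₁ c′₀ c′₁ (:- # 1) (q :- # 1) (# 0) (:- (# 2)) (# 2 :* N :+ # 1)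
      (axis-c′ {m = ⟦ (# 2 :* N :+ # 1) ⟧ ρ} sm q≥3 m≥1 P≥1 Q≥1 mQ⁺ 2P⁺ mqP)
      (unit-remainder ρ q c′₀ (:- # 1) (:- I :+ H :* (# 1 :+ # 2 :* L)) q≥2))
    (certified-digit ρ q u₀ u₁ d₀ d₁ (# 0) (# 0) (# 1) ((# 2 :* N :+ # 1) :* q :+ q :- # 1)
      (:- (# 2 :* N :+ # 1))
      (axis-d⁺ {m = ⟦ (# 2 :* N :+ # 1) ⟧ ρ} sm q≥3 m≥1 P≥1 Q≥1 mQ⁺ 2P⁺ mqP)
      (unit-remainder ρ q d₀ (:- (# 2)) (b :- (# 2 :* N :+ # 1) :- # 1) q≥2))
    (certified-digit ρ q u₀ u₁ e₀ e₁ (:- # 1) (# 0) (# 0) (# 2) (:- (# 2 :* N :+ # 1))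
      (axis-e⁺ {m = ⟦ (# 2 :* N :+ # 1) ⟧ ρ} sm q≥3 m≥1 P≥1 Q≥1 mQ⁺ 2P⁺ mqP)
      (unit-remainder ρ q e₀ (# 1) (I) q≥2))
    (one-digit sm q≥2)
    (identity (:- # 1) ((# 1) :+ (:- (# 2 :* N :+ # 1)) :- (# 2) :- (:- (# 2 :* N :+ # 1))) ρ)
    (identity (q :- # 1) ((# 0) :+ ((# 2 :* N :+ # 1) :* q :+ q :- # 1) :+ q :* (:- (# 2 :* N :+ # 1))) ρ)
  where
  open Axis⁺
  ρ : Env 4
  ρ = n ▸ h ▸ i ▸ l ▸ ∅
  q≥2 : NonNeg (⟦ q ⟧ ρ - + 2)
  q≥2 = subst NonNeg (lem-q≥2 (⟦ q ⟧ ρ)) (q≥3 ⊕ lit 1)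

module Axis⁻ where
  N K K′ I L q u₀ u₁ b c₀ c₁ c′₀ c′₁ d₀ d₁ e₀ e₁ : Expr 5
  N = var 0F
  K = var 1F
  K′ = var 2F
  I = var 3F
  L = var 4F
  q = # 1 :+ # 2 :* (K :+ K′ :- # 1)
  u₀ = :- (q :* (# 1 :+ # 2 :* L))
  u₁ = # 2 :* I
  b = u₀ :+ u₁
  c₀ = K :* u₀ :+ # 1
  c₁ = K :* u₁
  c′₀ = :- (K′ :* u₀) :+ # 1
  c′₁ = :- (K′ :* u₁)
  d₀ = # 2 :* (K :+ K′ :- # 1) :* ((K :+ K′ :- # 1) :+ # 1) :- (N :+ # 1) :* q :+ q :* q :* L :- q :* I
  d₁ = :- (q :* I) :- q :* L :+ I :+ N :+ # 1 :- (K :+ K′ :- # 1)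
  e₀ = q :* I :+ # 1
  e₁ = (K :+ K′ :- # 1) :+ q :* L :- I :+ N :+ # 1

axis⁻ : ∀ n k k′ i l {q u₀ u₁} → let ρ = n ▸ k ▸ k′ ▸ i ▸ l ▸ ∅ in
  q ≡ ⟦ Axis⁻.q ⟧ ρ → u₀ ≡ ⟦ Axis⁻.u₀ ⟧ ρ → u₁ ≡ ⟦ Axis⁻.u₁ ⟧ ρ →
  let P = Pᵤ q u₀ u₁ ; Q = Qᵤ q u₀ u₁ ; M = Mᵤ q u₀ u₁ in
  Small q M P Q →
  NonNeg (q - + 3) → NonNeg ((+ 2 * n + 1ℤ) - 1ℤ) → NonNeg (P - 1ℤ) → NonNeg (- Q - 1ℤ) →
  NonNeg (((+ 2 * n + 1ℤ) + 1ℤ) * - Q - P) → NonNeg (+ 2 * P - (+ 2 * n + 1ℤ) * - Q - 1ℤ) →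
  NonNeg (q * M - ((+ 2 * n + 1ℤ) * q + q + 1ℤ) * P - 1ℤ) → Strip q (q - 1ℤ) k k′ → Witness q u₀ u₁
axis⁻ n k k′ i l refl refl refl sm q≥3 m≥1 P≥1 Q≤-1 mQ⁻ 2P⁻ mqP (k⁺ , k⁻ , k′⁺ , k′⁻) = assemble
    (certified-digit ρ q u₀ u₁ c₀ c₁ (# 0) (# 2 :* K) (# 0) (# 2) (# 0)
      (strip {β = ⟦ # 2 :* K ⟧ ρ} sm q≥2 k⁺ k⁻)
      (unit-remainder ρ q c₀ (# 1) (:- (K :* (# 1 :+ # 2 :* L))) q≥2))
    (certified-digit ρ q u₀ u₁ c′₀ c′₁ (# 0) (:- (# 2 :* K′)) (# 0) (# 2) (# 0)
      (strip {β = ⟦ :- (# 2 :* K′) ⟧ ρ} sm q≥2 k′⁺ k′⁻)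
      (unit-remainder ρ q c′₀ (# 1) (K′ :* (# 1 :+ # 2 :* L)) q≥2))
    (certified-digit ρ q u₀ u₁ d₀ d₁ (# 0) (# 0) (# 1) (:- ((# 2 :* N :+ # 1) :* q :+ q :+ # 1))
      ((# 2 :* N :+ # 1) :+ # 2)
      (axis-d⁻ {m = ⟦ (# 2 :* N :+ # 1) ⟧ ρ} sm q≥3 m≥1 P≥1 Q≤-1 mQ⁻ 2P⁻ mqP)
      (unit-remainder ρ q d₀ (:- (# 2)) (b :+ (# 2 :* N :+ # 1) :+ # 1) q≥2))
    (certified-digit ρ q u₀ u₁ e₀ e₁ (:- # 1) (# 0) (# 0) (# 2) (# 2 :* N :+ # 1)
      (axis-e⁻ {m = ⟦ (# 2 :* N :+ # 1) ⟧ ρ} sm q≥3 m≥1 P≥1 Q≤-1 mQ⁻ 2P⁻ mqP)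
      (unit-remainder ρ q e₀ (# 1) (I) q≥2))
    (one-digit sm q≥2)
    (identity (# 0) ((# 0) :+ ((# 2 :* N :+ # 1) :+ # 2) :- (# 2) :- (# 2 :* N :+ # 1)) ρ)
    (identity (:- (# 2 :* K′)) ((# 2 :* K) :+ (:- ((# 2 :* N :+ # 1) :* q :+ q :+ # 1)) :+ q :*
      (# 2 :* N :+ # 1)) ρ)
  where
  open Axis⁻
  ρ : Env 5
  ρ = n ▸ k ▸ k′ ▸ i ▸ l ▸ ∅
  q≥2 : NonNeg (⟦ q ⟧ ρ - + 2)
  q≥2 = subst NonNeg (lem-q≥2 (⟦ q ⟧ ρ)) (q≥3 ⊕ lit 1)

module Steep⁺ where
  H I L q u₀ u₁ b c₀ c₁ c′₀ c′₁ d₀ d₁ e₀ e₁ : Expr 3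
  H = var 0F
  I = var 1F
  L = var 2F
  q = # 1 :+ # 2 :* (H)
  u₀ = :- (q :* (# 1 :+ # 2 :* L))
  u₁ = # 2 :* I
  b = u₀ :+ u₁
  c₀ = :- (q :* I) :+ q :* (# 1 :+ # 2 :* L) :+ # 1
  c₁ = :- H :- q :* L :- I :- # 1
  c′₀ = :- (q :* I) :+ q :* (# 1 :+ # 2 :* L) :+ # 1 :+ q :* u₁ :+ (H :+ # 1) :* u₀
  c′₁ = :- H :- q :* L :- I :- # 1 :- b :+ (H :+ # 1) :* u₁
  d₀ = # 2 :* H :* (H :+ # 1) :+ # 1 :+ q :* q :* L :- q :* I
  d₁ = :- (q :* I) :- q :* L :+ I :- H :- # 2
  e₀ = q :* I :- # 1
  e₁ = H :+ q :* L :- I :+ # 1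

-- For Q > 2P not even m = 1 is possible in `axis⁺`. The opposite correction -2 + θ of e is then the
-- one with the right sign.
steep⁺ : ∀ h i l {q u₀ u₁} → let ρ = h ▸ i ▸ l ▸ ∅ in
  q ≡ ⟦ Steep⁺.q ⟧ ρ → u₀ ≡ ⟦ Steep⁺.u₀ ⟧ ρ → u₁ ≡ ⟦ Steep⁺.u₁ ⟧ ρ →
  let P = Pᵤ q u₀ u₁ ; Q = Qᵤ q u₀ u₁ ; M = Mᵤ q u₀ u₁ in
  Small q M P Q →
  NonNeg (q - + 3) → NonNeg (P - 1ℤ) → NonNeg (Q - + 2 * P - 1ℤ) → NonNeg (q * M - (q + 1ℤ) * P - 1ℤ) →
    Witness q u₀ u₁
steep⁺ h i l refl refl refl sm q≥3 P≥1 Q>2P qP = assemble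
    (certified-digit ρ q u₀ u₁ c₀ c₁ (# 1) (:- (# 2)) (# 0) (# 2) (:- # 1)
      (steep-c sm q≥3 P≥1 Q>2P qP)
      (unit-remainder ρ q c₀ (# 1) (:- I :+ (# 1 :+ # 2 :* L)) q≥2))
    (certified-digit ρ q u₀ u₁ c′₀ c′₁ (:- # 1) (q :- # 1) (# 0) (# 2) (:- # 1)
      (steep-c′ sm q≥3 P≥1 Q>2P qP)
      (unit-remainder ρ q c′₀ (# 1) (:- I :+ (# 1 :+ # 2 :* L) :+ u₁ :- (H :+ # 1) :* (# 1 :+ # 2 :* L)) q≥2))
    (certified-digit ρ q u₀ u₁ d₀ d₁ (# 0) (# 0) (# 1) (# 1) (:- (# 3))
      (steep-d⁺ sm q≥3 P≥1 Q>2P qP)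
      (unit-remainder ρ q d₀ (# 2) (:- b) q≥2))
    (certified-digit ρ q u₀ u₁ e₀ e₁ (:- # 1) (# 0) (# 0) (:- (# 2)) (# 1)
      (steep-e⁺ sm q≥3 P≥1 Q>2P)
      (unit-remainder ρ q e₀ (:- # 1) (:- I) q≥2))
    (one-digit sm q≥2)
    (identity (:- # 1) ((# 1) :+ (:- (# 3)) :- (:- (# 2)) :- (# 1)) ρ)
    (identity (q :- # 1) ((:- (# 2)) :+ (# 1) :+ q :* (# 1)) ρ)
  where
  open Steep⁺
  ρ : Env 3
  ρ = h ▸ i ▸ l ▸ ∅
  q≥2 : NonNeg (⟦ q ⟧ ρ - + 2)
  q≥2 = subst NonNeg (lem-q≥2 (⟦ q ⟧ ρ)) (q≥3 ⊕ lit 1)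

module Steep⁻ where
  K K′ I L q u₀ u₁ b c₀ c₁ c′₀ c′₁ d₀ d₁ e₀ e₁ : Expr 4
  K = var 0F
  K′ = var 1F
  I = var 2F
  L = var 3F
  q = # 1 :+ # 2 :* (K :+ K′ :- # 1)
  u₀ = :- (q :* (# 1 :+ # 2 :* L))
  u₁ = # 2 :* I
  b = u₀ :+ u₁
  c₀ = K :* u₀ :+ # 1
  c₁ = K :* u₁
  c′₀ = :- (K′ :* u₀) :+ # 1
  c′₁ = :- (K′ :* u₁)
  d₀ = # 2 :* (K :+ K′ :- # 1) :* ((K :+ K′ :- # 1) :+ # 1) :+ q :* q :* L :- q :* I
  d₁ = :- (q :* I) :- q :* L :+ I :- (K :+ K′ :- # 1) :- # 2
  e₀ = q :* I :- # 1
  e₁ = (K :+ K′ :- # 1) :+ q :* L :- I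

steep⁻ : ∀ k k′ i l {q u₀ u₁} → let ρ = k ▸ k′ ▸ i ▸ l ▸ ∅ in
  q ≡ ⟦ Steep⁻.q ⟧ ρ → u₀ ≡ ⟦ Steep⁻.u₀ ⟧ ρ → u₁ ≡ ⟦ Steep⁻.u₁ ⟧ ρ →
  let P = Pᵤ q u₀ u₁ ; Q = Qᵤ q u₀ u₁ ; M = Mᵤ q u₀ u₁ in
  Small q M P Q →
  NonNeg (q - + 3) → NonNeg (P - 1ℤ) → NonNeg (- Q - + 2 * P - 1ℤ) → NonNeg (q * M - (q + 1ℤ) * P - 1ℤ) →
  Strip q (q - 1ℤ) k k′ → Witness q u₀ u₁
steep⁻ k k′ i l refl refl refl sm q≥3 P≥1 -Q>2P qP (k⁺ , k⁻ , k′⁺ , k′⁻) = assemble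
    (certified-digit ρ q u₀ u₁ c₀ c₁ (# 0) (# 2 :* K) (# 0) (# 2) (# 0)
      (strip {β = ⟦ # 2 :* K ⟧ ρ} sm q≥2 k⁺ k⁻)
      (unit-remainder ρ q c₀ (# 1) (:- (K :* (# 1 :+ # 2 :* L))) q≥2))
    (certified-digit ρ q u₀ u₁ c′₀ c′₁ (# 0) (:- (# 2 :* K′)) (# 0) (# 2) (# 0)
      (strip {β = ⟦ :- (# 2 :* K′) ⟧ ρ} sm q≥2 k′⁺ k′⁻)
      (unit-remainder ρ q c′₀ (# 1) (K′ :* (# 1 :+ # 2 :* L)) q≥2))
    (certified-digit ρ q u₀ u₁ d₀ d₁ (# 0) (# 0) (# 1) (:- # 1) (:- (# 3))
      (steep-d⁻ sm q≥3 P≥1 -Q>2P qP)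
      (unit-remainder ρ q d₀ (:- (# 2)) (b) q≥2))
    (certified-digit ρ q u₀ u₁ e₀ e₁ (:- # 1) (# 0) (# 0) (:- (# 2)) (:- # 1)
      (steep-e⁻ sm q≥3 -Q>2P qP)
      (unit-remainder ρ q e₀ (:- # 1) (:- I) q≥2))
    (one-digit sm q≥2)
    (identity (# 0) ((# 0) :+ (:- (# 3)) :- (:- (# 2)) :- (:- # 1)) ρ)
    (identity (:- (# 2 :* K′)) ((# 2 :* K) :+ (:- # 1) :+ q :* (:- # 1)) ρ)
  where
  open Steep⁻
  ρ : Env 4
  ρ = k ▸ k′ ▸ i ▸ l ▸ ∅
  q≥2 : NonNeg (⟦ q ⟧ ρ - + 2)
  q≥2 = subst NonNeg (lem-q≥2 (⟦ q ⟧ ρ)) (q≥3 ⊕ lit 1)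

-- Estimates for P and Q

sign-cases : ∀ {x} → x ≢ 0ℤ → NonNeg (x - 1ℤ) ⊎ NonNeg (- x - 1ℤ)
sign-cases {+ 0} h = contradiction refl h
sign-cases {+ ℕ.suc n} h = inj₁ (lit n)
sign-cases { -[1+ n ]} h = inj₂ (lit n)

ℕ-parity : ∀ n → (∃ λ i → n ≡ 2 ℕ.* i) ⊎ (∃ λ i → n ≡ 1 ℕ.+ 2 ℕ.* i)
ℕ-parity 0 = inj₁ (0 , refl)
ℕ-parity (ℕ.suc n) with ℕ-parity n
... | inj₁ (i , refl) = inj₂ (i , refl)
... | inj₂ (i , refl) = inj₁ (ℕ.suc i , sym (ℕ.*-suc 2 i))

parity : ∀ x → (∃ λ i → x ≡ + 2 * i) ⊎ (∃ λ i → x ≡ 1ℤ + + 2 * i)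
parity (+ n) with ℕ-parity n
... | inj₁ (i , refl) = inj₁ (+ i , ℤ.pos-* 2 i)
... | inj₂ (i , refl) = inj₂ (+ i , cong (λ k → 1ℤ + k) (ℤ.pos-* 2 i))
parity -[1+ n ] with ℕ-parity n
... | inj₁ (i , refl) = inj₂ (- + i - 1ℤ , trans (cong (λ k → - (1ℤ + k)) (ℤ.pos-* 2 i)) (lem (+ i)))
  where
  lem : ∀ i → - (1ℤ + + 2 * i) ≡ 1ℤ + + 2 * (- i - 1ℤ)
  lem = solve-∀
... | inj₂ (i , refl) = inj₁ (- + i - 1ℤ , trans (cong (λ k → - (1ℤ + (1ℤ + k))) (ℤ.pos-* 2 i)) (lem (+ i)))
  where
  lem : ∀ i → - (1ℤ + (1ℤ + + 2 * i)) ≡ + 2 * (- i - 1ℤ)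
  lem = solve-∀

even≢odd : ∀ {x} i j → x ≡ + 2 * i → x ≢ 1ℤ + + 2 * j
even≢odd i j refl eq = not-unit (+ 2) (lit 0) (i - j) (trans (lem i j) (trans (cong (_- + 2 * j) eq) (lem′ j)))
  where
  lem : ∀ i j → + 2 * (i - j) ≡ + 2 * i - + 2 * j
  lem = solve-∀
  lem′ : ∀ j → 1ℤ + + 2 * j - + 2 * j ≡ 1ℤ
  lem′ = solve-∀

square-NonNeg : ∀ x → NonNeg (x * x)
square-NonNeg (+ n) = lit n ⊗ lit n
square-NonNeg -[1+ n ] = lit _

square-cancel : ∀ a b → NonNeg (b * b - a * a) → NonNeg b → NonNeg (b - a)
square-cancel a b h hb with b - a in eq
... | + n = lit n
... | -[1+ n ] = contradiction {A = NonNeg (- (1ℤ + (+ n * + n + + 2 * + n + + 2 * (1ℤ + + n) * b)))}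
  (subst NonNeg (trans (lem a b) (trans (cong (λ d → d * (+ 2 * b - d)) eq) (lem′ (+ n) b))) h)
    (negative (lit n ⊗ lit n ⊕ lit 2 ⊗ lit n ⊕ lit 2 ⊗ (lit 1 ⊕ lit n) ⊗ hb))
  where
  lem : ∀ a b → b * b - a * a ≡ (b - a) * (+ 2 * b - (b - a))
  lem = solve-∀
  lem′ : ∀ n b → - (1ℤ + n) * (+ 2 * b - - (1ℤ + n)) ≡ - (1ℤ + (n * n + + 2 * n + + 2 * (1ℤ + n) * b))
  lem′ = solve-∀
  negative : ∀ {x} → NonNeg x → ¬ NonNeg (- (1ℤ + x))
  negative {+ m} _ ()

-- (kx)² ≤ 4ck²N ≤ (N - 2)N < (N - 1)². The summand + 2 in the assumption is what makes the last two
-- steps possible.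
sqrt-bound : ∀ N x c k → NonNeg (+ 4 * c * N - x * x) → NonNeg c → NonNeg (N - (+ 4 * c * (k * k) + + 2)) →
  NonNeg (N - k * x - 1ℤ)
sqrt-bound N x c k h hc hN = subst NonNeg (lem₁ N (k * x))
  (square-cancel (k * x) (N - 1ℤ)
    (subst NonNeg (lem N x c k) (square-NonNeg k ⊗ h ⊕ (hN ⊕ lit 4 ⊗ hc ⊗ square-NonNeg k ⊕ lit 2) ⊗ hN
      ⊕ lit 1))
    (subst NonNeg (lem₂ N c k) (hN ⊕ lit 4 ⊗ hc ⊗ square-NonNeg k ⊕ lit 1)))
  where
  lem₁ : ∀ N y → N - 1ℤ - y ≡ N - y - 1ℤ
  lem₁ = solve-∀
  lem₂ : ∀ N c k → N - (+ 4 * c * (k * k) + + 2) + + 4 * c * (k * k) + 1ℤ ≡ N - 1ℤ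
  lem₂ = solve-∀
  lem : ∀ N x c k → k * k * (+ 4 * c * N - x * x)
    + (N - (+ 4 * c * (k * k) + + 2) + + 4 * c * (k * k) + + 2) * (N - (+ 4 * c * (k * k) + + 2)) + 1ℤ
    ≡ (N - 1ℤ) * (N - 1ℤ) - k * x * (k * x)
  lem = solve-∀

nonNeg-cancel : ∀ a x → 0ℤ <ᶻ a → NonNeg (a * x) → NonNeg x
nonNeg-cancel (+ ℕ.suc n) x _ h = nonNeg-cert n h refl
nonNeg-cancel (+ 0) x (+<+ ()) _

module Cauchy (q : ℤ) (q≥2 : NonNeg (q - + 2)) (u₀ u₁ : ℤ) where
  M P Q : ℤ
  M = Mᵤ q u₀ u₁
  P = Pᵤ q u₀ u₁
  Q = Qᵤ q u₀ u₁

  4q-1 : 0ℤ <ᶻ + 4 * q - 1ℤ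
  4q-1 = cert 0 (lit 4 ⊗ q≥2 ⊕ lit 6) (solve (q ∷ []))

  q≥0 : 0ℤ ≤ᶻ q
  q≥0 = nonNeg-cert 0 (q≥2 ⊕ lit 2) (solve (q ∷ []))

  -- Cauchy–Schwarz as an exact identity: 1 - 4q is the discriminant of the norm form.
  P²-bound : NonNeg (+ 4 * 1ℤ * (q * M) - P * P)
  P²-bound = nonNeg-cancel _ _ 4q-1 (subst NonNeg (lem q u₀ u₁) (square-NonNeg (+ 2 * Q - P)))
    where
    lem : ∀ q u₀ u₁ → (+ 2 * (- (q * u₁) + + 2 * q * (u₀ + u₁)) - (+ 2 * - (q * u₁) + (u₀ + u₁))) *
      (+ 2 * (- (q * u₁) + + 2 * q * (u₀ + u₁)) - (+ 2 * - (q * u₁) + (u₀ + u₁)))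
      ≡ (+ 4 * q - 1ℤ) * (+ 4 * 1ℤ * (q * (u₀ * u₀ + u₀ * u₁ + q * (u₁ * u₁))) -
        (+ 2 * - (q * u₁) + (u₀ + u₁)) * (+ 2 * - (q * u₁) + (u₀ + u₁)))
    lem = solve-∀

  Q²-bound : NonNeg (+ 4 * q * (q * M) - Q * Q)
  Q²-bound = nonNeg-cancel _ _ 4q-1 (subst NonNeg (lem q u₀ u₁) (square-NonNeg (+ 2 * q * P - Q)))
    where
    lem : ∀ q u₀ u₁ → (+ 2 * q * (+ 2 * - (q * u₁) + (u₀ + u₁)) - (- (q * u₁) + + 2 * q * (u₀ + u₁))) *
      (+ 2 * q * (+ 2 * - (q * u₁) + (u₀ + u₁)) - (- (q * u₁) + + 2 * q * (u₀ + u₁)))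
      ≡ (+ 4 * q - 1ℤ) * (+ 4 * q * (q * (u₀ * u₀ + u₀ * u₁ + q * (u₁ * u₁))) -
        (- (q * u₁) + + 2 * q * (u₀ + u₁)) * (- (q * u₁) + + 2 * q * (u₀ + u₁)))
    lem = solve-∀

  negated : ∀ c x → NonNeg (c - x * x) → NonNeg (c - - x * - x)
  negated c x = subst NonNeg (lem c x)
    where
    lem : ∀ c x → c - x * x ≡ c - - x * - x
    lem = solve-∀

  -- 36(2q + 1)² is 4k² for k = 3(2q + 1), the largest multiple of P compared with N. It comes from
  -- `axis-multiplier`, where 6N is split into 2N, which dominates 6(2q + 1)P, and 4N, which
  -- dominates P² and so 12nqP.
  module _ (large : NonNeg (q * M - (+ 36 * ((+ 2 * q + 1ℤ) * (+ 2 * q + 1ℤ)) + + 2))) where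
    threshold : ∀ c k y → NonNeg y → + 36 * ((+ 2 * q + 1ℤ) * (+ 2 * q + 1ℤ)) ≡ + 4 * c * (k * k) + y →
      NonNeg (q * M - (+ 4 * c * (k * k) + + 2))
    threshold c k y hy eq = subst NonNeg (trans (cong (λ z → q * M - (z + + 2) + y) eq)
      (lem (q * M) (+ 4 * c * (k * k)) y)) (large ⊕ hy)
      where
      lem : ∀ N z y → N - (z + y + + 2) + y ≡ N - (z + + 2)
      lem = solve-∀

    P-bound : ∀ k y → NonNeg y → + 36 * ((+ 2 * q + 1ℤ) * (+ 2 * q + 1ℤ)) ≡ + 4 * 1ℤ * (k * k) + y →
      NonNeg (q * M - k * P - 1ℤ) × NonNeg (q * M - k * - P - 1ℤ)
    P-bound k y hy eq = sqrt-bound (q * M) P 1ℤ k P²-bound (lit 1) (threshold 1ℤ k y hy eq)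
      , sqrt-bound (q * M) (- P) 1ℤ k (negated (+ 4 * 1ℤ * (q * M)) P P²-bound) (lit 1) (threshold 1ℤ k y hy eq)

    qP-bound : NonNeg (q * M - (q + 1ℤ) * P - 1ℤ) × NonNeg (q * M - (q + 1ℤ) * - P - 1ℤ)
    qP-bound = P-bound (q + 1ℤ) (+ 140 * (q * q) + + 136 * q + + 32)
      (lit 140 ⊗ (q≥0 ⊗ q≥0) ⊕ lit 136 ⊗ q≥0 ⊕ lit 32) (solve (q ∷ []))

    3KP-bound : NonNeg (q * M - (+ 3 * (+ 2 * q + 1ℤ)) * P - 1ℤ)
      × NonNeg (q * M - (+ 3 * (+ 2 * q + 1ℤ)) * - P - 1ℤ)
    3KP-bound = P-bound (+ 3 * (+ 2 * q + 1ℤ)) 0ℤ (lit 0) (solve (q ∷ []))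

    small-of-large : Small q M P Q
    small-of-large = small
      (nonNeg-cancel q M (cert 0 (q≥2 ⊕ lit 1) (solve (q ∷ [])))
        (subst NonNeg (lem (q * M) q) (large ⊕ lit 36 ⊗ square-NonNeg (+ 2 * q + 1ℤ) ⊕ lit 2)))
      (proj₁ 4P) (subst NonNeg (minus-minus (q * M) (+ 4) P) (proj₂ 4P))
      (sqrt-bound (q * M) Q q (+ 3) Q²-bound q≥0 3Q)
      (subst NonNeg (minus-minus (q * M) (+ 3) Q)
        (sqrt-bound (q * M) (- Q) q (+ 3) (negated (+ 4 * q * (q * M)) Q Q²-bound) q≥0 3Q))
      where
      lem : ∀ N q → N - (+ 36 * ((+ 2 * q + 1ℤ) * (+ 2 * q + 1ℤ)) + + 2) +
        + 36 * ((+ 2 * q + 1ℤ) * (+ 2 * q + 1ℤ)) + + 2 ≡ N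
      lem = solve-∀
      minus-minus : ∀ N k x → N - k * - x - 1ℤ ≡ N + k * x - 1ℤ
      minus-minus = solve-∀
      4P = P-bound (+ 4) (+ 144 * (q * (q - + 2)) + + 432 * (q - + 2) + + 836)
        (lit 144 ⊗ (q≥0 ⊗ q≥2) ⊕ lit 432 ⊗ q≥2 ⊕ lit 836) (solve (q ∷ []))
      3Q = threshold q (+ 3) (+ 144 * (q * q) + + 108 * q + + 36)
        (lit 144 ⊗ (q≥0 ⊗ q≥0) ⊕ lit 108 ⊗ q≥0 ⊕ lit 36) (solve (q ∷ []))

quotient : ∀ P R → NonNeg (P - 1ℤ) → NonNeg (R - 1ℤ) →
  ∃ λ n → NonNeg n × NonNeg (P - 1ℤ - n * (+ 2 * R)) × NonNeg ((n + 1ℤ) * (+ 2 * R) - P)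
quotient (+ ℕ.suc p) (+ ℕ.suc r) _ _ = + n , lit n ,
  subst NonNeg (trans (lem₁ (+ rest) (+ n * + d)) (sym (cong₂ (λ x y → x - + n * y) p-eq′ d-eq))) (lit rest) ,
  subst NonNeg (trans (lem₂ (+ (d ℕ.∸ ℕ.suc rest)) (+ rest) (+ n) (+ d) gap-eq)
    (sym (cong₂ (λ x y → (+ n + 1ℤ) * y - (1ℤ + x)) p-eq′ d-eq))) (lit (d ℕ.∸ ℕ.suc rest))
  where
  d = 2 ℕ.* ℕ.suc r
  n = p ℕ./ d
  rest = p ℕ.% d
  d-eq : + 2 * + ℕ.suc r ≡ + d
  d-eq = sym (ℤ.pos-* 2 (ℕ.suc r))
  p-eq : p ≡ rest ℕ.+ n ℕ.* d
  p-eq = ℕ.m≡m%n+[m/n]*n p d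
  p-eq′ : + p ≡ + rest + + n * + d
  p-eq′ = trans (cong +_ p-eq) (cong (λ x → + rest + x) (ℤ.pos-* n d))
  gap-eq : + 1 + + rest + + (d ℕ.∸ ℕ.suc rest) ≡ + d
  gap-eq = cong +_ (ℕ.m+[n∸m]≡n (ℕ.m%n<n p d))
  lem₁ : ∀ x y → x ≡ x + y - y
  lem₁ = solve-∀
  lem₂ : ∀ g x n d → + 1 + x + g ≡ d → g ≡ (n + 1ℤ) * d - (1ℤ + (x + n * d))
  lem₂ g x n d refl = lem₃ g x n
    where
    lem₃ : ∀ g x n → g ≡ (n + 1ℤ) * (+ 1 + x + g) - (1ℤ + (x + n * (+ 1 + x + g)))
    lem₃ = solve-∀
quotient (+ 0) R () _
quotient -[1+ _ ] R () _
quotient (+ ℕ.suc _) (+ 0) _ ()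
quotient (+ ℕ.suc _) -[1+ _ ] _ ()

-- Halving h as evenly as possible keeps 2k and 2k′ at most h + 1. The bound q = 2h is attained only
-- for h = 1, with k = 1 and k′ = 0.
split-even : ∀ h → NonNeg (h - 1ℤ) → ∃₂ λ k k′ → h ≡ k + k′ × Strip (+ 2 * h) (+ 2 * h) k k′
split-even h hh with parity h
... | inj₁ (x , refl) = x , x , lem x , at-double x hh
  where
  lem : ∀ x → + 2 * x ≡ x + x
  lem = solve-∀
  at-double : ∀ x → NonNeg (+ 2 * x - 1ℤ) → let h = + 2 * x in Strip (+ 2 * h) (+ 2 * h) x x
  at-double x hh =
    nonNeg-cert 0 (lit 1 ⊕ hh) (solve (x ∷ [])) , nonNeg-cert 0 (lit 2 ⊕ lit 3 ⊗ hh) (solve (x ∷ [])) ,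
    nonNeg-cert 0 (lit 3 ⊕ lit 3 ⊗ hh) (solve (x ∷ [])) , nonNeg-cert 0 hh (solve (x ∷ []))
... | inj₂ (x , refl) = x + 1ℤ , x , lem x , at-odd x hh
  where
  lem : ∀ x → 1ℤ + + 2 * x ≡ x + 1ℤ + x
  lem = solve-∀
  at-odd : ∀ x → NonNeg (1ℤ + + 2 * x - 1ℤ) → let h = 1ℤ + + 2 * x in Strip (+ 2 * h) (+ 2 * h) (x + 1ℤ) x
  at-odd x hh =
    nonNeg-cert 0 hh (solve (x ∷ [])) , nonNeg-cert 0 (lit 3 ⊕ lit 3 ⊗ hh) (solve (x ∷ [])) ,
    nonNeg-cert 0 (lit 2 ⊕ lit 3 ⊗ hh) (solve (x ∷ [])) , nonNeg-cert 0 (lit 1 ⊕ hh) (solve (x ∷ []))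

-- Here 2(c - c′) is (q + 1)U, so h + 1 = (q + 1)/2 has to be divided between k and k′; both 2k and
-- 2k′ stay below q.
split-odd : ∀ h → NonNeg (h - 1ℤ) → ∃₂ λ k k′ → h ≡ k + k′ - 1ℤ × Strip (1ℤ + + 2 * h) (1ℤ + + 2 * h - 1ℤ) k k′
split-odd h hh with parity h
... | inj₁ (x , refl) = x + 1ℤ , x , lem x , at-double x hh (halved x hh)
  where
  lem : ∀ x → + 2 * x ≡ x + 1ℤ + x - 1ℤ
  lem = solve-∀
  halved : ∀ x → NonNeg (+ 2 * x - 1ℤ) → 0ℤ <ᶻ x
  halved x hh = cert 1 hh (solve (x ∷ []))
  at-double : ∀ x → NonNeg (+ 2 * x - 1ℤ) → 0ℤ <ᶻ x → let h = + 2 * x in Strip (1ℤ + + 2 * h) (1ℤ + + 2 * h - 1ℤ) (x + 1ℤ) x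
  at-double x hh x>0 =
    nonNeg-cert 0 (lit 2 ⊗ pred-NonNeg x>0) (solve (x ∷ [])) , nonNeg-cert 0 (lit 5 ⊕ lit 3 ⊗ hh)
      (solve (x ∷ [])) ,
    nonNeg-cert 0 (lit 3 ⊕ lit 3 ⊗ hh) (solve (x ∷ [])) , nonNeg-cert 0 (lit 1 ⊕ hh) (solve (x ∷ []))
... | inj₂ (x , refl) = x + 1ℤ , x + 1ℤ , lem x , at-odd x hh
  where
  lem : ∀ x → 1ℤ + + 2 * x ≡ x + 1ℤ + (x + 1ℤ) - 1ℤ
  lem = solve-∀
  at-odd : ∀ x → NonNeg (1ℤ + + 2 * x - 1ℤ) → let h = 1ℤ + + 2 * x in Strip (1ℤ + + 2 * h) (1ℤ + + 2 * h - 1ℤ) (x + 1ℤ) (x + 1ℤ)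
  at-odd x hh =
    nonNeg-cert 0 hh (solve (x ∷ [])) , nonNeg-cert 0 (lit 4 ⊕ lit 3 ⊗ hh) (solve (x ∷ [])) ,
    nonNeg-cert 0 (lit 4 ⊕ lit 3 ⊗ hh) (solve (x ∷ [])) , nonNeg-cert 0 hh (solve (x ∷ []))

-- B(θ, θU) = q B(1, U), and B(1, U) = 2u₀ + u₁ is the trace of U.
Qᵤ-trace : ∀ q v u₁ → Qᵤ q (- (q * v)) u₁ ≡ q * (+ 2 * - (q * v) + u₁)
Qᵤ-trace q v u₁ = lem q v u₁
  where
  lem : ∀ q v u₁ → - (q * u₁) + + 2 * q * (- (q * v) + u₁) ≡ q * (+ 2 * - (q * v) + u₁)
  lem = solve-∀

q≥2-of : ∀ h → NonNeg (h - 1ℤ) → NonNeg (+ 2 * h - + 2)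
q≥2-of h h≥1 = nonNeg-cert 0 (lit 2 ⊗ h≥1) (solve (h ∷ []))

even-case : ∀ h v i → let q = + 2 * h ; u₀ = - (q * v) ; u₁ = 1ℤ + + 2 * i in
  NonNeg (h - 1ℤ) → Small q (Mᵤ q u₀ u₁) (Pᵤ q u₀ u₁) (Qᵤ q u₀ u₁) → NonNeg (Pᵤ q u₀ u₁ - 1ℤ) →
  NonNeg (- Qᵤ q u₀ u₁ - 1ℤ) ⊎ (NonNeg (Qᵤ q u₀ u₁ - 1ℤ) × ∃ λ l → v ≡ 1ℤ + + 2 * l) → Witness q u₀ u₁
even-case h v i h≥1 sm P≥1 (inj₁ Q≤-1) with split-even h h≥1
... | k , k′ , refl , st = even⁻ k k′ i v refl refl refl sm (q≥2-of (k + k′) h≥1) h≥1 P≥1 Q≤-1 st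
even-case h v i h≥1 sm P≥1 (inj₂ (Q≥1 , l , refl)) = even⁺ h i l refl refl refl sm (q≥2-of h h≥1) h≥1 P≥1 Q≥1

q≥3-of : ∀ h → NonNeg (h - 1ℤ) → NonNeg (1ℤ + + 2 * h - + 3)
q≥3-of h h≥1 = nonNeg-cert 0 (lit 2 ⊗ h≥1) (solve (h ∷ []))

mixed-case : ∀ h l i → let q = 1ℤ + + 2 * h ; u₀ = - (q * (+ 2 * l)) ; u₁ = 1ℤ + + 2 * i in
  NonNeg (h - 1ℤ) → Small q (Mᵤ q u₀ u₁) (Pᵤ q u₀ u₁) (Qᵤ q u₀ u₁) → NonNeg (Pᵤ q u₀ u₁ - Qᵤ q u₀ u₁ - 1ℤ) →
    Witness q u₀ u₁
mixed-case h l i h≥1 sm P>Q with split-odd h h≥1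
... | k , k′ , refl , st = mixed k k′ i l refl refl refl sm (q≥3-of (k + k′ - 1ℤ) h≥1) P>Q st

unit-case : ∀ h l i → let q = 1ℤ + + 2 * h ; u₀ = - (q * (1ℤ + + 2 * l)) ; u₁ = 1ℤ + + 2 * i in
  NonNeg (h - 1ℤ) → Small q (Mᵤ q u₀ u₁) (Pᵤ q u₀ u₁) (Qᵤ q u₀ u₁) → NonNeg (Pᵤ q u₀ u₁ - 1ℤ) →
  NonNeg (q * Mᵤ q u₀ u₁ - (q + 1ℤ) * Pᵤ q u₀ u₁ - 1ℤ) →
  NonNeg (Qᵤ q u₀ u₁ - 1ℤ) ⊎ NonNeg (- Qᵤ q u₀ u₁ - 1ℤ) → Witness q u₀ u₁
unit-case h l i h≥1 sm P≥1 qP (inj₁ Q≥1) = unit⁺ h i l refl refl refl sm (q≥3-of h h≥1) P≥1 Q≥1 qP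
unit-case h l i h≥1 sm P≥1 qP (inj₂ Q≤-1) with split-odd h h≥1
... | k , k′ , refl , st = unit⁻ k k′ i l refl refl refl sm (q≥3-of (k + k′ - 1ℤ) h≥1) P≥1 Q≤-1 qP st

-- Take n = ⌊(P - 1) / 2R⌋.  The last bound rests on t ≥ 6, through 2nqP ≤ P²/t ≤ 4N/6.
axis-multiplier : ∀ q N P R t → NonNeg (q - + 3) → NonNeg (P - 1ℤ) → NonNeg (R - 1ℤ) →
  NonNeg (+ 2 * P - R - 1ℤ) →
  R ≡ q * t → NonNeg (t - + 6) → NonNeg (+ 4 * 1ℤ * N - P * P) → NonNeg (N - (+ 3 * (+ 2 * q + 1ℤ)) * P - 1ℤ) →
  ∃ λ n → let m = + 2 * n + 1ℤ in NonNeg (m - 1ℤ) × NonNeg ((m + 1ℤ) * R - P) ×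
    NonNeg (+ 2 * P - m * R - 1ℤ) × NonNeg (N - (m * q + q + 1ℤ) * P - 1ℤ)
axis-multiplier q N P R t q≥3 P≥1 R≥1 R<2P refl t≥6 P² KP = conclude (quotient P R P≥1 R≥1)
  where
  below : ∀ n → NonNeg n → NonNeg (P - 1ℤ - n * (+ 2 * R)) → 0ℤ ≤ᶻ + 2 * P - (+ 2 * n + 1ℤ) * R - 1ℤ
  below (+ 0) _ _ = nonNeg-cert 0 R<2P (lem P R)
    where
    lem : ∀ P R → 1ℤ * (+ 2 * P - (+ 2 * 0ℤ + 1ℤ) * R - 1ℤ) ≡ + 2 * P - R - 1ℤ
    lem = solve-∀
  below (+ ℕ.suc k) _ low = nonNeg-cert 0
    (lit 2 ⊗ low ⊕ lit 1 ⊕ lit 2 ⊗ (lit k ⊗ (R≥1 ⊕ lit 1)) ⊕ (R≥1 ⊕ lit 1)) (lem P R (+ k))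
    where
    lem : ∀ P R k → 1ℤ * (+ 2 * P - (+ 2 * (1ℤ + k) + 1ℤ) * R - 1ℤ) ≡
      + 2 * (P - 1ℤ - (1ℤ + k) * (+ 2 * R)) + 1ℤ + + 2 * (k * (R - 1ℤ + 1ℤ)) + (R - 1ℤ + 1ℤ)
    lem = solve-∀
  product-bound : ∀ n → NonNeg n → NonNeg (P - 1ℤ - n * (+ 2 * (q * t))) →
    0ℤ <ᶻ N - ((+ 2 * n + 1ℤ) * q + q + 1ℤ) * P
  product-bound n n≥0 low = cert 5
    (lit 2 ⊗ KP ⊕ P² ⊕ (P≥1 ⊕ lit 1) ⊗ low ⊕ (P≥1 ⊕ lit 1)
      ⊕ lit 2 ⊗ (n≥0 ⊗ (q≥3 ⊕ lit 3) ⊗ (P≥1 ⊕ lit 1) ⊗ t≥6) ⊕ lit 1)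
    (solve (n ∷ q ∷ N ∷ P ∷ t ∷ []))
  conclude : (∃ λ n → NonNeg n × NonNeg (P - 1ℤ - n * (+ 2 * R)) × NonNeg ((n + 1ℤ) * (+ 2 * R) - P)) →
    ∃ λ n → let m = + 2 * n + 1ℤ in NonNeg (m - 1ℤ) × NonNeg ((m + 1ℤ) * R - P) ×
      NonNeg (+ 2 * P - m * R - 1ℤ) × NonNeg (N - (m * q + q + 1ℤ) * P - 1ℤ)
  conclude (n , n≥0 , lower , upper) = n ,
    subst NonNeg (lem′ n) (lit 2 ⊗ n≥0) ,
    subst NonNeg (lem n R P) upper ,
    below n n≥0 lower ,
    pred-NonNeg (product-bound n n≥0 lower)
    where
    lem′ : ∀ n → + 2 * n ≡ + 2 * n + 1ℤ - 1ℤ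
    lem′ = solve-∀
    lem : ∀ n R P → (n + 1ℤ) * (+ 2 * R) - P ≡ (+ 2 * n + 1ℤ + 1ℤ) * R - P
    lem = solve-∀

axis-case : ∀ h l i → let q = 1ℤ + + 2 * h ; u₀ = - (q * (1ℤ + + 2 * l)) ; u₁ = + 2 * i
                          N = q * Mᵤ q u₀ u₁ ; P = Pᵤ q u₀ u₁ ; Q = Qᵤ q u₀ u₁ ; t = + 2 * u₀ + u₁ in
  NonNeg (h - 1ℤ) → Small q (Mᵤ q u₀ u₁) P Q → NonNeg (P - 1ℤ) →
  NonNeg (N - (q + 1ℤ) * P - 1ℤ) → NonNeg (N - (+ 3 * (+ 2 * q + 1ℤ)) * P - 1ℤ) →
    NonNeg (+ 4 * 1ℤ * N - P * P) →
  (NonNeg (Q - 1ℤ) × NonNeg (t - + 6) × (NonNeg (+ 2 * P - Q - 1ℤ) ⊎ NonNeg (Q - + 2 * P - 1ℤ))) ⊎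
  (NonNeg (- Q - 1ℤ) × NonNeg (- t - + 6) × (NonNeg (+ 2 * P - - Q - 1ℤ) ⊎ NonNeg (- Q - + 2 * P - 1ℤ))) →
  Witness q u₀ u₁
axis-case h l i h≥1 sm P≥1 qP KP P² (inj₁ (Q≥1 , t≥6 , inj₁ R<2P))
  with (let q = 1ℤ + + 2 * h ; u₀ = - (q * (1ℤ + + 2 * l)) ; u₁ = + 2 * i in axis-multiplier q (q * Mᵤ q u₀ u₁) (Pᵤ q u₀ u₁) (Qᵤ q u₀ u₁) (+ 2 * u₀ + u₁) (q≥3-of h h≥1) P≥1 Q≥1 R<2P (Qᵤ-trace (1ℤ + + 2 * h) (1ℤ + + 2 * l) (+ 2 * i)) t≥6 P² KP)
... | n , m≥1 , mQ , 2P , mqP = axis⁺ n h i l refl refl refl sm (q≥3-of h h≥1) m≥1 P≥1 Q≥1 mQ 2P mqP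
axis-case h l i h≥1 sm P≥1 qP KP P² (inj₁ (Q≥1 , t≥6 , inj₂ Q>2P)) =
  steep⁺ h i l refl refl refl sm (q≥3-of h h≥1) P≥1 Q>2P qP
axis-case h l i h≥1 sm P≥1 qP KP P² (inj₂ (Q≤-1 , t≤-6 , c)) with split-odd h h≥1
axis-case h l i h≥1 sm P≥1 qP KP P² (inj₂ (Q≤-1 , t≤-6 , inj₁ R<2P)) | k , k′ , refl , st
  with (let q = 1ℤ + + 2 * (k + k′ - 1ℤ) ; u₀ = - (q * (1ℤ + + 2 * l)) ; u₁ = + 2 * i in axis-multiplier q (q * Mᵤ q u₀ u₁) (Pᵤ q u₀ u₁) (- Qᵤ q u₀ u₁) (- (+ 2 * u₀ + u₁)) (q≥3-of (k + k′ - 1ℤ) h≥1) P≥1 Q≤-1 R<2P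
    (trans (cong -_ (Qᵤ-trace (1ℤ + + 2 * (k + k′ - 1ℤ)) (1ℤ + + 2 * l) (+ 2 * i)))
      (ℤ.neg-distribʳ-* (1ℤ + + 2 * (k + k′ - 1ℤ)) _)) t≤-6 P² KP)
... | n , m≥1 , mQ , 2P , mqP = axis⁻ n k k′ i l refl refl refl sm
  (q≥3-of (k + k′ - 1ℤ) h≥1) m≥1 P≥1 Q≤-1 mQ 2P mqP st
axis-case h l i h≥1 sm P≥1 qP KP P² (inj₂ (Q≤-1 , t≤-6 , inj₂ Q<-2P)) | k , k′ , refl , st =
  steep⁻ k k′ i l refl refl refl sm (q≥3-of (k + k′ - 1ℤ) h≥1) P≥1 Q<-2P qP st

-- Choice of the family

-- Only ±U is determined by the power of τ, and the families fix the sign of P or of P - Q; one of U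
-- and -U satisfies this.
Result : (q v u₁ : ℤ) → Set
Result q v u₁ = Witness q (- (q * v)) u₁ ⊎ Witness q (- (q * - v)) (- u₁)

-- The properties of U = -qv + u₁θ on which the families rest, in a form invariant under U ↦ -U. For
-- that reason the congruence u₁ ≡ 1 modulo q, valid for powers of θ, appears only as q not dividing
-- u₁.
record Regular (q v u₁ : ℤ) : Set where
  field
    coprime : ∀ k → u₁ ≢ q * k
    odd-if-even : ∀ h → q ≡ + 2 * h → (∃ λ l → v ≡ 1ℤ + + 2 * l) × ∃ λ i → u₁ ≡ 1ℤ + + 2 * i
    not-both-even : ∀ i l → u₁ ≡ + 2 * i → v ≢ + 2 * l
    trace-large : ∀ h i → q ≡ 1ℤ + + 2 * h → u₁ ≡ + 2 * i →
      NonNeg (+ 2 * - (q * v) + u₁ - + 6) ⊎ NonNeg (- (+ 2 * - (q * v) + u₁) - + 6)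
    large : NonNeg (q * Mᵤ q (- (q * v)) u₁ - (+ 36 * ((+ 2 * q + 1ℤ) * (+ 2 * q + 1ℤ)) + + 2))

neg-odd : ∀ {x} → (∃ λ i → x ≡ 1ℤ + + 2 * i) → ∃ λ i → - x ≡ 1ℤ + + 2 * i
neg-odd (i , refl) = - i - 1ℤ , lem i
  where
  lem : ∀ i → - (1ℤ + + 2 * i) ≡ 1ℤ + + 2 * (- i - 1ℤ)
  lem = solve-∀

neg-even : ∀ {x} i → - x ≡ + 2 * i → x ≡ + 2 * - i
neg-even {x} i eq = trans (sym (ℤ.neg-involutive x)) (trans (cong -_ eq) (ℤ.neg-distribʳ-* (+ 2) i))

negate : ∀ {q v u₁} → Regular q v u₁ → Regular q (- v) (- u₁)
negate {q} {v} {u₁} r = record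
  { coprime = λ k eq → coprime (- k) (trans (sym (ℤ.neg-involutive u₁))
    (trans (cong -_ eq) (ℤ.neg-distribʳ-* q k)))
  ; odd-if-even = λ h eq → neg-odd (proj₁ (odd-if-even h eq)) , neg-odd (proj₂ (odd-if-even h eq))
  ; not-both-even = λ i l eq eq′ → not-both-even (- i) (- l) (neg-even i eq) (neg-even l eq′)
  ; trace-large = λ h i eq eq′ → swap-sign (trace-large h (- i) eq (neg-even i eq′))
  ; large = subst NonNeg (lem′ q v u₁) large
  }
  where
  open Regular r
  swap-sign : NonNeg (+ 2 * - (q * v) + u₁ - + 6) ⊎ NonNeg (- (+ 2 * - (q * v) + u₁) - + 6) →
    NonNeg (+ 2 * - (q * - v) + - u₁ - + 6) ⊎ NonNeg (- (+ 2 * - (q * - v) + - u₁) - + 6)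
  swap-sign (inj₁ h) = inj₂ (subst NonNeg (lem q v u₁) h)
    where
    lem : ∀ q v u₁ → + 2 * - (q * v) + u₁ - + 6 ≡ - (+ 2 * - (q * - v) + - u₁) - + 6
    lem = solve-∀
  swap-sign (inj₂ h) = inj₁ (subst NonNeg (lem q v u₁) h)
    where
    lem : ∀ q v u₁ → - (+ 2 * - (q * v) + u₁) - + 6 ≡ + 2 * - (q * - v) + - u₁ - + 6
    lem = solve-∀
  lem′ : ∀ q v u₁ → q * (- (q * v) * - (q * v) + - (q * v) * u₁ + q * (u₁ * u₁)) -
    (+ 36 * ((+ 2 * q + 1ℤ) * (+ 2 * q + 1ℤ)) + + 2)
    ≡ q * (- (q * - v) * - (q * - v) + - (q * - v) * - u₁ + q * (- u₁ * - u₁)) -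
      (+ 36 * ((+ 2 * q + 1ℤ) * (+ 2 * q + 1ℤ)) + + 2)
  lem′ = solve-∀

opposite-signs : ∀ x y q → NonNeg (x - 1ℤ) → x ≡ q * y → NonNeg (q - + 2) → ¬ NonNeg (- y - + 6)
opposite-signs x y q hx refl hq hy = contradiction
  (subst NonNeg (lem q y) (hx ⊕ (hq ⊕ lit 2) ⊗ (hy ⊕ lit 6))) λ ()
  where
  lem : ∀ q y → q * y - 1ℤ + (q - + 2 + + 2) * (- y - + 6 + + 6) ≡ - 1ℤ
  lem = solve-∀

-- Q is q times the trace, so its sign selects the alternative.
trace-sign⁺ : ∀ {q v u₁} → NonNeg (q - + 2) → NonNeg (Qᵤ q (- (q * v)) u₁ - 1ℤ) →
  NonNeg (+ 2 * - (q * v) + u₁ - + 6) ⊎ NonNeg (- (+ 2 * - (q * v) + u₁) - + 6) →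
    NonNeg (+ 2 * - (q * v) + u₁ - + 6)
trace-sign⁺ {q} {v} {u₁} hq hQ (inj₁ h) = h
trace-sign⁺ {q} {v} {u₁} hq hQ (inj₂ h) =
  contradiction h (opposite-signs (Qᵤ q (- (q * v)) u₁) (+ 2 * - (q * v) + u₁) q hQ (Qᵤ-trace q v u₁) hq)

trace-sign⁻ : ∀ {q v u₁} → NonNeg (q - + 2) → NonNeg (- Qᵤ q (- (q * v)) u₁ - 1ℤ) →
  NonNeg (+ 2 * - (q * v) + u₁ - + 6) ⊎ NonNeg (- (+ 2 * - (q * v) + u₁) - + 6) →
    NonNeg (- (+ 2 * - (q * v) + u₁) - + 6)
trace-sign⁻ {q} {v} {u₁} hq hQ (inj₂ h) = h
trace-sign⁻ {q} {v} {u₁} hq hQ (inj₁ h) =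
  contradiction (subst (λ t → NonNeg (t - + 6)) (sym (ℤ.neg-involutive (+ 2 * - (q * v) + u₁))) h)
  (opposite-signs (- Qᵤ q (- (q * v)) u₁) (- (+ 2 * - (q * v) + u₁)) q hQ
    (trans (cong -_ (Qᵤ-trace q v u₁)) (ℤ.neg-distribʳ-* q _)) hq)

compare : ∀ P R → + 2 * P - R ≢ 0ℤ → NonNeg (+ 2 * P - R - 1ℤ) ⊎ NonNeg (R - + 2 * P - 1ℤ)
compare P R h with sign-cases h
... | inj₁ g = inj₁ g
... | inj₂ g = inj₂ (subst NonNeg (lem P R) g)
  where
  lem : ∀ P R → - (+ 2 * P - R) - 1ℤ ≡ R - + 2 * P - 1ℤ
  lem = solve-∀

module _ {q v u₁ : ℤ} (q≥2 : NonNeg (q - + 2)) (r : Regular q v u₁) where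
  open Regular r
  private
    u₀ P Q : ℤ
    u₀ = - (q * v)
    P = Pᵤ q u₀ u₁
    Q = Qᵤ q u₀ u₁
  open Cauchy q q≥2 u₀ u₁ using (P²-bound; qP-bound; 3KP-bound; small-of-large)

  -- Modulo q, each of P, P - Q and the trace Q/q is congruent to u₁, which is not 0 there. The next
  -- two lemmas use the same argument.
  P≢0 : P ≢ 0ℤ
  P≢0 eq = coprime (+ 2 * u₁ + v) (trans (lem q v u₁)
    (trans (cong (_+ q * (+ 2 * u₁ + v)) eq) (ℤ.+-identityˡ _)))
    where
    lem : ∀ q v u₁ → u₁ ≡ (+ 2 * - (q * u₁) + (- (q * v) + u₁)) + q * (+ 2 * u₁ + v)
    lem = solve-∀

  P≢Q : P - Q ≢ 0ℤ
  P≢Q eq = coprime (+ 3 * u₁ + v - + 2 * q * v)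
    (trans (lem q v u₁) (trans (cong (_+ q * (+ 3 * u₁ + v - + 2 * q * v)) eq) (ℤ.+-identityˡ _)))
    where
    lem : ∀ q v u₁ → u₁ ≡ (+ 2 * - (q * u₁) + (- (q * v) + u₁) - (- (q * u₁) + + 2 * q * (- (q * v) + u₁)))
      + q * (+ 3 * u₁ + v - + 2 * q * v)
    lem = solve-∀

  Q≢0 : Q ≢ 0ℤ
  Q≢0 eq with ℤ.i*j≡0⇒i≡0∨j≡0 q (trans (sym (Qᵤ-trace q v u₁)) eq)
  ... | inj₁ refl = contradiction q≥2 λ ()
  ... | inj₂ t≡0 = coprime (+ 2 * v) (trans (lem q v u₁)
    (trans (cong (_+ q * (+ 2 * v)) t≡0) (ℤ.+-identityˡ _)))
    where
    lem : ∀ q v u₁ → u₁ ≡ + 2 * - (q * v) + u₁ + q * (+ 2 * v)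
    lem = solve-∀

  -- As q divides Q, 2P - sQ ≡ 2u₁ modulo q, and -h is an inverse of 2 modulo q = 1 + 2h.
  2P≢ : ∀ h s → q ≡ 1ℤ + + 2 * h → + 2 * P - s * Q ≢ 0ℤ
  2P≢ h s refl eq = coprime (u₁ - h * x)
    (trans (lem h v u₁ s) (trans (cong (λ y → q * (u₁ - h * x) - h * y) eq)
    (trans (cong (λ y → q * (u₁ - h * x) - y) (ℤ.*-zeroʳ h)) (ℤ.+-identityʳ _))))
    where
    x : ℤ
    x = + 4 * u₁ + + 2 * v + s * (+ 2 * - (q * v) + u₁)
    lem : ∀ h v u₁ s → let q = 1ℤ + + 2 * h in
      u₁ ≡ q * (u₁ - h * (+ 4 * u₁ + + 2 * v + s * (+ 2 * - (q * v) + u₁)))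
        - h * (+ 2 * (+ 2 * - (q * u₁) + (- (q * v) + u₁)) - s * (- (q * u₁) + + 2 * q * (- (q * v) + u₁)))
    lem = solve-∀


  small-P-Q : Small q (Mᵤ q u₀ u₁) P Q
  small-P-Q = small-of-large large

  q+1-bound : NonNeg (q * Mᵤ q u₀ u₁ - (q + 1ℤ) * P - 1ℤ)
  q+1-bound = proj₁ (qP-bound large)

  3K-bound : NonNeg (q * Mᵤ q u₀ u₁ - (+ 3 * (+ 2 * q + 1ℤ)) * P - 1ℤ)
  3K-bound = proj₁ (3KP-bound large)

  P²≤4N : NonNeg (+ 4 * 1ℤ * (q * Mᵤ q u₀ u₁) - P * P)
  P²≤4N = P²-bound

  axis-data : ∀ h i → q ≡ 1ℤ + + 2 * h → u₁ ≡ + 2 * i → let t = + 2 * u₀ + u₁ in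
    (NonNeg (Q - 1ℤ) × NonNeg (t - + 6) × (NonNeg (+ 2 * P - Q - 1ℤ) ⊎ NonNeg (Q - + 2 * P - 1ℤ))) ⊎
    (NonNeg (- Q - 1ℤ) × NonNeg (- t - + 6) × (NonNeg (+ 2 * P - - Q - 1ℤ) ⊎ NonNeg (- Q - + 2 * P - 1ℤ)))
  axis-data h i q-odd u₁-even with sign-cases Q≢0
  ... | inj₁ Q≥1 = inj₁ (Q≥1 , trace-sign⁺ {q} {v} {u₁} q≥2 Q≥1 (trace-large h i q-odd u₁-even) ,
    compare P Q (λ eq → 2P≢ h 1ℤ q-odd (trans (cong (λ y → + 2 * P - y) (ℤ.*-identityˡ Q)) eq)))
  ... | inj₂ Q≤-1 = inj₂ (Q≤-1 , trace-sign⁻ {q} {v} {u₁} q≥2 Q≤-1 (trace-large h i q-odd u₁-even) ,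
    compare P (- Q) (λ eq → 2P≢ h (- 1ℤ) q-odd (trans (cong (λ y → + 2 * P - y) (ℤ.-1*i≡-i Q)) eq)))

even-half : ∀ h → NonNeg (+ 2 * h - + 2) → 0ℤ ≤ᶻ h - 1ℤ
even-half h hq = nonNeg-cert 1 hq (solve (h ∷ []))

odd-half : ∀ h → NonNeg (1ℤ + + 2 * h - + 2) → NonNeg (h - 1ℤ)
odd-half h hq = pred-NonNeg (positive h hq)
  where
  positive : ∀ h → NonNeg (1ℤ + + 2 * h - + 2) → 0ℤ <ᶻ h
  positive h hq = cert 1 hq (solve (h ∷ []))

-- An even v rules out even q and even u₁, so T = -qu₁ + (u₁ - qv)θ is 1 + θ modulo 2.
mixed-witness : ∀ {q v u₁} → NonNeg (q - + 2) → Regular q v u₁ → ∀ l → v ≡ + 2 * l →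
  NonNeg (Pᵤ q (- (q * v)) u₁ - Qᵤ q (- (q * v)) u₁ - 1ℤ) → Witness q (- (q * v)) u₁
mixed-witness {q} {v} {u₁} q≥2 r l v-even P>Q with parity q | parity u₁
... | inj₁ (h , q-even) | _ = contradiction (proj₂ (proj₁ (Regular.odd-if-even r h q-even)))
  (even≢odd l (proj₁ (proj₁ (Regular.odd-if-even r h q-even))) v-even)
... | inj₂ _ | inj₁ (i , u₁-even) = contradiction v-even (Regular.not-both-even r i l u₁-even)
mixed-witness q≥2 r l refl P>Q | inj₂ (h , refl) | inj₂ (i , refl) =
  mixed-case h l i (odd-half h q≥2) (small-P-Q q≥2 r) P>Q

-- For odd v, T modulo 2 is θ if q is even, 1 if q and u₁ are odd, and θ if q is odd and u₁ even.
positive-witness : ∀ {q v u₁} → NonNeg (q - + 2) → Regular q v u₁ → ∀ l → v ≡ 1ℤ + + 2 * l →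
  NonNeg (Pᵤ q (- (q * v)) u₁ - 1ℤ) → Witness q (- (q * v)) u₁
positive-witness {q} {v} {u₁} q≥2 r l v-odd P≥1 with parity q | parity u₁
... | inj₁ (h , q-even) | inj₁ (i , u₁-even) =
  contradiction (proj₂ (proj₂ (Regular.odd-if-even r h q-even)))
    (even≢odd i (proj₁ (proj₂ (Regular.odd-if-even r h q-even))) u₁-even)
positive-witness {q} {v} {u₁} q≥2 r l v-odd P≥1 | inj₁ (h , refl) | inj₂ (i , refl) =
  even-case h v i (even-half h q≥2) (small-P-Q q≥2 r) P≥1 (orient (sign-cases (Q≢0 q≥2 r)))
  where
  orient : ∀ {A B : Set} → A ⊎ B → B ⊎ (A × ∃ λ l → v ≡ 1ℤ + + 2 * l)
  orient (inj₁ a) = inj₂ (a , l , v-odd)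
  orient (inj₂ b) = inj₁ b
positive-witness q≥2 r l refl P≥1 | inj₂ (h , refl) | inj₂ (i , refl) =
  unit-case h l i (odd-half h q≥2) (small-P-Q q≥2 r) P≥1 (q+1-bound q≥2 r) (sign-cases (Q≢0 q≥2 r))
positive-witness q≥2 r l refl P≥1 | inj₂ (h , refl) | inj₁ (i , refl) =
  axis-case h l i (odd-half h q≥2) (small-P-Q q≥2 r) P≥1 (q+1-bound q≥2 r) (3K-bound q≥2 r) (P²≤4N q≥2 r)
    (axis-data q≥2 r h i refl refl)

Pᵤ-neg : ∀ q v u₁ → - Pᵤ q (- (q * v)) u₁ ≡ Pᵤ q (- (q * - v)) (- u₁)
Pᵤ-neg = lem
  where
  lem : ∀ q v u₁ → - (+ 2 * - (q * u₁) + (- (q * v) + u₁)) ≡ + 2 * - (q * - u₁) + (- (q * - v) + - u₁)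
  lem = solve-∀

Qᵤ-neg : ∀ q v u₁ → - Qᵤ q (- (q * v)) u₁ ≡ Qᵤ q (- (q * - v)) (- u₁)
Qᵤ-neg = lem
  where
  lem : ∀ q v u₁ → - (- (q * u₁) + + 2 * q * (- (q * v) + u₁)) ≡ - (q * - u₁) + + 2 * q * (- (q * - v) + - u₁)
  lem = solve-∀

regular-result : ∀ {q v u₁} → NonNeg (q - + 2) → Regular q v u₁ → Result q v u₁
regular-result {q} {v} {u₁} q≥2 r with parity v
... | inj₁ (l , v-even) with sign-cases (P≢Q q≥2 r)
...   | inj₁ h = inj₁ (mixed-witness q≥2 r l v-even h)
...   | inj₂ h = inj₂ (mixed-witness q≥2 (negate r) (- l) (trans (cong -_ v-even) (ℤ.neg-distribʳ-* (+ 2) l))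
                   (subst NonNeg (trans (lem (Pᵤ q (- (q * v)) u₁) (Qᵤ q (- (q * v)) u₁))
                     (cong₂ (λ x y → x - y - 1ℤ) (Pᵤ-neg q v u₁) (Qᵤ-neg q v u₁))) h))
  where
  lem : ∀ P Q → - (P - Q) - 1ℤ ≡ - P - - Q - 1ℤ
  lem = solve-∀
regular-result {q} {v} {u₁} q≥2 r | inj₂ (l , v-odd) with sign-cases (P≢0 q≥2 r)
...   | inj₁ h = inj₁ (positive-witness q≥2 r l v-odd h)
...   | inj₂ h = inj₂ (positive-witness q≥2 (negate r) (proj₁ (neg-odd (l , v-odd)))
  (proj₂ (neg-odd (l , v-odd)))
                   (subst NonNeg (cong (_- 1ℤ) (Pᵤ-neg q v u₁)) h))

-- Powers of θ

re im : ℤ → ℕ → ℤ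
re q 0 = 1ℤ
re q (ℕ.suc n) = - (q * im q n)
im q 0 = 0ℤ
im q (ℕ.suc n) = re q n + im q n

-- θ² = θ - q, so every positive power of θ is congruent to θ modulo q.
im≡1 : ∀ q n → ∃ λ j → im q (ℕ.suc n) ≡ 1ℤ + q * j
im≡1 q 0 = 0ℤ , sym (trans (cong (λ x → 1ℤ + x) (ℤ.*-zeroʳ q)) refl)
im≡1 q (ℕ.suc n) with im≡1 q n
... | j , eq = j - im q n , trans (cong (λ x → - (q * im q n) + x) eq) (lem q j (im q n))
  where
  lem : ∀ q j x → - (q * x) + (1ℤ + q * j) ≡ 1ℤ + q * (j - x)
  lem = solve-∀

power-norm : ∀ q n → Mᵤ q (re q (ℕ.suc n)) (im q (ℕ.suc n)) ≡ q * Mᵤ q (re q n) (im q n)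
power-norm q n = lem q (re q n) (im q n)
  where
  lem : ∀ q a b → - (q * b) * - (q * b) + - (q * b) * (a + b) + q * ((a + b) * (a + b))
    ≡ q * (a * a + a * b + q * (b * b))
  lem = solve-∀

im-odd-if-even : ∀ h n → ∃ λ i → im (+ 2 * h) (ℕ.suc n) ≡ 1ℤ + + 2 * i
im-odd-if-even h n with im≡1 (+ 2 * h) n
... | j , eq = h * j , trans eq (cong (λ x → 1ℤ + x) (ℤ.*-assoc (+ 2) h j))

-- For odd q the recurrence im(n + 2) = im(n + 1) - q im(n) can be run backwards modulo 2: two
-- consecutive even terms would make all earlier ones even, against im(1) = 1.
im-not-both-even : ∀ h n i l → im (1ℤ + + 2 * h) (ℕ.suc n) ≡ + 2 * i → im (1ℤ + + 2 * h) n ≢ + 2 * l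
im-not-both-even h 0 i l eq _ = even≢odd i 0ℤ eq refl
im-not-both-even h (ℕ.suc n) i l eq eq′ = im-not-both-even h n l (l - i - h * im q n) eq′
  (trans (lem h (im q n) (im q (ℕ.suc n)))
    (trans (cong₂ (λ x y → x - y - + 2 * h * im q n) eq′ eq) (lem′ h (im q n) i l)))
  where
  q = 1ℤ + + 2 * h
  lem : ∀ h x y → x ≡ y - (- ((1ℤ + + 2 * h) * x) + y) - + 2 * h * x
  lem = solve-∀
  lem′ : ∀ h x i l → + 2 * l - + 2 * i - + 2 * h * x ≡ + 2 * (l - i - h * x)
  lem′ = solve-∀

trace : ℤ → ℕ → ℤ
trace q n = + 2 * re q n + im q n

trace-recurrence : ∀ q n → trace q (ℕ.suc (ℕ.suc n)) ≡ trace q (ℕ.suc n) - q * trace q n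
trace-recurrence q n = lem q (re q n) (im q n)
  where
  lem : ∀ q a b → + 2 * - (q * (a + b)) + (- (q * b) + (a + b)) ≡ + 2 * - (q * b) + (a + b) - q * (+ 2 * a + b)
  lem = solve-∀

-- The traces of the powers of θ are periodic mod 18 for q = 3 and mod 20 for q = 5; this excludes the even traces ±2 and ±4,
-- which the residue mod q alone allows.
data Residues₃ : ℤ → ℤ → Set where
  s₁ : ∀ k l → Residues₃ (+ 13 + + 18 * k) (+ 10 + + 18 * l)
  s₂ : ∀ k l → Residues₃ (+ 10 + + 18 * k) (+ 7 + + 18 * l)
  s₃ : ∀ k l → Residues₃ (+ 7 + + 18 * k) (+ 13 + + 18 * l)

residues₃ : ∀ n → Residues₃ (trace (+ 3) (2 ℕ.+ n)) (trace (+ 3) (3 ℕ.+ n))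
residues₃ 0 = s₁ (- 1ℤ) (- 1ℤ)
residues₃ (ℕ.suc n) = subst (Residues₃ _) (sym (trace-recurrence (+ 3) (2 ℕ.+ n))) (step (residues₃ n))
  where
  step : ∀ {x y} → Residues₃ x y → Residues₃ y (y - + 3 * x)
  step (s₁ k l) = subst (Residues₃ _) (lem k l) (s₂ l (l - + 3 * k - + 2))
    where
    lem : ∀ k l → + 7 + + 18 * (l - + 3 * k - + 2) ≡ + 10 + + 18 * l - + 3 * (+ 13 + + 18 * k)
    lem = solve-∀
  step (s₂ k l) = subst (Residues₃ _) (lem k l) (s₃ l (l - + 3 * k - + 2))
    where
    lem : ∀ k l → + 13 + + 18 * (l - + 3 * k - + 2) ≡ + 7 + + 18 * l - + 3 * (+ 10 + + 18 * k)
    lem = solve-∀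
  step (s₃ k l) = subst (Residues₃ _) (lem k l) (s₁ l (l - + 3 * k - 1ℤ))
    where
    lem : ∀ k l → + 10 + + 18 * (l - + 3 * k - 1ℤ) ≡ + 13 + + 18 * l - + 3 * (+ 7 + + 18 * k)
    lem = solve-∀

data Residues₅ : ℤ → ℤ → Set where
  s₁ : ∀ k l → Residues₅ (+ 1 + + 20 * k) (+ 11 + + 20 * l)
  s₂ : ∀ k l → Residues₅ (+ 11 + + 20 * k) (+ 6 + + 20 * l)
  s₃ : ∀ k l → Residues₅ (+ 6 + + 20 * k) (+ 11 + + 20 * l)
  s₄ : ∀ k l → Residues₅ (+ 11 + + 20 * k) (+ 1 + + 20 * l)
  s₅ : ∀ k l → Residues₅ (+ 1 + + 20 * k) (+ 6 + + 20 * l)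
  s₆ : ∀ k l → Residues₅ (+ 6 + + 20 * k) (+ 1 + + 20 * l)

residues₅ : ∀ n → Residues₅ (trace (+ 5) (1 ℕ.+ n)) (trace (+ 5) (2 ℕ.+ n))
residues₅ 0 = s₁ 0ℤ (- 1ℤ)
residues₅ (ℕ.suc n) = subst (Residues₅ _) (sym (trace-recurrence (+ 5) (1 ℕ.+ n))) (step (residues₅ n))
  where
  step : ∀ {x y} → Residues₅ x y → Residues₅ y (y - + 5 * x)
  step (s₁ k l) = subst (Residues₅ _) (lem k l) (s₂ l (l - + 5 * k))
    where
    lem : ∀ k l → + 6 + + 20 * (l - + 5 * k) ≡ + 11 + + 20 * l - + 5 * (+ 1 + + 20 * k)
    lem = solve-∀
  step (s₂ k l) = subst (Residues₅ _) (lem k l) (s₃ l (l - + 5 * k - + 3))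
    where
    lem : ∀ k l → + 11 + + 20 * (l - + 5 * k - + 3) ≡ + 6 + + 20 * l - + 5 * (+ 11 + + 20 * k)
    lem = solve-∀
  step (s₃ k l) = subst (Residues₅ _) (lem k l) (s₄ l (l - + 5 * k - 1ℤ))
    where
    lem : ∀ k l → + 1 + + 20 * (l - + 5 * k - 1ℤ) ≡ + 11 + + 20 * l - + 5 * (+ 6 + + 20 * k)
    lem = solve-∀
  step (s₄ k l) = subst (Residues₅ _) (lem k l) (s₅ l (l - + 5 * k - + 3))
    where
    lem : ∀ k l → + 6 + + 20 * (l - + 5 * k - + 3) ≡ + 1 + + 20 * l - + 5 * (+ 11 + + 20 * k)
    lem = solve-∀
  step (s₅ k l) = subst (Residues₅ _) (lem k l) (s₆ l (l - + 5 * k))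
    where
    lem : ∀ k l → + 1 + + 20 * (l - + 5 * k) ≡ + 6 + + 20 * l - + 5 * (+ 1 + + 20 * k)
    lem = solve-∀
  step (s₆ k l) = subst (Residues₅ _) (lem k l) (s₁ l (l - + 5 * k - + 2))
    where
    lem : ∀ k l → + 11 + + 20 * (l - + 5 * k - + 2) ≡ + 1 + + 20 * l - + 5 * (+ 6 + + 20 * k)
    lem = solve-∀

AtLeast6 : ℤ → Set
AtLeast6 t = NonNeg (t - + 6) ⊎ NonNeg (- t - + 6)

odd-shift : ∀ c {x} → x ≡ 1ℤ + + 2 * c → ∀ i → x ≢ + 2 * i
odd-shift c eq i eq′ = even≢odd i c eq′ eq

trace₃-large : ∀ {x y} → Residues₃ x y → ∀ i → x ≡ + 2 * i → AtLeast6 x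
trace₃-large (s₁ k _) i eq = contradiction eq (odd-shift (+ 6 + + 9 * k) (lem k) i)
  where
  lem : ∀ k → + 13 + + 18 * k ≡ 1ℤ + + 2 * (+ 6 + + 9 * k)
  lem = solve-∀
trace₃-large (s₂ (+ k) _) i eq = inj₁ (subst NonNeg (lem (+ k)) (lit 4 ⊕ lit 18 ⊗ lit k))
  where
  lem : ∀ k → + 4 + + 18 * k ≡ + 10 + + 18 * k - + 6
  lem = solve-∀
trace₃-large (s₂ -[1+ k ] _) i eq = inj₂ (subst NonNeg (lem (+ k)) (lit 2 ⊕ lit 18 ⊗ lit k))
  where
  lem : ∀ k → + 2 + + 18 * k ≡ - (+ 10 + + 18 * - (1ℤ + k)) - + 6
  lem = solve-∀
trace₃-large (s₃ k _) i eq = contradiction eq (odd-shift (+ 3 + + 9 * k) (lem k) i)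
  where
  lem : ∀ k → + 7 + + 18 * k ≡ 1ℤ + + 2 * (+ 3 + + 9 * k)
  lem = solve-∀

trace₅-large : ∀ {x y} → Residues₅ x y → ∀ i → x ≡ + 2 * i → AtLeast6 x
trace₅-large {x} {y} r i eq = by r eq
  where
  ones : ∀ k → + 1 + + 20 * k ≡ 1ℤ + + 2 * (+ 10 * k)
  ones = solve-∀
  elevens : ∀ k → + 11 + + 20 * k ≡ 1ℤ + + 2 * (+ 5 + + 10 * k)
  elevens = solve-∀
  sixes : ∀ k → AtLeast6 (+ 6 + + 20 * k)
  sixes (+ k) = inj₁ (subst NonNeg (lem (+ k)) (lit 20 ⊗ lit k))
    where
    lem : ∀ k → + 20 * k ≡ + 6 + + 20 * k - + 6
    lem = solve-∀
  sixes -[1+ k ] = inj₂ (subst NonNeg (lem (+ k)) (lit 8 ⊕ lit 20 ⊗ lit k))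
    where
    lem : ∀ k → + 8 + + 20 * k ≡ - (+ 6 + + 20 * - (1ℤ + k)) - + 6
    lem = solve-∀
  by : ∀ {x y} → Residues₅ x y → x ≡ + 2 * i → AtLeast6 x
  by (s₁ k _) eq = contradiction eq (odd-shift (+ 10 * k) (ones k) i)
  by (s₂ k _) eq = contradiction eq (odd-shift (+ 5 + + 10 * k) (elevens k) i)
  by (s₃ k _) _ = sixes k
  by (s₄ k _) eq = contradiction eq (odd-shift (+ 5 + + 10 * k) (elevens k) i)
  by (s₅ k _) eq = contradiction eq (odd-shift (+ 10 * k) (ones k) i)
  by (s₆ k _) _ = sixes k

-- The trace is 1 + qc. Being even it is not 1, so c ≠ 0 and its absolute value is at least q - 1,
-- which is 6 or more for q ≥ 7. The cases q = 3 and q = 5 use the residues above, whose even values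
-- are 10 modulo 18 and 6 modulo 20.
power-trace-large : ∀ h n → NonNeg (1ℤ + + 2 * h - + 2) → ∀ i → im (1ℤ + + 2 * h) (2 ℕ.+ n) ≡ + 2 * i →
  AtLeast6 (trace (1ℤ + + 2 * h) (2 ℕ.+ n))
power-trace-large h n hq i eq = by-cases h hq {re (1ℤ + + 2 * h) (2 ℕ.+ n) + i}
  (trans (cong (λ x → + 2 * re (1ℤ + + 2 * h) (2 ℕ.+ n) + x) eq)
    (sym (ℤ.*-distribˡ-+ (+ 2) (re (1ℤ + + 2 * h) (2 ℕ.+ n)) i)))
  where
  by-cases : ∀ h → NonNeg (1ℤ + + 2 * h - + 2) → ∀ {e} → trace (1ℤ + + 2 * h) (2 ℕ.+ n) ≡ + 2 * e →
    AtLeast6 (trace (1ℤ + + 2 * h) (2 ℕ.+ n))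
  by-cases (+ 0) () _
  by-cases -[1+ k ] hq _ = contradiction (subst NonNeg (lem (+ k)) (hq ⊕ lit 2 ⊗ lit k)) λ ()
    where
    lem : ∀ k → 1ℤ + + 2 * - (1ℤ + k) - + 2 + + 2 * k ≡ - + 3
    lem = solve-∀
  by-cases (+ 1) _ {e} even = trace₃-large (residues₃ n) e even
  by-cases (+ 2) _ {e} even = trace₅-large (residues₅ (1 ℕ.+ n)) e even
  by-cases (+ ℕ.suc (ℕ.suc (ℕ.suc k))) _ {e} even with im≡1 (1ℤ + + 2 * (+ 3 + + k)) (1 ℕ.+ n)
  ... | j , im-eq = from-multiplier (j - + 2 * x) (trans (cong (λ y → + 2 * - (q * x) + y) im-eq) (lem q j x))
    where
    q x : ℤ
    q = 1ℤ + + 2 * (+ 3 + + k)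
    x = im q (1 ℕ.+ n)
    lem : ∀ q j x → + 2 * - (q * x) + (1ℤ + q * j) ≡ 1ℤ + q * (j - + 2 * x)
    lem = solve-∀
    from-multiplier : ∀ c → trace q (2 ℕ.+ n) ≡ 1ℤ + q * c → AtLeast6 (trace q (2 ℕ.+ n))
    from-multiplier (+ 0) t-eq = contradiction even
      (odd-shift 0ℤ (trans t-eq (cong (λ y → 1ℤ + y) (ℤ.*-zeroʳ q))) e)
    from-multiplier (+ ℕ.suc a) t-eq = inj₁ (subst (λ t → NonNeg (t - + 6)) (sym t-eq)
      (subst NonNeg (lem₁ (+ k) (+ a)) (lit 2 ⊕ lit 2 ⊗ lit k ⊕ (lit 7 ⊕ lit 2 ⊗ lit k) ⊗ lit a)))
      where
      lem₁ : ∀ k a → + 2 + + 2 * k + (+ 7 + + 2 * k) * a ≡ 1ℤ + (1ℤ + + 2 * (+ 3 + k)) * (1ℤ + a) - + 6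
      lem₁ = solve-∀
    from-multiplier -[1+ a ] t-eq = inj₂ (subst (λ t → NonNeg (- t - + 6)) (sym t-eq)
      (subst NonNeg (lem₁ (+ k) (+ a)) (lit 2 ⊗ lit k ⊕ (lit 7 ⊕ lit 2 ⊗ lit k) ⊗ lit a)))
      where
      lem₁ : ∀ k a → + 2 * k + (+ 7 + + 2 * k) * a ≡ - (1ℤ + (1ℤ + + 2 * (+ 3 + k)) * - (1ℤ + a)) - + 6
      lem₁ = solve-∀

Large : ℤ → ℕ → Set
Large q n = NonNeg (q * Mᵤ q (re q n) (im q n) - (+ 36 * ((+ 2 * q + 1ℤ) * (+ 2 * q + 1ℤ)) + + 2))

large-step : ∀ q n → NonNeg (q - + 2) → Large q n → Large q (ℕ.suc n)
large-step q n hq h = subst (λ x → NonNeg (q * x - (+ 36 * ((+ 2 * q + 1ℤ) * (+ 2 * q + 1ℤ)) + + 2)))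
  (sym (power-norm q n))
  (subst NonNeg (lem q (Mᵤ q (re q n) (im q n)) (+ 36 * ((+ 2 * q + 1ℤ) * (+ 2 * q + 1ℤ)) + + 2))
    (h ⊕ (hq ⊕ lit 1) ⊗ (h ⊕ (lit 36 ⊗ square-NonNeg (+ 2 * q + 1ℤ) ⊕ lit 2))))
  where
  lem : ∀ q M c → q * M - c + (q - + 2 + 1ℤ) * (q * M - c + c) ≡ q * (q * M) - c
  lem = solve-∀

large-from : ∀ {q} n → NonNeg (q - + 2) → Large q n → ∀ k → Large q (n ℕ.+ k)
large-from {q} n hq h k = subst (Large q) (ℕ.+-comm k n) (steps k)
  where
  steps : ∀ k → Large q (k ℕ.+ n)
  steps 0 = h
  steps (ℕ.suc k) = large-step q (k ℕ.+ n) hq (steps k)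

-- 13 is the least q ≥ 2 with q⁴ ≥ 36(2q + 1)² + 2: the difference is 2315 at 13 and negative at 12.
large-13 : ∀ k → Large (+ (13 ℕ.+ k)) 3
large-13 k = subst (λ x → NonNeg (q * x - (+ 36 * ((+ 2 * q + 1ℤ) * (+ 2 * q + 1ℤ)) + + 2)))
  (sym (trans (power-norm q 2) (cong (q *_)
    (trans (power-norm q 1) (cong (q *_) (trans (power-norm q 0) (cong (q *_) (lem₀ q))))))))
  (subst NonNeg (lem (+ k)) (lit 2315 ⊕ lit 4900 ⊗ lit k ⊕ lit 870 ⊗ (lit k ⊗ lit k)
    ⊕ lit 52 ⊗ (lit k ⊗ lit k ⊗ lit k) ⊕ (lit k ⊗ lit k) ⊗ (lit k ⊗ lit k)))
  where
  q : ℤ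
  q = + (13 ℕ.+ k)
  lem₀ : ∀ q → 1ℤ * 1ℤ + 1ℤ * 0ℤ + q * (0ℤ * 0ℤ) ≡ 1ℤ
  lem₀ = solve-∀
  lem : ∀ k → + 2315 + + 4900 * k + + 870 * (k * k) + + 52 * (k * k * k) + k * k * (k * k)
    ≡ (+ 13 + k) * ((+ 13 + k) * ((+ 13 + k) * ((+ 13 + k) * 1ℤ))) -
      (+ 36 * ((+ 2 * (+ 13 + k) + 1ℤ) * (+ 2 * (+ 13 + k) + 1ℤ)) + + 2)
  lem = solve-∀

power-regular : ∀ q n → NonNeg (q - + 2) → Large q (2 ℕ.+ n) → Regular q (im q (1 ℕ.+ n)) (im q (2 ℕ.+ n))
power-regular q n q≥2 large = record
  { coprime = λ k eq → not-unit q q≥2 (k - proj₁ (im≡1 q (1 ℕ.+ n)))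
      (trans (lem q k (proj₁ (im≡1 q (1 ℕ.+ n))))
        (trans (cong (_- q * proj₁ (im≡1 q (1 ℕ.+ n))) (trans (sym eq) (proj₂ (im≡1 q (1 ℕ.+ n)))))
        (lem′ (q * proj₁ (im≡1 q (1 ℕ.+ n))))))
  ; odd-if-even = λ { h refl → im-odd-if-even h n , im-odd-if-even h (1 ℕ.+ n) }
  ; not-both-even = not-both-even
  ; trace-large = λ { h i refl eq → power-trace-large h n q≥2 i eq }
  ; large = large
  }
  where
  lem : ∀ q k j → q * (k - j) ≡ q * k - q * j
  lem = solve-∀
  lem′ : ∀ x → 1ℤ + x - x ≡ 1ℤ
  lem′ = solve-∀
  not-both-even : ∀ i l → im q (2 ℕ.+ n) ≡ + 2 * i → im q (1 ℕ.+ n) ≢ + 2 * l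
  not-both-even i l eq with parity q
  ... | inj₁ (h , refl) = contradiction (proj₂ (im-odd-if-even h (1 ℕ.+ n)))
    (even≢odd i (proj₁ (im-odd-if-even h (1 ℕ.+ n))) eq)
  ... | inj₂ (h , refl) = im-not-both-even h (1 ℕ.+ n) i l eq

-- Witnesses for each q and w

PowerResult : ℕ → ℕ → Set
PowerResult q n = Result (+ q) (im (+ q) n) (im (+ q) (ℕ.suc n))

large-result : ∀ q n → Large (+ (2 ℕ.+ q)) (2 ℕ.+ n) → PowerResult (2 ℕ.+ q) (1 ℕ.+ n)
large-result q n large = regular-result (lit q) (power-regular (+ (2 ℕ.+ q)) n (lit q) large)

module _ {n} (ρ : Env n) (hs : List (Expr n)) (ps : Hypotheses ρ hs) (q u₀ u₁ : Expr n) where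
  private
    M P Q : Expr n
    M = u₀ :* u₀ :+ u₀ :* u₁ :+ q :* (u₁ :* u₁)
    P = # 2 :* :- (q :* u₁) :+ (u₀ :+ u₁)
    Q = :- (q :* u₁) :+ # 2 :* q :* (u₀ :+ u₁)

  certified-small : ∀ m p⁺ p⁻ q⁺ q⁻ → {Certifies hs M m} →
    {Certifies hs (q :* M :- # 4 :* P) p⁺} → {Certifies hs (q :* M :+ # 4 :* P) p⁻} →
    {Certifies hs (q :* M :- # 3 :* Q) q⁺} → {Certifies hs (q :* M :+ # 3 :* Q) q⁻} →
    Small (⟦ q ⟧ ρ) (Mᵤ (⟦ q ⟧ ρ) (⟦ u₀ ⟧ ρ) (⟦ u₁ ⟧ ρ)) (Pᵤ (⟦ q ⟧ ρ) (⟦ u₀ ⟧ ρ) (⟦ u₁ ⟧ ρ))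
      (Qᵤ (⟦ q ⟧ ρ) (⟦ u₀ ⟧ ρ) (⟦ u₁ ⟧ ρ))
  certified-small m p⁺ p⁻ q⁺ q⁻ {a} {b} {c} {d} {e} = small (weaken (certified hs ps M m {a}))
    (pred-NonNeg (certified hs ps (q :* M :- # 4 :* P) p⁺ {b}))
      (pred-NonNeg (certified hs ps (q :* M :+ # 4 :* P) p⁻ {c}))
    (pred-NonNeg (certified hs ps (q :* M :- # 3 :* Q) q⁺ {d}))
      (pred-NonNeg (certified hs ps (q :* M :+ # 3 :* Q) q⁻ {e}))

-- The bound 8 comes from 4P < N, which reads 8q - 4 < q². With N = q² for w = 2 the condition
-- `Large` never holds, so `Small` is verified directly.
small-θ : ∀ q → NonNeg (q - + 8) →
  Small q (Mᵤ q (- (q * 0ℤ)) (- 1ℤ)) (Pᵤ q (- (q * 0ℤ)) (- 1ℤ)) (Qᵤ q (- (q * 0ℤ)) (- 1ℤ))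
small-θ q hq = certified-small (q ▸ ∅) (x :- # 8 ∷ []) (hq , tt) x (:- (x :* # 0)) (:- # 1)
  (0 , const 7 ∷ lin 1 0 ∷ [])
  (0 , const 3 ∷ lin 8 0 ∷ quad 1 0 0 ∷ [])
  (0 , const 123 ∷ lin 24 0 ∷ quad 1 0 0 ∷ [])
  (0 , const 87 ∷ lin 19 0 ∷ quad 1 0 0 ∷ [])
  (0 , const 39 ∷ lin 13 0 ∷ quad 1 0 0 ∷ [])
  where
  x : Expr 1
  x = var 0F

-- For U = -θ one has T = q - θ, P = 2q - 1 and Q = -q. Here v = 0 is even for every q, which for
-- even q leaves the family that needs Q < 0.
width-2 : ∀ q → NonNeg (q - + 8) → Witness q (- (q * 0ℤ)) (- 1ℤ)
width-2 q hq with parity q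
... | inj₁ (h , refl) = even-case h 0ℤ (- 1ℤ) (half h hq) (small-θ (+ 2 * h) hq) (P≥1 (+ 2 * h) hq)
  (inj₁ (Q≤-1 (+ 2 * h) hq))
  where
  half : ∀ h → NonNeg (+ 2 * h - + 8) → 0ℤ ≤ᶻ h - 1ℤ
  half h hq = nonNeg-cert 1 (hq ⊕ lit 6) (solve (h ∷ []))
  P≥1 : ∀ q → NonNeg (q - + 8) → 0ℤ ≤ᶻ + 2 * - (q * - 1ℤ) + (- (q * 0ℤ) + - 1ℤ) - 1ℤ
  P≥1 q hq = nonNeg-cert 0 (lit 2 ⊗ hq ⊕ lit 14) (solve (q ∷ []))
  Q≤-1 : ∀ q → NonNeg (q - + 8) → 0ℤ ≤ᶻ - (- (q * - 1ℤ) + + 2 * q * (- (q * 0ℤ) + - 1ℤ)) - 1ℤ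
  Q≤-1 q hq = nonNeg-cert 0 (hq ⊕ lit 7) (solve (q ∷ []))
... | inj₂ (h , refl) = mixed-case h 0ℤ (- 1ℤ) (half h hq) (small-θ (1ℤ + + 2 * h) hq) (P>Q (1ℤ + + 2 * h) hq)
  where
  positive : ∀ h → NonNeg (1ℤ + + 2 * h - + 8) → 0ℤ <ᶻ h
  positive h hq = cert 1 (hq ⊕ lit 6) (solve (h ∷ []))
  half : ∀ h → NonNeg (1ℤ + + 2 * h - + 8) → NonNeg (h - 1ℤ)
  half h hq = pred-NonNeg (positive h hq)
  P>Q : ∀ q → NonNeg (q - + 8) → 0ℤ ≤ᶻ + 2 * - (q * - 1ℤ)
    + (- (q * 0ℤ) + - 1ℤ) - (- (q * - 1ℤ) + + 2 * q * (- (q * 0ℤ) + - 1ℤ)) - 1ℤ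
  P>Q q hq = nonNeg-cert 0 (lit 3 ⊗ hq ⊕ lit 22) (solve (q ∷ []))

-- The bound 6 comes from 3Q < N, which reads 3(2q² - q) < q³.
small-θ² : ∀ q → NonNeg (q - + 6) →
  Small q (Mᵤ q (- (q * - 1ℤ)) (- 1ℤ)) (Pᵤ q (- (q * - 1ℤ)) (- 1ℤ)) (Qᵤ q (- (q * - 1ℤ)) (- 1ℤ))
small-θ² q hq = certified-small (q ▸ ∅) (x :- # 6 ∷ []) (hq , tt) x (:- (x :* :- # 1)) (:- # 1)
  (0 , const 35 ∷ lin 12 0 ∷ quad 1 0 0 ∷ [])
  (0 , const 147 ∷ lin 96 0 ∷ quad 18 0 0 ∷ cubic 1 0 0 0 ∷ [])
  (0 , const 283 ∷ lin 120 0 ∷ quad 18 0 0 ∷ cubic 1 0 0 0 ∷ [])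
  (0 , const 17 ∷ lin 39 0 ∷ quad 12 0 0 ∷ cubic 1 0 0 0 ∷ [])
  (0 , const 413 ∷ lin 177 0 ∷ quad 24 0 0 ∷ cubic 1 0 0 0 ∷ [])
  where
  x : Expr 1
  x = var 0F

P-θ²≥1 : ∀ q → NonNeg (q - + 6) → 0ℤ ≤ᶻ (+ 2 * - (q * - 1ℤ) + (- (q * - 1ℤ) + - 1ℤ)) - 1ℤ
P-θ²≥1 q hq = nonNeg-cert 0 (lit 3 ⊗ hq ⊕ lit 16) (solve (q ∷ []))

Q-θ²≥1 : ∀ q → NonNeg (q - + 6) → 0ℤ ≤ᶻ (- (q * - 1ℤ) + + 2 * q * (- (q * - 1ℤ) + - 1ℤ)) - 1ℤ
Q-θ²≥1 q hq = nonNeg-cert 0 (lit 2 ⊗ (hq ⊗ hq) ⊕ lit 23 ⊗ hq ⊕ lit 65) (solve (q ∷ []))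

-- For U = -θ² one has T = q + (q - 1)θ, P = 3q - 1 and Q = 2q² - q, both positive.
width-3 : ∀ q → NonNeg (q - + 6) → Witness q (- (q * - 1ℤ)) (- 1ℤ)
width-3 q hq with parity q
... | inj₁ (h , refl) = even-case h (- 1ℤ) (- 1ℤ) (half h hq) (small-θ² (+ 2 * h) hq) (P-θ²≥1 (+ 2 * h) hq)
    (inj₂ (Q-θ²≥1 (+ 2 * h) hq , - 1ℤ , refl))
  where
  half : ∀ h → NonNeg (+ 2 * h - + 6) → 0ℤ ≤ᶻ h - 1ℤ
  half h hq = nonNeg-cert 1 (hq ⊕ lit 4) (solve (h ∷ []))
... | inj₂ (h , refl) = unit-case h (- 1ℤ) (- 1ℤ) (half h hq) (small-θ² (1ℤ + + 2 * h) hq)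
  (P-θ²≥1 (1ℤ + + 2 * h) hq)
    (qP (1ℤ + + 2 * h) hq) (inj₁ (Q-θ²≥1 (1ℤ + + 2 * h) hq))
  where
  positive : ∀ h → NonNeg (1ℤ + + 2 * h - + 6) → 0ℤ <ᶻ h
  positive h hq = cert 1 (hq ⊕ lit 4) (solve (h ∷ []))
  half : ∀ h → NonNeg (1ℤ + + 2 * h - + 6) → NonNeg (h - 1ℤ)
  half h hq = pred-NonNeg (positive h hq)
  qP : ∀ q → NonNeg (q - + 6) → 0ℤ ≤ᶻ q *
    (- (q * - 1ℤ) * - (q * - 1ℤ) + - (q * - 1ℤ) * - 1ℤ + q * (- 1ℤ * - 1ℤ)) - (q + 1ℤ) *
    (+ 2 * - (q * - 1ℤ) + (- (q * - 1ℤ) + - 1ℤ)) - 1ℤ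
  qP q hq = nonNeg-cert 0 (hq ⊗ hq ⊗ hq ⊕ lit 15 ⊗ (hq ⊗ hq) ⊕ lit 70 ⊗ hq ⊕ lit 96) (solve (q ∷ []))

width-3-result : ∀ q → NonNeg (+ q - + 6) → PowerResult q 1
width-3-result q hq = inj₂ (subst (λ u₁ → Witness (+ q) (- (+ q * - 1ℤ)) (- u₁)) (sym (lem (+ q)))
  (width-3 (+ q) hq))
  where
  lem : ∀ q → - (q * 0ℤ) + 1ℤ ≡ 1ℤ
  lem = solve-∀

strict? : ∀ q u₀ u₁ x₀ x₁ → Dec (StrictDigit q u₀ u₁ x₀ x₁)
strict? q u₀ u₁ x₀ x₁ = map′
  (λ { (a , b , c , d , e , f , g) → strict (inside a b c d e f) λ k eq →
    g (divides k (trans eq (ℤ.*-comm q k))) })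
  (λ { (strict (inside a b c d e f) g) → a , b , c , d , e , f , λ { (divides k eq) →
    g k (trans eq (ℤ.*-comm k q)) } })
  (_ ℤ.<? _ ×-dec _ ℤ.<? _ ×-dec _ ℤ.<? _ ×-dec _ ℤ.<? _ ×-dec _ ℤ.<? _ ×-dec _ ℤ.<? _ ×-dec ¬? (q ∣? x₀))

-- For small q and w the estimates fail and the digits c, c′, d, e are given explicitly.
explicit : ∀ {q u₀ u₁} c₀ c₁ c′₀ c′₁ d₀ d₁ e₀ e₁ →
  {_ : True (strict? q u₀ u₁ c₀ c₁ ×-dec strict? q u₀ u₁ c′₀ c′₁ ×-dec strict? q u₀ u₁ d₀ d₁ ×-dec
    strict? q u₀ u₁ e₀ e₁ ×-dec strict? q u₀ u₁ 1ℤ 0ℤ ×-dec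
    (c₀ + (u₀ * d₀ - q * (u₁ * d₁)) ℤ.≟
      c′₀ + (- (q * u₁) * (e₀ + - (q * u₁)) - q * ((u₀ + u₁) * (e₁ + (u₀ + u₁))))) ×-dec
    (c₁ + (u₀ * d₁ + u₁ * d₀ + u₁ * d₁) ℤ.≟
      c′₁ + (- (q * u₁) * (e₁ + (u₀ + u₁)) + (u₀ + u₁) * (e₀ + - (q * u₁)) + (u₀ + u₁) * (e₁ + (u₀ + u₁)))))} →
  Witness q u₀ u₁
explicit _ _ _ _ _ _ _ _ {h} with toWitness h
... | a , b , c , d , e , f , g = witness a b c d e f g

-- Here n = w - 2. The direct estimates serve w = 2 from q = 8 and w = 3 from q = 6. For larger w
-- the norm q^w eventually passes the bound in `Large`, at w = 4 already if q ≥ 13. Finitely many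
-- pairs are left for explicit digits.
witnesses : ∀ q n → 2 ≤ q → ¬ (q ≡ 2 × (n ≡ 0 ⊎ n ≡ 1)) → PowerResult q n
witnesses 0 _ ()
witnesses 1 _ (ℕ.s≤s ())
witnesses 2 0 _ h = contradiction (refl , inj₁ refl) h
witnesses 2 1 _ h = contradiction (refl , inj₂ refl) h
witnesses 2 2 _ _ = inj₁ (explicit (- + 1) (- + 1) (+ 1) (+ 0) (+ 3) (- + 1) (- + 1) (+ 1))
witnesses 2 3 _ _ = inj₁ (explicit (- + 1) (- + 2) (- + 3) (+ 1) (- + 1) (+ 3) (- + 3) (+ 1))
witnesses 2 4 _ _ = inj₁ (explicit (- + 3) (+ 3) (+ 1) (- + 3) (- + 5) (+ 3) (- + 1) (- + 2))
witnesses 2 5 _ _ = inj₂ (explicit (- + 1) (- + 5) (+ 1) (+ 0) (+ 7) (+ 1) (- + 5) (+ 3))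
witnesses 2 6 _ _ = inj₂ (explicit (+ 1) (+ 5) (- + 3) (- + 5) (- + 3) (+ 8) (- + 7) (- + 1))
witnesses 2 7 _ _ = inj₂ (explicit (- + 11) (+ 7) (+ 9) (- + 7) (- + 17) (+ 5) (+ 3) (- + 8))
-- From w = 10 on, since 2¹⁰ = 1024 exceeds 36 · 5² + 2 = 902.
witnesses 2 (ℕ.2+ (ℕ.2+ (ℕ.2+ (ℕ.2+ n)))) _ _ = large-result 0 (7 ℕ.+ n) (large-from {+ 2} 9 (lit _) (lit _) n)
witnesses 3 0 _ _ = inj₂ (explicit (+ 1) (- + 1) (+ 1) (+ 1) (+ 1) (+ 1) (- + 1) (+ 0))
witnesses 3 1 _ _ = inj₂ (explicit (+ 1) (+ 1) (+ 1) (- + 2) (- + 2) (+ 2) (- + 1) (- + 1))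
witnesses 3 2 _ _ = inj₁ (explicit (- + 2) (- + 2) (+ 4) (+ 2) (+ 7) (- + 1) (- + 4) (+ 2))
witnesses 3 3 _ _ = inj₁ (explicit (+ 7) (- + 5) (- + 5) (+ 5) (- + 2) (+ 8) (- + 7) (- + 1))
witnesses 3 4 _ _ = inj₁ (explicit (- + 2) (+ 8) (+ 16) (- + 7) (- + 23) (+ 6) (+ 2) (- + 8))
witnesses 3 (ℕ.suc (ℕ.2+ (ℕ.2+ n))) _ _ = large-result 1 (4 ℕ.+ n) (large-from {+ 3} 6 (lit _) (lit _) n)
witnesses 4 0 _ _ = inj₂ (explicit (+ 1) (- + 1) (+ 1) (+ 1) (+ 2) (+ 1) (- + 2) (+ 0))
witnesses 4 1 _ _ = inj₂ (explicit (- + 1) (+ 2) (+ 3) (- + 3) (- + 6) (+ 3) (- + 2) (- + 1))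
witnesses 4 2 _ _ = inj₁ (explicit (- + 3) (- + 3) (+ 5) (+ 3) (+ 14) (+ 2) (- + 6) (+ 3))
witnesses 4 3 _ _ = inj₁ (explicit (+ 7) (+ 6) (+ 3) (- + 13) (- + 10) (+ 16) (- + 14) (- + 2))
witnesses 4 (ℕ.2+ (ℕ.2+ n)) _ _ = large-result 2 (3 ℕ.+ n) (large-from {+ 4} 5 (lit _) (lit _) n)
witnesses 5 0 _ _ = inj₂ (explicit (+ 1) (- + 2) (+ 1) (+ 1) (+ 2) (+ 2) (- + 2) (+ 0))
witnesses 5 1 _ _ = inj₂ (explicit (+ 2) (+ 2) (+ 7) (- + 4) (- + 8) (+ 4) (- + 2) (- + 2))
witnesses 5 2 _ _ = inj₁ (explicit (- + 9) (- + 8) (+ 6) (+ 4) (+ 22) (+ 4) (- + 11) (+ 4))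
witnesses 5 3 _ _ = inj₁ (explicit (- + 39) (+ 18) (+ 21) (- + 9) (- + 27) (+ 28) (- + 23) (- + 5))
witnesses 5 (ℕ.2+ (ℕ.2+ n)) _ _ = large-result 3 (3 ℕ.+ n) (large-from {+ 5} 5 (lit _) (lit _) n)
witnesses 6 0 _ _ = inj₂ (explicit (+ 1) (- + 2) (+ 1) (+ 1) (+ 3) (+ 2) (- + 3) (+ 0))
witnesses 6 1 _ _ = width-3-result 6 (lit _)
witnesses 6 2 _ _ = inj₁ (explicit (- + 11) (- + 10) (+ 7) (+ 5) (+ 33) (+ 9) (- + 15) (+ 5))
witnesses 6 3 _ _ = inj₁ (explicit (+ 17) (+ 15) (+ 41) (- + 37) (- + 57) (+ 42) (- + 33) (- + 9))
witnesses 6 (ℕ.2+ (ℕ.2+ n)) _ _ = large-result 4 (3 ℕ.+ n) (large-from {+ 6} 5 (lit _) (lit _) n)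
witnesses 7 0 _ _ = inj₂ (explicit (+ 1) (- + 2) (+ 1) (+ 2) (+ 3) (+ 3) (- + 3) (+ 0))
witnesses 7 1 _ _ = width-3-result 7 (lit _)
witnesses 7 2 _ _ = inj₁ (explicit (- + 13) (- + 12) (+ 15) (+ 12) (+ 38) (+ 16) (- + 20) (+ 7))
witnesses 7 (ℕ.suc (ℕ.2+ n)) _ _ = large-result 5 (2 ℕ.+ n) (large-from {+ 7} 4 (lit _) (lit _) n)
witnesses 8 0 _ _ = inj₂ (width-2 (+ 8) (lit _))
witnesses 8 1 _ _ = width-3-result 8 (lit _)
witnesses 8 2 _ _ = inj₁ (explicit (- + 15) (- + 14) (+ 17) (+ 14) (+ 60) (+ 20) (- + 28) (+ 7))
witnesses 8 (ℕ.suc (ℕ.2+ n)) _ _ = large-result 6 (2 ℕ.+ n) (large-from {+ 8} 4 (lit _) (lit _) n)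
witnesses 9 0 _ _ = inj₂ (width-2 (+ 9) (lit _))
witnesses 9 1 _ _ = width-3-result 9 (lit _)
witnesses 9 2 _ _ = inj₁ (explicit (- + 26) (- + 24) (+ 19) (+ 16) (+ 67) (+ 29) (- + 35) (+ 9))
witnesses 9 (ℕ.suc (ℕ.2+ n)) _ _ = large-result 7 (2 ℕ.+ n) (large-from {+ 9} 4 (lit _) (lit _) n)
witnesses 10 0 _ _ = inj₂ (width-2 (+ 10) (lit _))
witnesses 10 1 _ _ = width-3-result 10 (lit _)
witnesses 10 2 _ _ = inj₁ (explicit (- + 29) (- + 27) (+ 21) (+ 18) (+ 95) (+ 35) (- + 45) (+ 9))
witnesses 10 (ℕ.suc (ℕ.2+ n)) _ _ = large-result 8 (2 ℕ.+ n) (large-from {+ 10} 4 (lit _) (lit _) n)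
witnesses 11 0 _ _ = inj₂ (width-2 (+ 11) (lit _))
witnesses 11 1 _ _ = width-3-result 11 (lit _)
witnesses 11 2 _ _ = inj₁ (explicit (- + 32) (- + 30) (+ 34) (+ 30) (+ 104) (+ 46) (- + 54) (+ 11))
witnesses 11 (ℕ.suc (ℕ.2+ n)) _ _ = large-result 9 (2 ℕ.+ n) (large-from {+ 11} 4 (lit _) (lit _) n)
witnesses 12 0 _ _ = inj₂ (width-2 (+ 12) (lit _))
witnesses 12 1 _ _ = width-3-result 12 (lit _)
witnesses 12 2 _ _ = inj₁ (explicit (- + 35) (- + 33) (+ 37) (+ 33) (+ 138) (+ 54) (- + 66) (+ 11))
witnesses 12 (ℕ.suc (ℕ.2+ n)) _ _ = large-result 10 (2 ℕ.+ n) (large-from {+ 12} 4 (lit _) (lit _) n)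
witnesses (ℕ.suc (ℕ.2+ (ℕ.2+ (ℕ.2+ (ℕ.2+ (ℕ.2+ (ℕ.2+ q))))))) 0 _ _ = inj₂ (width-2 (+ (13 ℕ.+ q)) (lit _))
witnesses (ℕ.suc (ℕ.2+ (ℕ.2+ (ℕ.2+ (ℕ.2+ (ℕ.2+ (ℕ.2+ q))))))) 1 _ _ = width-3-result (13 ℕ.+ q) (lit _)
witnesses (ℕ.suc (ℕ.2+ (ℕ.2+ (ℕ.2+ (ℕ.2+ (ℕ.2+ (ℕ.2+ q))))))) (ℕ.2+ n) _ _ =
  large-result (11 ℕ.+ q) (1 ℕ.+ n) (large-from {+ (13 ℕ.+ q)} 3 (lit _) (large-13 q) n)

-- From Voronoi cells to digit sets

Sign : ℤ → Set
Sign s = s ≡ - (+ 1) ⊎ s ≡ + 1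

sign² : ∀ {s} → Sign s → s * s ≡ 1ℤ
sign² (inj₁ refl) = refl
sign² (inj₂ refl) = refl

sign-* : ∀ {s t} → Sign s → Sign t → Sign (s * t)
sign-* (inj₁ refl) (inj₁ refl) = inj₂ refl
sign-* (inj₁ refl) (inj₂ refl) = inj₁ refl
sign-* (inj₂ refl) (inj₁ refl) = inj₁ refl
sign-* (inj₂ refl) (inj₂ refl) = inj₂ refl

-- In the coordinates of ℤ[τ], a + bθ is the pair (a , p b); a power of τ is the same power of θ up to sign.
times-τ : ∀ {p} → Sign p → ∀ q s x y → mulτ p q τ (s * x , p * (s * y))
  ≡ (s * p * - (q * y) , p * (s * p * (x + y)))
times-τ {p} hp q s x y = cong₂ _,_ (lem₀ p q s x y)
  (trans (lem₁ p s x y) (trans (cong (λ k → s * x + k * (s * y)) (sign² hp))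
    (trans (lem₂ s x y) (trans (cong (λ k → k * (s * (x + y))) (sym (sign² hp))) (lem₃ p s (x + y))))))
  where
  lem₀ : ∀ p q s x y → 0ℤ * (s * x) - q * (1ℤ * (p * (s * y))) ≡ s * p * - (q * y)
  lem₀ = solve-∀
  lem₁ : ∀ p s x y → 0ℤ * (p * (s * y)) + 1ℤ * (s * x) + p * (1ℤ * (p * (s * y))) ≡ s * x + p * p * (s * y)
  lem₁ = solve-∀
  lem₂ : ∀ s x y → s * x + 1ℤ * (s * y) ≡ 1ℤ * (s * (x + y))
  lem₂ = solve-∀
  lem₃ : ∀ p s z → p * p * (s * z) ≡ p * (s * p * z)
  lem₃ = solve-∀

power-coordinates : ∀ {p} → Sign p → ∀ q n → ∃ λ s → Sign s × τpow p q n ≡ (s * re q n , p * (s * im q n))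
power-coordinates {p} hp q 0 = 1ℤ , inj₂ refl , cong (1ℤ ,_) (sym (ℤ.*-zeroʳ p))
power-coordinates {p} hp q (ℕ.suc n) with power-coordinates hp q n
... | s , hs , eq = s * p , sign-* hs hp , trans (cong (mulτ p q τ) eq) (times-τ hp q s (re q n) (im q n))

-- Expansion of the norm of x + λT, with λ = m + nθ, as N(x) + N(λ)N(T) + B(x, λT); the last two
-- terms form the quantity of `gap`.
shifted-norm : ∀ q u₀ u₁ x₀ x₁ m n →
  (x₀ + (m * - (q * u₁) - q * (n * (u₀ + u₁)))) * (x₀ + (m * - (q * u₁) - q * (n * (u₀ + u₁))))
  + (x₀ + (m * - (q * u₁) - q * (n * (u₀ + u₁)))) * (x₁ + (m * (u₀ + u₁) + n * - (q * u₁) + n * (u₀ + u₁)))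
  + q * ((x₁ + (m * (u₀ + u₁) + n * - (q * u₁) + n * (u₀ + u₁))) *
    (x₁ + (m * (u₀ + u₁) + n * - (q * u₁) + n * (u₀ + u₁))))
  ≡ x₀ * x₀ + x₀ * x₁ + q * (x₁ * x₁) + ((m * m + m * n + q * (n * n)) *
    (q * (u₀ * u₀ + u₀ * u₁ + q * (u₁ * u₁)))
    + (m * (x₀ * (+ 2 * - (q * u₁) + (u₀ + u₁)) + x₁ * (- (q * u₁) + + 2 * q * (u₀ + u₁)))
    + n * (x₀ * ((+ 2 * - (q * u₁) + (u₀ + u₁)) - (- (q * u₁) + + 2 * q * (u₀ + u₁)))
      + x₁ * (q * (+ 2 * - (q * u₁) + (u₀ + u₁))))))
shifted-norm = solve-∀

norm-coordinates : ∀ {p} → Sign p → ∀ q x y → norm p q (x , y) ≡ normForm q x (p * y)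
norm-coordinates {p} hp q x y = trans (cong (λ z → x * x + p * (x * y) + q * z)
  (trans (sym (ℤ.*-identityˡ (y * y))) (cong (_* (y * y)) (sym (sign² hp)))))
  (lem p q x y)
  where
  lem : ∀ p q x y → x * x + p * (x * y) + q * (p * p * (y * y)) ≡ x * x + x * (p * y) + q * (p * y * (p * y))
  lem = solve-∀

module Membership {p q : ℤ} (hp : Sign p) (q≥2 : NonNeg (q - + 2)) {w : ℕ} {D : Zτ → Set}
  (digits : IsMinNormDigitSet p q w D)
  {u₀ u₁ s : ℤ} (hs : Sign s) (τ^w : τpow p q w ≡ (s * - (q * u₁) , p * (s * (u₀ + u₁)))) where
  open IsMinNormDigitSet digits

  not-divisible : ∀ {x₀ x₁} → (∀ k → x₀ ≢ q * k) → ¬ DivByτ p q (x₀ , x₁)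
  not-divisible {x₀} h ((k₀ , k₁) , eq) = h (- k₁) (trans (cong proj₁ eq) (lem q k₀ k₁))
    where
    lem : ∀ q k₀ k₁ → k₀ * 0ℤ - q * (k₁ * 1ℤ) ≡ q * - k₁
    lem = solve-∀

  multiple₀ : ∀ k → ∃ λ j → proj₁ (mulτ p q k (τpow p q w)) ≡ q * j
  multiple₀ (k₀ , k₁) = - (k₀ * (s * u₁)) - k₁ * (p * (s * (u₀ + u₁))) ,
    trans (cong (λ t → proj₁ (mulτ p q (k₀ , k₁) t)) τ^w) (lem p q s u₁ k₀ k₁ (u₀ + u₁))
    where
    lem : ∀ p q s u₁ k₀ k₁ b → k₀ * (s * - (q * u₁)) - q * (k₁ * (p * (s * b)))
      ≡ q * (- (k₀ * (s * u₁)) - k₁ * (p * (s * b)))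
    lem = solve-∀

  module _ {x₀ x₁ : ℤ} (strict-x : StrictDigit q u₀ u₁ x₀ x₁) where
    open StrictDigit strict-x
    private
      x : Zτ
      x = (x₀ , p * x₁)

    congruent-bigger : ∀ d₀ d₁ k₀ k₁ → subτ (d₀ , d₁) x ≡ mulτ p q (k₀ , k₁) (τpow p q w) →
      ¬ (k₀ ≡ 0ℤ × k₁ ≡ 0ℤ) →
      norm p q x <ᶻ norm p q (d₀ , d₁)
    congruent-bigger d₀ d₁ k₀ k₁ eq k≢0 = subst₂ _<ᶻ_ (sym x-norm) (sym d-norm)
      (subst (_<ᶻ normForm q x₀ x₁ + excess) (ℤ.+-identityʳ _)
        (ℤ.+-monoʳ-< (normForm q x₀ x₁) (gap q≥1 isInside m n mn≢0)))
      where
      m n a b excess : ℤ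
      m = s * k₀
      n = s * p * k₁
      a = - (q * u₁)
      b = u₀ + u₁
      excess = normForm q m n * (q * Mᵤ q u₀ u₁) + (m * (x₀ * Pᵤ q u₀ u₁ + x₁ * Qᵤ q u₀ u₁)
        + n * (x₀ * (Pᵤ q u₀ u₁ - Qᵤ q u₀ u₁) + x₁ * (q * Pᵤ q u₀ u₁)))
      q≥1 : NonNeg (q - 1ℤ)
      q≥1 = subst NonNeg (lem q) (q≥2 ⊕ lit 1)
        where
        lem : ∀ q → q - + 2 + 1ℤ ≡ q - 1ℤ
        lem = solve-∀
      cancel : ∀ {s} → Sign s → ∀ k → s * k ≡ 0ℤ → k ≡ 0ℤ
      cancel {s} hs k eq = trans (sym (ℤ.*-identityˡ k)) (trans (cong (_* k) (sym (sign² hs)))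
        (trans (ℤ.*-assoc s s k) (trans (cong (s *_) eq) (ℤ.*-zeroʳ s))))
      mn≢0 : ¬ (m ≡ 0ℤ × n ≡ 0ℤ)
      mn≢0 (m≡0 , n≡0) = k≢0 (cancel hs k₀ m≡0 , cancel (sign-* hs hp) k₁ n≡0)
      x-norm : norm p q x ≡ normForm q x₀ x₁
      x-norm = trans (norm-coordinates hp q x₀ (p * x₁)) (cong (normForm q x₀)
        (trans (sym (ℤ.*-assoc p p x₁)) (trans (cong (_* x₁) (sign² hp)) (ℤ.*-identityˡ x₁))))
      eq′ : (d₀ - x₀ , d₁ - p * x₁) ≡ mulτ p q (k₀ , k₁) (s * a , p * (s * b))
      eq′ = trans eq (cong (mulτ p q (k₀ , k₁)) τ^w)
      lem : ∀ d x → d ≡ x + (d - x)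
      lem = solve-∀
      lem₀ : ∀ p q s k₀ k₁ a b → k₀ * (s * a) - q * (k₁ * (p * (s * b))) ≡ s * k₀ * a - q * (s * p * k₁ * b)
      lem₀ = solve-∀
      d₀-eq : d₀ ≡ x₀ + (m * a - q * (n * b))
      d₀-eq = trans (lem d₀ x₀) (cong (λ y → x₀ + y) (trans (cong proj₁ eq′) (lem₀ p q s k₀ k₁ a b)))
      lem₁ : ∀ p s k₀ k₁ a b x₁ → p * (p * x₁ + (k₀ * (p * (s * b)) + k₁ * (s * a) + p * (k₁ * (p * (s * b)))))
        ≡ p * p * x₁ + (p * p * (s * k₀ * b) + s * p * k₁ * a + p * p * (s * p * k₁ * b))
      lem₁ = solve-∀
      lem₂ : ∀ x y z t → 1ℤ * x + (1ℤ * y + z + 1ℤ * t) ≡ x + (y + z + t)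
      lem₂ = solve-∀
      d₁-eq : p * d₁ ≡ x₁ + (m * b + n * a + n * b)
      d₁-eq = trans (cong (p *_) (trans (lem d₁ (p * x₁)) (cong (λ y → p * x₁ + y) (cong proj₂ eq′))))
        (trans (lem₁ p s k₀ k₁ a b x₁) (trans (cong (λ pp → pp * x₁ + (pp * (m * b) + n * a + pp * (n * b)))
          (sign² hp))
          (lem₂ x₁ (m * b) (n * a) (n * b))))
      d-norm : norm p q (d₀ , d₁) ≡ normForm q x₀ x₁ + excess
      d-norm = trans (norm-coordinates hp q d₀ d₁)
        (trans (cong₂ (normForm q) d₀-eq d₁-eq) (shifted-norm q u₀ u₁ x₀ x₁ m n))

    -- The alternative d = 0 would make x a multiple of τ^w, whose first coordinate is divisible by
    -- q.
    d-not-divisible : ∀ d₀ d₁ k → D (d₀ , d₁) → subτ (d₀ , d₁) x ≡ mulτ p q k (τpow p q w) →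
      ¬ DivByτ p q (d₀ , d₁)
    d-not-divisible d₀ d₁ k d∈D eq with digitsOk (d₀ , d₁) d∈D
    ... | inj₂ h = h
    ... | inj₁ refl = contradiction (trans (lem x₀)
      (trans (cong -_ (trans (cong proj₁ eq) (proj₂ (multiple₀ k))))
      (ℤ.neg-distribʳ-* q (proj₁ (multiple₀ k)))))
      (indivisible (- proj₁ (multiple₀ k)))
      where
      lem : ∀ x → x ≡ - (0ℤ - x)
      lem = solve-∀

    not-congruent : ∀ d₀ d₁ k₀ k₁ → D (d₀ , d₁) → ¬ (k₀ ≡ 0ℤ × k₁ ≡ 0ℤ) →
      subτ (d₀ , d₁) x ≢ mulτ p q (k₀ , k₁) (τpow p q w)
    not-congruent d₀ d₁ k₀ k₁ d∈D k≢0 eq = ℤ.<⇒≱ (congruent-bigger d₀ d₁ k₀ k₁ eq k≢0)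
      (minimal (d₀ , d₁) d∈D (d-not-divisible d₀ d₁ (k₀ , k₁) d∈D eq) x ((- k₀ , - k₁) , cong₂ _,_
        (trans (ℤ-flip x₀ d₀) (trans (cong -_ (cong proj₁ eq)) (lem₀ q k₀ k₁ a b)))
        (trans (ℤ-flip (p * x₁) d₁) (trans (cong -_ (cong proj₂ eq)) (lem₁ p k₀ k₁ a b)))))
      where
      a b : ℤ
      a = proj₁ (τpow p q w)
      b = proj₂ (τpow p q w)
      ℤ-flip : ∀ x y → x - y ≡ - (y - x)
      ℤ-flip = solve-∀
      lem₀ : ∀ q k₀ k₁ a b → - (k₀ * a - q * (k₁ * b)) ≡ - k₀ * a - q * (- k₁ * b)
      lem₀ = solve-∀
      lem₁ : ∀ p k₀ k₁ a b → - (k₀ * b + k₁ * a + p * (k₁ * b)) ≡ - k₀ * b + - k₁ * a + p * (- k₁ * b)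
      lem₁ = solve-∀

    -- `D` contains some representative of the class of x. Were it different from x, it would have
    -- larger norm, against its minimality.
    strict-digit∈D : D x
    strict-digit∈D with exists x (not-divisible indivisible)
    ... | (d₀ , d₁) , d∈D , (k₀ , k₁) , d≡x with k₀ ℤ.≟ 0ℤ | k₁ ℤ.≟ 0ℤ
    ...   | yes refl | yes refl = subst D d-is-x d∈D
      where
      lem₀ : ∀ q a b → 0ℤ * a - q * (0ℤ * b) ≡ 0ℤ
      lem₀ = solve-∀
      lem₁ : ∀ p a b → 0ℤ * b + 0ℤ * a + p * (0ℤ * b) ≡ 0ℤ
      lem₁ = solve-∀
      d-is-x : (d₀ , d₁) ≡ x
      d-is-x = cong₂ _,_ (ℤ.i-j≡0⇒i≡j d₀ x₀ (trans (cong proj₁ d≡x)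
        (lem₀ q (proj₁ (τpow p q w)) (proj₂ (τpow p q w)))))
        (ℤ.i-j≡0⇒i≡j d₁ (p * x₁) (trans (cong proj₂ d≡x) (lem₁ p (proj₁ (τpow p q w)) (proj₂ (τpow p q w)))))
    ...   | yes _ | no k₁≢0 = contradiction d≡x (not-congruent d₀ d₁ k₀ k₁ d∈D λ z → k₁≢0 (proj₂ z))
    ...   | no k₀≢0 | _ = contradiction d≡x (not-congruent d₀ d₁ k₀ k₁ d∈D λ z → k₀≢0 (proj₁ z))

-- Expansions of weight two and three

zeros : ℕ → List Zτ → List Zτ
zeros 0 xs = xs
zeros (ℕ.suc n) xs = zeroτ ∷ zeros n xs

eval-zeros : ∀ p q n xs → eval p q (zeros n xs) ≡ mulτ p q (τpow p q n) (eval p q xs)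
eval-zeros p q 0 xs = cong₂ _,_ (lem₀ q (proj₁ (eval p q xs)) (proj₂ (eval p q xs)))
  (lem₁ p (proj₁ (eval p q xs)) (proj₂ (eval p q xs)))
  where
  lem₀ : ∀ q a b → a ≡ 1ℤ * a - q * (0ℤ * b)
  lem₀ = solve-∀
  lem₁ : ∀ p a b → b ≡ 1ℤ * b + 0ℤ * a + p * (0ℤ * b)
  lem₁ = solve-∀
eval-zeros p q (ℕ.suc n) xs = trans (cong (λ v → addτ zeroτ (mulτ p q τ v)) (eval-zeros p q n xs))
  (cong₂ _,_ (lem₀ p q (proj₁ t) (proj₂ t) (proj₁ v) (proj₂ v))
    (lem₁ p q (proj₁ t) (proj₂ t) (proj₁ v) (proj₂ v)))
  where
  t v : Zτ
  t = τpow p q n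
  v = eval p q xs
  lem₀ : ∀ p q a b c d → 0ℤ + (0ℤ * (a * c - q * (b * d)) - q * (1ℤ * (a * d + b * c + p * (b * d))))
    ≡ (0ℤ * a - q * (1ℤ * b)) * c - q * ((0ℤ * b + 1ℤ * a + p * (1ℤ * b)) * d)
  lem₀ = solve-∀
  lem₁ : ∀ p q a b c d → 0ℤ + (0ℤ * (a * d + b * c + p * (b * d)) + 1ℤ * (a * c - q * (b * d))
    + p * (1ℤ * (a * d + b * c + p * (b * d))))
    ≡ (0ℤ * a - q * (1ℤ * b)) * d + (0ℤ * b + 1ℤ * a + p * (1ℤ * b)) * c
      + p * ((0ℤ * b + 1ℤ * a + p * (1ℤ * b)) * d)
  lem₁ = solve-∀

weight-zeros : ∀ n xs → weight (zeros n xs) ≡ weight xs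
weight-zeros 0 xs = refl
weight-zeros (ℕ.suc n) xs = weight-zeros n xs

weight-cons : ∀ σ σs → weight (σ ∷ σs) ≤ ℕ.suc (weight σs)
weight-cons σ σs with ≡-dec ℤ._≟_ ℤ._≟_ σ zeroτ
... | yes _ = ℕ.n≤1+n _
... | no _ = ℕ.≤-refl

weight-nonzero : ∀ {σ} σs → σ ≢ zeroτ → weight (σ ∷ σs) ≡ ℕ.suc (weight σs)
weight-nonzero {σ} σs σ≢0 with ≡-dec ℤ._≟_ ℤ._≟_ σ zeroτ
... | yes σ≡0 = contradiction σ≡0 σ≢0
... | no _ = refl

zerosUpTo-zeros : ∀ n xs → ZerosUpTo n (zeros n xs)
zerosUpTo-zeros 0 xs = tt
zerosUpTo-zeros (ℕ.suc n) xs = refl , zerosUpTo-zeros n xs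

zerosUpTo-[] : ∀ n → ZerosUpTo n []
zerosUpTo-[] 0 = tt
zerosUpTo-[] (ℕ.suc n) = tt

isNAF-zeros : ∀ w n xs → IsNAF w xs → IsNAF w (zeros n xs)
isNAF-zeros w 0 xs h = h
isNAF-zeros w (ℕ.suc n) xs h = (λ 0≢0 → contradiction refl 0≢0) , isNAF-zeros w n xs h

allIn-zeros : ∀ {D : Zτ → Set} → D zeroτ → ∀ n xs → AllIn D xs → AllIn D (zeros n xs)
allIn-zeros h 0 xs hs = hs
allIn-zeros h (ℕ.suc n) xs hs = h , allIn-zeros h n xs hs

eval-singleton : ∀ p q x → eval p q (x ∷ []) ≡ x
eval-singleton p q (a , b) = cong₂ _,_ (lem₀ q a) (lem₁ p b)
  where
  lem₀ : ∀ q a → a + (0ℤ * 0ℤ - q * (1ℤ * 0ℤ)) ≡ a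
  lem₀ = solve-∀
  lem₁ : ∀ p b → b + (0ℤ * 0ℤ + 1ℤ * 0ℤ + p * (1ℤ * 0ℤ)) ≡ b
  lem₁ = solve-∀

-- With w = 2 + n, the w-NAF has c′, e and 1 at positions 0, w and 2w, and the competitor has c and
-- d at positions 0 and w - 1. If c or d were 0, the competitor would only become lighter.
two-vs-three : ∀ {p q n D c c′ d e} → D zeroτ → D c → D c′ → D d → D e → D oneτ → c′ ≢ zeroτ → e ≢ zeroτ →
  addτ c (mulτ p q (τpow p q (ℕ.suc n)) d)
    ≡ addτ c′ (mulτ p q (τpow p q (2 ℕ.+ n)) (addτ e (τpow p q (2 ℕ.+ n)))) →
  ¬ NAFOptimal p q (2 ℕ.+ n) D
two-vs-three {p} {q} {n} {D} {c} {c′} {d} {e} z∈D c∈D c′∈D d∈D e∈D 1∈D c′≢0 e≢0 eq opt =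
  ℕ.<⇒≱ short (subst (_≤ weight f) weight-naf
    (opt naf f naf∈D f∈D naf-isNAF (trans eval-naf (trans (sym eq) (sym eval-f)))))
  where
  tail naf f : List Zτ
  tail = e ∷ zeros (1 ℕ.+ n) (oneτ ∷ [])
  naf = c′ ∷ zeros (1 ℕ.+ n) tail
  f = c ∷ zeros n (d ∷ [])
  weight-naf : weight naf ≡ 3
  weight-naf = trans (weight-nonzero _ c′≢0) (cong ℕ.suc (trans (weight-zeros (1 ℕ.+ n) tail)
    (trans (weight-nonzero _ e≢0) (cong ℕ.suc (weight-zeros (1 ℕ.+ n) (oneτ ∷ []))))))
  short : weight f ℕ.< 3
  short = ℕ.s≤s (ℕ.≤-trans (weight-cons c _)
    (ℕ.s≤s (subst (_≤ 1) (sym (weight-zeros n (d ∷ []))) (weight-cons d []))))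
  naf∈D : AllIn D naf
  naf∈D = c′∈D , allIn-zeros {D} z∈D (1 ℕ.+ n) tail (e∈D , allIn-zeros {D} z∈D (1 ℕ.+ n) (oneτ ∷ []) (1∈D , tt))
  f∈D : AllIn D f
  f∈D = c∈D , allIn-zeros {D} z∈D n (d ∷ []) (d∈D , tt)
  naf-isNAF : IsNAF (2 ℕ.+ n) naf
  naf-isNAF = (λ _ → zerosUpTo-zeros (1 ℕ.+ n) tail) , isNAF-zeros (2 ℕ.+ n) (1 ℕ.+ n) tail
    ((λ _ → zerosUpTo-zeros (1 ℕ.+ n) _) , isNAF-zeros (2 ℕ.+ n) (1 ℕ.+ n) (oneτ ∷ [])
      ((λ _ → zerosUpTo-[] (1 ℕ.+ n)) , tt))
  shifted : ∀ x m xs → eval p q (x ∷ zeros m xs) ≡ addτ x (mulτ p q (τpow p q (ℕ.suc m)) (eval p q xs))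
  shifted x m xs = cong (addτ x) (trans (lem (mulτ p q τ (eval p q (zeros m xs))))
    (eval-zeros p q (ℕ.suc m) xs))
    where
    lem : ∀ y → y ≡ addτ zeroτ y
    lem (a , b) = cong₂ _,_ (sym (ℤ.+-identityˡ a)) (sym (ℤ.+-identityˡ b))
  times-one : ∀ t → mulτ p q t oneτ ≡ t
  times-one (a , b) = cong₂ _,_ (lem₀ q a b) (lem₁ p a b)
    where
    lem₀ : ∀ q a b → a * 1ℤ - q * (b * 0ℤ) ≡ a
    lem₀ = solve-∀
    lem₁ : ∀ p a b → a * 0ℤ + b * 1ℤ + p * (b * 0ℤ) ≡ b
    lem₁ = solve-∀
  eval-f : eval p q f ≡ addτ c (mulτ p q (τpow p q (ℕ.suc n)) d)
  eval-f = trans (shifted c n (d ∷ [])) (cong (λ v → addτ c (mulτ p q (τpow p q (ℕ.suc n)) v))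
    (eval-singleton p q d))
  eval-naf : eval p q naf ≡ addτ c′ (mulτ p q (τpow p q (2 ℕ.+ n)) (addτ e (τpow p q (2 ℕ.+ n))))
  eval-naf = trans (shifted c′ (1 ℕ.+ n) tail) (cong (λ v → addτ c′ (mulτ p q (τpow p q (2 ℕ.+ n)) v))
    (trans (shifted e (1 ℕ.+ n) (oneτ ∷ [])) (cong (addτ e)
      (trans (cong (mulτ p q (τpow p q (2 ℕ.+ n))) (eval-singleton p q oneτ)) (times-one _)))))

scaled-strict : ∀ {q u₀ u₁ s x₀ x₁} → Sign s → StrictDigit q u₀ u₁ x₀ x₁ → StrictDigit q u₀ u₁ (s * x₀) (s * x₁)
scaled-strict {q} {u₀} {u₁} {x₀ = x₀} {x₁} (inj₂ refl) h =
  subst₂ (StrictDigit q u₀ u₁) (sym (ℤ.*-identityˡ x₀)) (sym (ℤ.*-identityˡ x₁)) h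
scaled-strict {q} {u₀} {u₁} {x₀ = x₀} {x₁} (inj₁ refl) (strict i h) = strict
  (subst₂ (Inside q (q * Mᵤ q u₀ u₁)) (lem x₀ x₁ (Pᵤ q u₀ u₁) (Qᵤ q u₀ u₁))
    (lem x₀ x₁ (Pᵤ q u₀ u₁ - Qᵤ q u₀ u₁) (q * Pᵤ q u₀ u₁)) (flip i))
  (λ k eq → h (- k) (trans (lem′ x₀) (trans (cong -_ eq) (ℤ.neg-distribʳ-* q k))))
  where
  lem : ∀ x y P Q → - (x * P + y * Q) ≡ - (+ 1) * x * P + - (+ 1) * y * Q
  lem = solve-∀
  lem′ : ∀ x → x ≡ - (- (+ 1) * x)
  lem′ = solve-∀

strict-nonzero : ∀ {q u₀ u₁ x₀ x₁ y} → StrictDigit q u₀ u₁ x₀ x₁ → (x₀ , y) ≢ zeroτ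
strict-nonzero {q} h eq = StrictDigit.indivisible h 0ℤ (trans (cong proj₁ eq) (sym (ℤ.*-zeroʳ q)))

module _ {p q : ℤ} (hp : Sign p) (q≥2 : NonNeg (q - + 2)) where
  -- Passing from θ to τ, U and T acquire signs s and t = sp. These are absorbed by the digits sd
  -- and te, which lie in the cell by its symmetry. The sign of T² is 1, so the leading digit
  -- remains 1.
  witness-nonoptimal : ∀ {n D u₀ u₁ s} → IsMinNormDigitSet p q (2 ℕ.+ n) D → Sign s →
    τpow p q (ℕ.suc n) ≡ (s * u₀ , p * (s * u₁)) → Witness q u₀ u₁ → ¬ NAFOptimal p q (2 ℕ.+ n) D
  witness-nonoptimal {n} {D} {u₀} {u₁} {s} digits hs τ^n+1
    (witness {c₀} {c₁} {c′₀} {c′₁} {d₀} {d₁} {e₀} {e₁} c c′ d e one eq₀ eq₁) =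
    two-vs-three (IsMinNormDigitSet.zero∈D digits) (member c) (member c′) (member (scaled-strict hs d))
      (member (scaled-strict hs′ e))
      (subst (λ x → D (1ℤ , x)) (ℤ.*-zeroʳ p) (member one)) (strict-nonzero c′)
        (strict-nonzero (scaled-strict hs′ e)) equal
    where
    a b t : ℤ
    a = - (q * u₁)
    b = u₀ + u₁
    t = s * p
    hs′ : Sign t
    hs′ = sign-* hs hp
    τ^w : τpow p q (2 ℕ.+ n) ≡ (t * a , p * (t * b))
    τ^w = trans (cong (mulτ p q τ) τ^n+1) (times-τ hp q s u₀ u₁)
    member : ∀ {x₀ x₁} → StrictDigit q u₀ u₁ x₀ x₁ → D (x₀ , p * x₁)
    member = Membership.strict-digit∈D hp q≥2 digits {u₀} {u₁} hs′ τ^w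
    product : ∀ {s} → Sign s → ∀ x y z t → mulτ p q (s * x , p * (s * y)) (s * z , p * (s * t))
      ≡ (x * z - q * (y * t) , p * (x * t + y * z + y * t))
    product {s} hs x y z t = cong₂ _,_
      (trans (lem₀ p q s x y z t) (trans (cong₂ (λ k l → k * (x * z) - q * (l * (k * (y * t)))) (sign² hs)
        (sign² hp)) (lem₁ q (x * z) (y * t))))
      (trans (lem₂ p s x y z t) (trans (cong₂ (λ k l → p * (k * (x * t + y * z + l * (y * t)))) (sign² hs)
        (sign² hp)) (lem₃ p (x * t + y * z) (y * t))))
      where
      lem₀ : ∀ p q s x y z t → s * x * (s * z) - q * (p * (s * y) * (p * (s * t)))
        ≡ s * s * (x * z) - q * (p * p * (s * s * (y * t)))
      lem₀ = solve-∀
      lem₁ : ∀ q x y → 1ℤ * x - q * (1ℤ * (1ℤ * y)) ≡ x - q * y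
      lem₁ = solve-∀
      lem₂ : ∀ p s x y z t → s * x * (p * (s * t)) + p * (s * y) * (s * z) + p * (p * (s * y) * (p * (s * t)))
        ≡ p * (s * s * (x * t + y * z + p * p * (y * t)))
      lem₂ = solve-∀
      lem₃ : ∀ p x y → p * (1ℤ * (x + 1ℤ * y)) ≡ p * (x + y)
      lem₃ = solve-∀
    add-scaled : ∀ s x y z t → addτ (s * x , p * (s * y)) (s * z , p * (s * t))
      ≡ (s * (x + z) , p * (s * (y + t)))
    add-scaled s x y z t = cong₂ _,_ (sym (ℤ.*-distribˡ-+ s x z)) (lem p s y t)
      where
      lem : ∀ p s y t → p * (s * y) + p * (s * t) ≡ p * (s * (y + t))
      lem = solve-∀
    equal : addτ (c₀ , p * c₁) (mulτ p q (τpow p q (ℕ.suc n)) (s * d₀ , p * (s * d₁)))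
      ≡ addτ (c′₀ , p * c′₁) (mulτ p q (τpow p q (2 ℕ.+ n)) (addτ (t * e₀ , p * (t * e₁)) (τpow p q (2 ℕ.+ n))))
    equal = trans (cong (addτ (c₀ , p * c₁))
      (trans (cong (λ v → mulτ p q v (s * d₀ , p * (s * d₁))) τ^n+1) (product hs u₀ u₁ d₀ d₁)))
      (trans (cong₂ _,_ eq₀ (trans (sym (ℤ.*-distribˡ-+ p c₁ _))
        (trans (cong (p *_) eq₁) (lem p c′₁ a b e₀ e₁))))
      (cong (addτ (c′₀ , p * c′₁)) (sym (trans (cong (λ v → mulτ p q v (addτ (t * e₀ , p * (t * e₁)) v)) τ^w)
        (trans (cong (mulτ p q (t * a , p * (t * b))) (add-scaled t e₀ e₁ a b))
          (product hs′ a b (e₀ + a) (e₁ + b)))))))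
      where
      lem : ∀ p c a b e₀ e₁ → p * (c + (a * (e₁ + b) + b * (e₀ + a) + b * (e₁ + b)))
        ≡ p * c + p * (a * (e₁ + b) + b * (e₀ + a) + b * (e₁ + b))
      lem = solve-∀

  result-nonoptimal : ∀ {n D} → IsMinNormDigitSet p q (2 ℕ.+ n) D → Result q (im q n) (im q (ℕ.suc n)) →
    ¬ NAFOptimal p q (2 ℕ.+ n) D
  result-nonoptimal {n} digits r with power-coordinates hp q (ℕ.suc n)
  result-nonoptimal {n} digits (inj₁ W) | s , hs , eq = witness-nonoptimal digits hs eq W
  -- A witness for -U is one for the same power of τ with the opposite sign s.
  result-nonoptimal {n} digits (inj₂ W) | s , hs , eq = witness-nonoptimal digits (sign-* (inj₁ refl) hs)
    (trans eq (cong₂ _,_ (lem₀ q s (im q n)) (lem₁ p s (im q (ℕ.suc n))))) W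
    where
    lem₀ : ∀ q s x → s * - (q * x) ≡ - (+ 1) * s * - (q * - x)
    lem₀ = solve-∀
    lem₁ : ∀ p s y → p * (s * y) ≡ p * (- (+ 1) * s * - y)
    lem₁ = solve-∀

nonoptimal : ∀ {p} → Sign p → ∀ q n {D} → 2 ≤ q → ¬ (q ≡ 2 × (n ≡ 0 ⊎ n ≡ 1)) →
  IsMinNormDigitSet p (+ q) (2 ℕ.+ n) D →
  ¬ NAFOptimal p (+ q) (2 ℕ.+ n) D
nonoptimal hp (ℕ.suc (ℕ.suc q)) n q≥2 h digits =
  result-nonoptimal hp (lit q) digits (witnesses (2 ℕ.+ q) n q≥2 h)
nonoptimal hp 1 n (ℕ.s≤s ())

-- Optimality for q = 2

_≟τ_ : (x y : Zτ) → Dec (x ≡ y)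
_≟τ_ = ≡-dec ℤ._≟_ ℤ._≟_

-- A state (c , j , v) of the comparison of a w-NAF with another expansion, both read from the least significant digit:
-- the value of the rest of the w-NAF exceeds that of the rest of the other expansion by the carry c, the next j digits
-- of the w-NAF are zero, and the potential v bounds the excess of the weight still to come.
State : Set
State = Zτ × ℕ × ℕ

nextGap : ℕ → ℕ → Zτ → ℕ
nextGap w j ε with ε ≟τ zeroτ
... | yes _ = j ∸ 1
... | no _ = w ∸ 1

Successor : ℕ → State → (ε φ : Zτ) → Zτ → State → Set
Successor w (c , j , v) ε φ c′ (c″ , j′ , v′) =
  c″ ≡ c′ × j′ ≡ nextGap w j ε × weight (ε ∷ []) ℕ.+ v′ ≤ weight (φ ∷ []) ℕ.+ v

Closed : ℤ → ℕ → List State → State → (ε φ : Zτ) → Set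
Closed p w table st@(c , j , v) ε φ = (j ≢ 0 → ε ≡ zeroτ) →
  ∀ c′ → mulτ p (+ 2) τ c′ ≡ subτ (addτ φ c) ε → Any (Successor w st ε φ c′) table

weight-∷ : ∀ σ σs → weight (σ ∷ σs) ≡ weight (σ ∷ []) ℕ.+ weight σs
weight-∷ σ σs with ≡-dec ℤ._≟_ ℤ._≟_ σ zeroτ
... | yes _ = refl
... | no _ = refl

module Potential (p : ℤ) (w : ℕ) (S : List Zτ) (zero∈S : zeroτ ∈ S) (table : List State)
  (closed : All (λ st → All (λ ε → All (Closed p w table st ε) S) S) table) where

  after : ∀ {j ε σs} → (ε ≢ zeroτ → ZerosUpTo (w ∸ 1) σs) → ZerosUpTo j (ε ∷ σs) → ZerosUpTo (nextGap w j ε) σs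
  after {j} {ε} h zs with ε ≟τ zeroτ
  after {0} h zs | yes _ = tt
  after {ℕ.suc j} h zs | yes _ = proj₂ zs
  ... | no ε≢0 = h ε≢0

  forced : ∀ {j ε σs} → ZerosUpTo j (ε ∷ σs) → j ≢ 0 → ε ≡ zeroτ
  forced {0} _ j≢0 = contradiction refl j≢0
  forced {ℕ.suc j} zs _ = proj₁ zs

  -- Each pair of digits changes the potential by at least the excess of weight it causes, so the
  -- inequalities of the table telescope. The forced zeros are part of the state because they
  -- exclude the digit pairs that would break them.
  naf-bound : ∀ e f {c j v} → (c , j , v) ∈ table → AllIn (_∈ S) e → AllIn (_∈ S) f → IsNAF w e →
    ZerosUpTo j e →
    eval p (+ 2) e ≡ addτ (eval p (+ 2) f) c → weight e ≤ weight f ℕ.+ v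
  naf-step : ∀ ε e φ f {c j v} → (c , j , v) ∈ table → AllIn (_∈ S) (ε ∷ e) → AllIn (_∈ S) (φ ∷ f) →
    IsNAF w (ε ∷ e) →
    ZerosUpTo j (ε ∷ e) → eval p (+ 2) (ε ∷ e) ≡ addτ (eval p (+ 2) (φ ∷ f)) c →
      weight (ε ∷ e) ≤ weight (φ ∷ f) ℕ.+ v

  naf-bound [] f _ _ _ _ _ _ = ℕ.z≤n
  -- An exhausted competitor is padded with zeros, so the induction runs along the w-NAF alone.
  naf-bound (ε ∷ e) [] {c} {v = v} st∈ he hf naf zs eq = naf-step ε e zeroτ [] st∈ he (zero∈S , tt) naf zs
    (trans eq (cong (λ x → addτ x c) (sym (eval-singleton p (+ 2) zeroτ))))
  naf-bound (ε ∷ e) (φ ∷ f) = naf-step ε e φ f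

  naf-step ε e φ f {c} {j} {v} st∈ (ε∈S , he) (φ∈S , hf) (gap , naf) zs eq
    with find (All.lookup (All.lookup (All.lookup closed st∈) ε∈S) φ∈S (forced {j} zs) c′ carried)
    where
    E F c′ : Zτ
    E = eval p (+ 2) e
    F = eval p (+ 2) f
    c′ = subτ E F
    carried : mulτ p (+ 2) τ c′ ≡ subτ (addτ φ c) ε
    carried = cong₂ _,_
      (trans (lem₀ (proj₁ E) (proj₂ E) (proj₁ F) (proj₂ F) (proj₁ ε) (proj₁ φ))
        (trans (cong (λ x → x - (proj₁ φ + (0ℤ * proj₁ F - + 2 * (1ℤ * proj₂ F))) + (proj₁ φ - proj₁ ε))
        (cong proj₁ eq)) (lem₁ (proj₁ φ) (0ℤ * proj₁ F - + 2 * (1ℤ * proj₂ F)) (proj₁ c) (proj₁ ε))))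
      (trans (lem₂ p (proj₁ E) (proj₂ E) (proj₁ F) (proj₂ F) (proj₂ ε) (proj₂ φ))
        (trans (cong (λ x → x - (proj₂ φ + (0ℤ * proj₂ F + 1ℤ * proj₁ F + p * (1ℤ * proj₂ F)))
        + (proj₂ φ - proj₂ ε)) (cong proj₂ eq))
        (lem₁ (proj₂ φ) (0ℤ * proj₂ F + 1ℤ * proj₁ F + p * (1ℤ * proj₂ F)) (proj₂ c) (proj₂ ε))))
      where
      lem₀ : ∀ e₀ e₁ f₀ f₁ ε φ → 0ℤ * (e₀ - f₀) - + 2 * (1ℤ * (e₁ - f₁)) ≡
        ε + (0ℤ * e₀ - + 2 * (1ℤ * e₁)) - (φ + (0ℤ * f₀ - + 2 * (1ℤ * f₁))) + (φ - ε)
      lem₀ = solve-∀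
      lem₁ : ∀ φ t c ε → φ + t + c - (φ + t) + (φ - ε) ≡ φ + c - ε
      lem₁ = solve-∀
      lem₂ : ∀ p e₀ e₁ f₀ f₁ ε φ → 0ℤ * (e₁ - f₁) + 1ℤ * (e₀ - f₀) + p * (1ℤ * (e₁ - f₁)) ≡
        ε + (0ℤ * e₁ + 1ℤ * e₀ + p * (1ℤ * e₁)) - (φ + (0ℤ * f₁ + 1ℤ * f₀ + p * (1ℤ * f₁))) + (φ - ε)
      lem₂ = solve-∀
  ... | (_ , _ , v′) , st′∈ , refl , refl , potential = begin
    weight (ε ∷ e)                                ≡⟨ weight-∷ ε e ⟩
    weight (ε ∷ []) ℕ.+ weight e                  ≤⟨ ℕ.+-monoʳ-≤ (weight (ε ∷ []))
      (naf-bound e f st′∈ he hf naf (after {j} gap zs) E≡F+c′) ⟩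
    weight (ε ∷ []) ℕ.+ (weight f ℕ.+ v′)         ≡⟨ cong (weight (ε ∷ []) ℕ.+_) (ℕ.+-comm (weight f) v′) ⟩
    weight (ε ∷ []) ℕ.+ (v′ ℕ.+ weight f)         ≡⟨ ℕ.+-assoc (weight (ε ∷ [])) v′ (weight f) ⟨
    weight (ε ∷ []) ℕ.+ v′ ℕ.+ weight f           ≤⟨ ℕ.+-monoˡ-≤ (weight f) potential ⟩
    weight (φ ∷ []) ℕ.+ v ℕ.+ weight f            ≡⟨ ℕ.+-assoc (weight (φ ∷ [])) v (weight f) ⟩
    weight (φ ∷ []) ℕ.+ (v ℕ.+ weight f)          ≡⟨ cong (weight (φ ∷ []) ℕ.+_) (ℕ.+-comm v (weight f)) ⟩
    weight (φ ∷ []) ℕ.+ (weight f ℕ.+ v)          ≡⟨ ℕ.+-assoc (weight (φ ∷ [])) (weight f) v ⟨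
    weight (φ ∷ []) ℕ.+ weight f ℕ.+ v            ≡⟨ cong (ℕ._+ v) (weight-∷ φ f) ⟨
    weight (φ ∷ f) ℕ.+ v                          ∎
    where
    open ℕ.≤-Reasoning
    E F : Zτ
    E = eval p (+ 2) e
    F = eval p (+ 2) f
    lem : ∀ x y → x ≡ y + (x - y)
    lem = solve-∀
    E≡F+c′ : E ≡ addτ F (subτ E F)
    E≡F+c′ = cong₂ _,_ (lem (proj₁ E) (proj₁ F)) (lem (proj₂ E) (proj₂ F))

-- From τ(p - τ) = 2, the quotient of 2k + z₁τ by τ is z₁ + k(p - τ).
quotient-unique : ∀ p {z₀ z₁} k → z₀ ≡ k * + 2 → ∀ c′ → mulτ p (+ 2) τ c′ ≡ (z₀ , z₁) → c′ ≡ (z₁ + p * k , - k)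
quotient-unique p {z₁ = z₁} k z₀-eq (a , b) eq = cong₂ _,_
  (trans (lem₁ p a b) (cong₂ (λ x y → x - p * y) (cong proj₂ eq) b≡-k)) b≡-k ⟫ lem₂ p z₁ k
  where
  b≡-k : b ≡ - k
  b≡-k = ℤ.*-cancelʳ-≡ b (- k) (+ 2) (trans (lem₀ a b)
    (trans (cong -_ (trans (cong proj₁ eq) z₀-eq)) (ℤ.neg-distribˡ-* k (+ 2))))
    where
    lem₀ : ∀ a b → b * + 2 ≡ - (0ℤ * a - + 2 * (1ℤ * b))
    lem₀ = solve-∀
  lem₁ : ∀ p a b → a ≡ 0ℤ * b + 1ℤ * a + p * (1ℤ * b) - p * b
  lem₁ = solve-∀
  lem₂ : ∀ p z k → z - p * - k ≡ z + p * k
  lem₂ = solve-∀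
  _⟫_ : ∀ {c : Zτ} {x y b} → c ≡ (x , b) → x ≡ y → c ≡ (y , b)
  refl ⟫ refl = refl

quotient-correct : ∀ {p} → Sign p → ∀ {z₀} z₁ k → z₀ ≡ k * + 2 → mulτ p (+ 2) τ (z₁ + p * k , - k) ≡ (z₀ , z₁)
quotient-correct {p} hp z₁ k refl = cong₂ _,_ (lem₀ p z₁ k) (lem₁ p z₁ k)
  where
  lem₀ : ∀ p z k → 0ℤ * (z + p * k) - + 2 * (1ℤ * - k) ≡ k * + 2
  lem₀ = solve-∀
  lem₁ : ∀ p z k → 0ℤ * - k + 1ℤ * (z + p * k) + p * (1ℤ * - k) ≡ z
  lem₁ = solve-∀

module _ {p : ℤ} (hp : Sign p) where
  successor? : ∀ w st ε φ c′ st′ → Dec (Successor w st ε φ c′ st′)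
  successor? w (c , j , v) ε φ c′ (c″ , j′ , v′) =
    c″ ≟τ c′ ×-dec j′ ℕ.≟ nextGap w j ε ×-dec weight (ε ∷ []) ℕ.+ v′ ℕ.≤? weight (φ ∷ []) ℕ.+ v

  closed? : ∀ w table st ε φ → Dec (Closed p w table st ε φ)
  closed? w table st@(c , j , v) ε φ with ¬? (j ℕ.≟ 0) →-dec (ε ≟τ zeroτ)
  ... | no ¬legal = yes λ legal → contradiction legal ¬legal
  ... | yes legal with + 2 ∣? proj₁ (subτ (addτ φ c) ε)
  -- Multiples of τ have even first coordinate, so this pair of digits cannot occur with this carry.
  ...   | no odd = yes λ _ c′ eq → contradiction
    (divides (- proj₂ c′) (trans (sym (cong proj₁ eq)) (lem (proj₁ c′) (proj₂ c′)))) odd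
    where
    lem : ∀ a b → 0ℤ * a - + 2 * (1ℤ * b) ≡ - b * + 2
    lem = solve-∀
  ...   | yes (divides k eq) = map′
    (λ found _ c′ eq′ → subst (λ c → Any (Successor w st ε φ c) table)
      (sym (quotient-unique p k eq c′ eq′)) found)
    (λ h → h legal _ (quotient-correct hp (proj₂ (subτ (addτ φ c) ε)) k eq))
    (any? (successor? w st ε φ (proj₂ (subτ (addτ φ c) ε) + p * k , - k)) table)

-- Carry tables and digit sets for q = 2

-- (a , b , j , v) describes the two states with carries ±(a + bθ), j forced zeros and potential v.  The tables contain the
-- states reachable from zero, and v is the greatest possible excess of weight on the way back to carry zero.
Entry : Set
Entry = ℤ × ℤ × ℕ × ℕ

symmetric : ℤ → List Entry → List State
symmetric p = concatMap λ { (a , b , j , v) → ((a , p * b) , j , v) ∷ ((- a , - (p * b)) , j , v) ∷ [] }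

table₂ table₃ : List Entry
table₂ =
  (+ 0 , + 0 , 0 , 0) ∷ (+ 0 , + 0 , 1 , 0) ∷ (+ 1 , + 0 , 0 , 1) ∷ (+ 1 , + 0 , 1 , 1) ∷ (+ 0 , + 1 , 0 , 1) ∷
  (+ 0 , + 1 , 1 , 1) ∷ (+ 1 , - + 1 , 0 , 2) ∷ (+ 1 , - + 1 , 1 , 0) ∷ (+ 2 , - + 1 , 1 , 1) ∷ []
table₃ =
  (+ 0 , + 0 , 0 , 0) ∷ (+ 0 , + 0 , 1 , 0) ∷ (+ 0 , + 0 , 2 , 0) ∷ (+ 1 , + 0 , 0 , 1) ∷ (+ 1 , + 0 , 1 , 0) ∷
  (+ 1 , + 0 , 2 , 0) ∷ (+ 0 , + 1 , 0 , 1) ∷ (+ 0 , + 1 , 1 , 1) ∷ (+ 0 , + 1 , 2 , 0)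
    ∷ (+ 1 , - + 1 , 0 , 1) ∷
  (+ 1 , - + 1 , 1 , 1) ∷ (+ 1 , - + 1 , 2 , 0) ∷ (+ 1 , + 1 , 0 , 2) ∷ (+ 1 , + 1 , 1 , 0)
    ∷ (+ 1 , + 1 , 2 , 0) ∷
  (+ 2 , - + 1 , 0 , 1) ∷ (+ 2 , - + 1 , 1 , 1) ∷ (+ 2 , - + 1 , 2 , 1) ∷ (+ 2 , + 0 , 0 , 1)
    ∷ (+ 2 , + 0 , 1 , 1) ∷
  (+ 2 , + 0 , 2 , 1) ∷ (+ 1 , - + 2 , 0 , 2) ∷ (+ 1 , - + 2 , 1 , 1) ∷ (+ 1 , - + 2 , 2 , 0)
    ∷ (+ 0 , + 2 , 0 , 1) ∷
  (+ 0 , + 2 , 1 , 1) ∷ (+ 0 , + 2 , 2 , 1) ∷ (+ 2 , - + 2 , 0 , 2) ∷ (+ 2 , - + 2 , 1 , 2)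
    ∷ (+ 2 , - + 2 , 2 , 0) ∷
  (+ 2 , + 1 , 0 , 1) ∷ (+ 2 , + 1 , 1 , 1) ∷ (+ 2 , + 1 , 2 , 1) ∷ (+ 3 , - + 1 , 0 , 2)
    ∷ (+ 3 , - + 1 , 1 , 1) ∷
  (+ 3 , - + 1 , 2 , 0) ∷ (+ 3 , + 0 , 0 , 2) ∷ (+ 3 , + 0 , 1 , 1) ∷ (+ 3 , + 0 , 2 , 1)
    ∷ (+ 1 , + 2 , 0 , 2) ∷
  (+ 1 , + 2 , 1 , 1) ∷ (+ 1 , + 2 , 2 , 0) ∷ (+ 3 , - + 2 , 1 , 1) ∷ (+ 3 , - + 2 , 2 , 0)
    ∷ (+ 3 , + 1 , 2 , 1) ∷
  (+ 2 , + 2 , 2 , 1) ∷ []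

-- In terms of θ these are 0, ±1 and 0, ±1, ±(1 - θ). There are 2^w - 2^(w-1) classes not divisible
-- by τ, that is 2 and 4, and these representatives lie in the open cell, so `D` has no choice.
digits₂ digits₃ : ℤ → List Zτ
digits₂ p = zeroτ ∷ (1ℤ , p * 0ℤ) ∷ (- 1ℤ , p * 0ℤ) ∷ []
digits₃ p = zeroτ ∷ (1ℤ , p * 0ℤ) ∷ (- 1ℤ , p * 0ℤ) ∷ (1ℤ , p * - 1ℤ) ∷ (- 1ℤ , p * 1ℤ) ∷ []

ClosedTable : ℤ → ℕ → List Zτ → List State → Set
ClosedTable p w S table = All (λ st → All (λ ε → All (Closed p w table st ε) S) S) table

closedTable? : ∀ {p} → Sign p → ∀ w S table → Dec (ClosedTable p w S table)
closedTable? hp w S table = all? (λ st → all? (λ ε → all? (closed? hp w table st ε) S) S) table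

closed₂ : ∀ {p} → Sign p → ClosedTable p 2 (digits₂ p) (symmetric p table₂)
closed₂ hp@(inj₁ refl) = toWitness {a? = closedTable? hp 2 _ _} tt
closed₂ hp@(inj₂ refl) = toWitness {a? = closedTable? hp 2 _ _} tt

closed₃ : ∀ {p} → Sign p → ClosedTable p 3 (digits₃ p) (symmetric p table₃)
closed₃ hp@(inj₁ refl) = toWitness {a? = closedTable? hp 3 _ _} tt
closed₃ hp@(inj₂ refl) = toWitness {a? = closedTable? hp 3 _ _} tt

-- τ² = pτ - 2 gives τ ≡ 2p modulo τ², and τ² divides 4. Hence d₀ + d₁τ is determined by d₀ + 2pd₁
-- modulo 4.
congruent₂ : ∀ {p} → Sign p → ∀ r j d₁ → CongMod p (+ 2) 2 (r + + 4 * j - + 2 * (p * d₁) , d₁) (r , p * 0ℤ)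
congruent₂ (inj₁ refl) r j d₁ = (- (+ 1) * d₁ - j , j) , cong₂ _,_ (lem₀ r j d₁) (lem₁ j d₁)
  where
  lem₀ : ∀ r j d → r + + 4 * j - + 2 * (- (+ 1) * d) - r ≡ (- (+ 1) * d - j) * - (+ 2) - + 2 * (j * - (+ 1))
  lem₀ = solve-∀
  lem₁ : ∀ j d → d - 0ℤ ≡ (- (+ 1) * d - j) * - (+ 1) + j * - (+ 2) + - (+ 1) * (j * - (+ 1))
  lem₁ = solve-∀
congruent₂ (inj₂ refl) r j d₁ = (d₁ - j , - j) , cong₂ _,_ (lem₀ r j d₁) (lem₁ j d₁)
  where
  lem₀ : ∀ r j d → r + + 4 * j - + 2 * (+ 1 * d) - r ≡ (d - j) * - (+ 2) - + 2 * (- j * + 1)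
  lem₀ = solve-∀
  lem₁ : ∀ j d → d - 0ℤ ≡ (d - j) * + 1 + - j * - (+ 2) + + 1 * (- j * + 1)
  lem₁ = solve-∀

-- τ³ = -τ - 2p gives τ ≡ -2p modulo τ³, and τ³ divides 8. Hence d₀ + d₁τ is determined by d₀ - 2pd₁
-- modulo 8; the digits ±(1 - θ) represent the classes of ±3.
congruent₃ : ∀ {p} → Sign p → ∀ r₀ r₁ j d₁ →
  CongMod p (+ 2) 3 (r₀ + + 8 * j + + 2 * (p * (d₁ - p * r₁)) , d₁) (r₀ , p * r₁)
congruent₃ (inj₁ refl) r₀ r₁ j d₁ = (+ 3 * j - (d₁ - - (+ 1) * r₁) , j) , cong₂ _,_ (lem₀ r₀ r₁ j d₁)
  (lem₁ r₁ j d₁)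
  where
  lem₀ : ∀ r s j d → r + + 8 * j + + 2 * (- (+ 1) * (d - - (+ 1) * s)) - r
    ≡ (+ 3 * j - (d - - (+ 1) * s)) * + 2 - + 2 * (j * - (+ 1))
  lem₀ = solve-∀
  lem₁ : ∀ s j d → d - - (+ 1) * s ≡ (+ 3 * j - (d - - (+ 1) * s)) * - (+ 1) + j * + 2 + - (+ 1) * (j * - (+ 1))
  lem₁ = solve-∀
congruent₃ (inj₂ refl) r₀ r₁ j d₁ = (- (+ 3) * j - (d₁ - + 1 * r₁) , j) , cong₂ _,_ (lem₀ r₀ r₁ j d₁)
  (lem₁ r₁ j d₁)
  where
  lem₀ : ∀ r s j d → r + + 8 * j + + 2 * (+ 1 * (d - + 1 * s)) - r
    ≡ (- (+ 3) * j - (d - + 1 * s)) * - (+ 2) - + 2 * (j * - (+ 1))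
  lem₀ = solve-∀
  lem₁ : ∀ s j d → d - + 1 * s ≡ (- (+ 3) * j - (d - + 1 * s)) * - (+ 1) + j * - (+ 2) + + 1 * (j * - (+ 1))
  lem₁ = solve-∀

even-divisible : ∀ {p} i d₁ → DivByτ p (+ 2) (+ 2 * i , d₁)
even-divisible {p} i d₁ = (d₁ + p * i , - i) , cong₂ _,_ (lem₀ p i d₁) (lem₁ p i d₁)
  where
  lem₀ : ∀ p i d → + 2 * i ≡ (d + p * i) * 0ℤ - + 2 * (- i * 1ℤ)
  lem₀ = solve-∀
  lem₁ : ∀ p i d → d ≡ (d + p * i) * 1ℤ + - i * 0ℤ + p * (- i * 1ℤ)
  lem₁ = solve-∀

odd-mod-4 : ∀ x → (∃ λ j → 1ℤ + + 2 * x ≡ 1ℤ + + 4 * j) ⊎ (∃ λ j → 1ℤ + + 2 * x ≡ - 1ℤ + + 4 * j)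
odd-mod-4 x with parity x
... | inj₁ (j , refl) = inj₁ (j , lem j)
  where
  lem : ∀ j → 1ℤ + + 2 * (+ 2 * j) ≡ 1ℤ + + 4 * j
  lem = solve-∀
... | inj₂ (j , refl) = inj₂ (j + 1ℤ , lem j)
  where
  lem : ∀ j → 1ℤ + + 2 * (1ℤ + + 2 * j) ≡ - 1ℤ + + 4 * (j + 1ℤ)
  lem = solve-∀

odd-mod-8 : ∀ x → (∃ λ j → 1ℤ + + 2 * x ≡ 1ℤ + + 8 * j ⊎ 1ℤ + + 2 * x ≡ - 1ℤ + + 8 * j ⊎
  1ℤ + + 2 * x ≡ + 3 + + 8 * j ⊎ 1ℤ + + 2 * x ≡ - + 3 + + 8 * j)
odd-mod-8 x with odd-mod-4 x
... | inj₁ (j , eq) with parity j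
...   | inj₁ (k , refl) = k , inj₁ (trans eq (lem k))
  where
  lem : ∀ k → 1ℤ + + 4 * (+ 2 * k) ≡ 1ℤ + + 8 * k
  lem = solve-∀
...   | inj₂ (k , refl) = k + 1ℤ , inj₂ (inj₂ (inj₂ (trans eq (lem k))))
  where
  lem : ∀ k → 1ℤ + + 4 * (1ℤ + + 2 * k) ≡ - + 3 + + 8 * (k + 1ℤ)
  lem = solve-∀
odd-mod-8 x | inj₂ (j , eq) with parity j
...   | inj₁ (k , refl) = k , inj₂ (inj₁ (trans eq (lem k)))
  where
  lem : ∀ k → - 1ℤ + + 4 * (+ 2 * k) ≡ - 1ℤ + + 8 * k
  lem = solve-∀
...   | inj₂ (k , refl) = k , inj₂ (inj₂ (inj₁ (trans eq (lem k))))
  where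
  lem : ∀ k → - 1ℤ + + 4 * (1ℤ + + 2 * k) ≡ + 3 + + 8 * k
  lem = solve-∀

module DigitSet {p : ℤ} (hp : Sign p) {w : ℕ} {D : Zτ → Set} (digits : IsMinNormDigitSet p (+ 2) w D) where
  open IsMinNormDigitSet digits

  -- A nonzero digit is not divisible by τ, so its first coordinate is odd; by uniqueness in `D` it
  -- equals the listed representative of its class.
  identify : ∀ {S : List Zτ} → zeroτ ∈ S →
    (∀ i d₁ → ∃ λ r → r ∈ S × D r × CongMod p (+ 2) w (1ℤ + + 2 * i , d₁) r) → ∀ d → D d → d ∈ S
  identify {S} zero∈S representative (d₀ , d₁) d∈D with digitsOk (d₀ , d₁) d∈D | parity d₀
  ... | inj₁ refl | _ = zero∈S
  ... | inj₂ ¬div | inj₁ (i , refl) = contradiction (even-divisible {p} i d₁) ¬div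
  ... | inj₂ ¬div | inj₂ (i , refl) with representative i d₁
  ...   | r , r∈S , r∈D , cong-r = subst (_∈ S) (sym (unique _ r d∈D r∈D ¬div cong-r)) r∈S

  module Width₂ (τ^w : τpow p (+ 2) w ≡ (1ℤ * - (+ 2 * 1ℤ) , p * (1ℤ * (0ℤ + 1ℤ))))
    (congruent : ∀ r j d₁ → CongMod p (+ 2) w (r + + 4 * j - + 2 * (p * d₁) , d₁) (r , p * 0ℤ)) where
    member : ∀ x₀ x₁ → {True (strict? (+ 2) 0ℤ 1ℤ x₀ x₁)} → D (x₀ , p * x₁)
    member x₀ x₁ {h} = Membership.strict-digit∈D hp (lit 0) digits {0ℤ} {1ℤ} {1ℤ} (inj₂ refl) τ^w (toWitness h)

    shift : ∀ i d₁ r j → 1ℤ + + 2 * (i + p * d₁) ≡ r + + 4 * j → 1ℤ + + 2 * i ≡ r + + 4 * j - + 2 * (p * d₁)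
    shift i d₁ r j eq = trans (lem i (p * d₁)) (cong (_- + 2 * (p * d₁)) eq)
      where
      lem : ∀ i x → 1ℤ + + 2 * i ≡ 1ℤ + + 2 * (i + x) - + 2 * x
      lem = solve-∀

    at : ∀ i d₁ r j → 1ℤ + + 2 * (i + p * d₁) ≡ r + + 4 * j → CongMod p (+ 2) w (1ℤ + + 2 * i , d₁) (r , p * 0ℤ)
    at i d₁ r j eq = subst (λ d → CongMod p (+ 2) w (d , d₁) (r , p * 0ℤ)) (sym (shift i d₁ r j eq))
      (congruent r j d₁)

    digits∈ : ∀ d → D d → d ∈ digits₂ p
    digits∈ = identify (here refl) λ i d₁ → represent i d₁ (odd-mod-4 (i + p * d₁))
      where
      represent : ∀ i d₁ → (∃ λ j → 1ℤ + + 2 * (i + p * d₁) ≡ 1ℤ + + 4 * j)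
        ⊎ (∃ λ j → 1ℤ + + 2 * (i + p * d₁) ≡ - 1ℤ + + 4 * j) →
        ∃ λ r → r ∈ digits₂ p × D r × CongMod p (+ 2) w (1ℤ + + 2 * i , d₁) r
      represent i d₁ (inj₁ (j , eq)) = _ , there (here refl) , member 1ℤ 0ℤ , at i d₁ 1ℤ j eq
      represent i d₁ (inj₂ (j , eq)) = _ , there (there (here refl)) , member (- 1ℤ) 0ℤ , at i d₁ (- 1ℤ) j eq

  module Width₃ (τ^w : τpow p (+ 2) w ≡ (p * - (+ 2 * 1ℤ) , p * (p * (- + 2 + 1ℤ))))
    (congruent : ∀ r₀ r₁ j d₁ → CongMod p (+ 2) w (r₀ + + 8 * j + + 2 * (p * (d₁ - p * r₁)) , d₁)
      (r₀ , p * r₁)) where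
    member : ∀ x₀ x₁ → {True (strict? (+ 2) (- + 2) 1ℤ x₀ x₁)} → D (x₀ , p * x₁)
    member x₀ x₁ {h} = Membership.strict-digit∈D hp (lit 0) digits { - + 2} {1ℤ} {p} hp τ^w (toWitness h)

    shift : ∀ i d₁ r₀ r₁ j → 1ℤ + + 2 * (i - p * d₁) ≡ r₀ - + 2 * r₁ + + 8 * j →
      1ℤ + + 2 * i ≡ r₀ + + 8 * j + + 2 * (p * (d₁ - p * r₁))
    shift i d₁ r₀ r₁ j eq = trans (lem i (p * d₁)) (trans (cong (λ x → x + + 2 * (p * d₁)) eq)
      (trans (cong (λ pp → r₀ - + 2 * (pp * r₁) + + 8 * j + + 2 * (p * d₁)) (sym (sign² hp)) ∘′ lem″ r₀ r₁ j
        (p * d₁)) (lem′ p r₀ r₁ j d₁)))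
      where
      lem : ∀ i x → 1ℤ + + 2 * i ≡ 1ℤ + + 2 * (i - x) + + 2 * x
      lem = solve-∀
      lem″ : ∀ r s j x → r - + 2 * s + + 8 * j + + 2 * x ≡ r - + 2 * (1ℤ * s) + + 8 * j + + 2 * x
      lem″ = solve-∀
      lem′ : ∀ p r s j d → r - + 2 * (p * p * s) + + 8 * j + + 2 * (p * d)
        ≡ r + + 8 * j + + 2 * (p * (d - p * s))
      lem′ = solve-∀
      _∘′_ : ∀ {x y z : ℤ} → y ≡ z → x ≡ y → x ≡ z
      a ∘′ b = trans b a

    at : ∀ i d₁ r₀ r₁ j → 1ℤ + + 2 * (i - p * d₁) ≡ r₀ - + 2 * r₁ + + 8 * j →
      CongMod p (+ 2) w (1ℤ + + 2 * i , d₁) (r₀ , p * r₁)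
    at i d₁ r₀ r₁ j eq = subst (λ d → CongMod p (+ 2) w (d , d₁) (r₀ , p * r₁)) (sym (shift i d₁ r₀ r₁ j eq))
      (congruent r₀ r₁ j d₁)

    digits∈ : ∀ d → D d → d ∈ digits₃ p
    digits∈ = identify (here refl) λ i d₁ → represent i d₁ (odd-mod-8 (i - p * d₁))
      where
      represent : ∀ i d₁ → (∃ λ j → 1ℤ + + 2 * (i - p * d₁) ≡ 1ℤ + + 8 * j ⊎ 1ℤ + + 2 * (i - p * d₁)
        ≡ - 1ℤ + + 8 * j ⊎
          1ℤ + + 2 * (i - p * d₁) ≡ + 3 + + 8 * j ⊎ 1ℤ + + 2 * (i - p * d₁) ≡ - + 3 + + 8 * j) →
        ∃ λ r → r ∈ digits₃ p × D r × CongMod p (+ 2) w (1ℤ + + 2 * i , d₁) r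
      represent i d₁ (j , inj₁ eq) = _ , there (here refl) , member 1ℤ 0ℤ , at i d₁ 1ℤ 0ℤ j eq
      represent i d₁ (j , inj₂ (inj₁ eq)) = _ , there (there (here refl)) , member (- 1ℤ) 0ℤ , at i d₁
        (- 1ℤ) 0ℤ j eq
      represent i d₁ (j , inj₂ (inj₂ (inj₁ eq))) =
        _ , there (there (there (here refl))) , member 1ℤ (- 1ℤ) , at i d₁ 1ℤ (- 1ℤ) j eq
      represent i d₁ (j , inj₂ (inj₂ (inj₂ eq))) =
        _ , there (there (there (there (here refl)))) , member (- 1ℤ) 1ℤ , at i d₁ (- 1ℤ) 1ℤ j eq

allIn-map : ∀ {A B : Zτ → Set} → (∀ d → A d → B d) → ∀ xs → AllIn A xs → AllIn B xs
allIn-map h [] _ = tt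
allIn-map h (x ∷ xs) (a , as) = h x a , allIn-map h xs as

optimal-of-table : ∀ p w S table {D} → zeroτ ∈ S → (zeroτ , 0 , 0) ∈ table → ClosedTable p w S table →
  (∀ d → D d → d ∈ S) → NAFOptimal p (+ 2) w D
optimal-of-table p w S table zero∈S start∈ closed digits∈ e f he hf naf eq =
  -- The comparison starts with carry 0, no forced zeros and potential 0, so the excess of weight is
  -- at most 0.
  subst (weight e ≤_) (ℕ.+-identityʳ _)
  (Potential.naf-bound p w S zero∈S table closed e f start∈ (allIn-map digits∈ e he)
    (allIn-map digits∈ f hf) naf tt
    (trans eq (cong₂ _,_ (sym (ℤ.+-identityʳ _)) (sym (ℤ.+-identityʳ _)))))

optimal₂ : ∀ {p} → Sign p → ∀ {D} → IsMinNormDigitSet p (+ 2) 2 D → NAFOptimal p (+ 2) 2 D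
optimal₂ hp@(inj₁ refl) digits = optimal-of-table _ 2 _ _ (here refl) (here refl) (closed₂ hp)
  (DigitSet.Width₂.digits∈ hp digits refl (congruent₂ hp))
optimal₂ hp@(inj₂ refl) digits = optimal-of-table _ 2 _ _ (here refl) (here refl) (closed₂ hp)
  (DigitSet.Width₂.digits∈ hp digits refl (congruent₂ hp))

optimal₃ : ∀ {p} → Sign p → ∀ {D} → IsMinNormDigitSet p (+ 2) 3 D → NAFOptimal p (+ 2) 3 D
optimal₃ hp@(inj₁ refl) digits = optimal-of-table _ 3 _ _ (here refl) (here refl) (closed₃ hp)
  (DigitSet.Width₃.digits∈ hp digits refl (congruent₃ hp))
optimal₃ hp@(inj₂ refl) digits = optimal-of-table _ 3 _ _ (here refl) (here refl) (closed₃ hp)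
  (DigitSet.Width₃.digits∈ hp digits refl (congruent₃ hp))

characterisation : ∀ q n {p} → Sign p → 2 ≤ q → ∀ D → IsMinNormDigitSet p (+ q) (2 ℕ.+ n) D →
  NAFOptimal p (+ q) (2 ℕ.+ n) D ⇔ (+ q ≡ + 2 × (2 ℕ.+ n ≡ 2 ⊎ 2 ℕ.+ n ≡ 3))
characterisation q n {p} hp q≥2 D digits = mk⇔ to from
  where
  exceptional? : ∀ q n → Dec (q ≡ 2 × (n ≡ 0 ⊎ n ≡ 1))
  exceptional? q n = (q ℕ.≟ 2) ×-dec ((n ℕ.≟ 0) ⊎-dec (n ℕ.≟ 1))
  to : NAFOptimal p (+ q) (2 ℕ.+ n) D → + q ≡ + 2 × (2 ℕ.+ n ≡ 2 ⊎ 2 ℕ.+ n ≡ 3)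
  to optimal with exceptional? q n
  ... | yes (refl , inj₁ refl) = refl , inj₁ refl
  ... | yes (refl , inj₂ refl) = refl , inj₂ refl
  ... | no h = contradiction optimal (nonoptimal hp q n q≥2 h digits)
  from : + q ≡ + 2 × (2 ℕ.+ n ≡ 2 ⊎ 2 ℕ.+ n ≡ 3) → NAFOptimal p (+ q) (2 ℕ.+ n) D
  from (refl , inj₁ refl) = optimal₂ hp digits
  from (refl , inj₂ refl) = optimal₃ hp digits

theorem2p4 : (q : ℤ) (w : ℕ) (p : ℤ) →
    ((+ 2 Data.Integer.≤ q × q Data.Integer.≤ + 500 × 2 ≤ w) ⊎ (+ 2 Data.Integer.≤ q × (w ≡ 2 ⊎ w ≡ 3))) →
    (p ≡ - (+ 1) ⊎ p ≡ + 1) →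
    (D : Zτ → Set) → IsMinNormDigitSet p q w D →
    (NAFOptimal p q w D ⇔ (q ≡ + 2 × (w ≡ 2 ⊎ w ≡ 3)))
theorem2p4 (+ q) (ℕ.suc (ℕ.suc n)) p (inj₁ (+≤+ q≥2 , _ , _)) hp = characterisation q n hp q≥2
theorem2p4 (+ q) _ p (inj₂ (+≤+ q≥2 , inj₁ refl)) hp = characterisation q 0 hp q≥2
theorem2p4 (+ q) _ p (inj₂ (+≤+ q≥2 , inj₂ refl)) hp = characterisation q 1 hp q≥2
theorem2p4 (+ q) 1 p (inj₁ (_ , _ , ℕ.s≤s ()))
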